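{- The pair $(K_3,C_4^{\triangle})$ is forcing. That is, for every $p\in(0,1]$ and $\varepsilon>0$ there is some $\delta>0$ such that every graph $G$ satisfying \[ t(K_3,G)\ge(1-\delta)p^{3}\quad\text{and}\quad t(C_4^{\triangle},G)\le(1+\delta)p^{12} \] is $(\varepsilon,p)$-quasirandom.
   Context: Graphs are finite, simple and undirected, with nonempty vertex set. For graphs $F$ and $G$, $\hom(F,G)$ is the number of graph homomorphisms from $F$ to $G$, and $t(F,G)=\hom(F,G)/|V(G)|^{|V(F)|}$ is the homomorphism density. $K_3$ is the triangle. For a graph $F$, the graph $F^{\triangle}$ is obtained from $F$ by replacing every edge by a triangle, each of which introduces a new vertex: for every edge $uv\in E(F)$ one adds a new vertex $w_{uv}$ (distinct for distinct edges) together with the edges $uw_{uv}$ and $vw_{uv}$, keeping the edge $uv$. Thus $C_4^{\triangle}$, obtained from the 4-cycle $C_4$, has 8 vertices and 12 edges. For $X,Y\subseteq V$, $e_G(X,Y)$ is the number of ordered pairs $(x,y)\in X\times Y$ with $xy\in E$ (so edges contained in $X\cap Y$ are counted twice). For $\varepsilon>0$ and $p\in(0,1]$, a graph $G=(V,E)$ is called $(\varepsilon,p)$-quasirandom if for all $X,Y\subseteq V$ we have $\bigl|e_G(X,Y)-p|X||Y|\bigr|\le\varepsilon|V|^2$. A pair of graphs $(F_1,F_2)$ is forcing if for every $p\in(0,1]$ and $\varepsilon>0$ there is some $\delta>0$ such that every graph $G$ with $t(F_1,G)\ge(1-\delta)p^{e(F_1)}$ and $t(F_2,G)\le(1+\delta)p^{e(F_2)}$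 is $(\varepsilon,p)$-quasirandom, where $e(F_i)$ is the number of edges of $F_i$. -}

module Defs where

open import Data.Empty using (⊥)
open import Data.Fin.Base as Fin using (Fin; finToFun; splitAt; toℕ)
open import Data.Fin.Properties as Fin using (all?)
open import Data.Fin.Subset using (Subset; ∣_∣; _∈_)
open import Data.Fin.Subset.Properties using (_∈?_)
import Data.Integer.Base as ℤ
open import Data.List.Base using (List; length; filter; allFin; cartesianProduct; lookup)
open import Data.Nat.Base as ℕ using (ℕ; zero; suc; NonZero)
import Data.Nat.DivMod as ℕ
import Data.Nat.Properties as ℕ
open import Data.Product.Base using (∃; _×_; _,_; proj₁; proj₂)
open import Data.Rational.Base as ℚ using (ℚ; 0ℚ; 1ℚ; ½)
import Data.Rational.Properties as ℚ
open import Data.Rational.Solver using (module +-*-Solver)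
open import Data.Sum.Base as Sum using (_⊎_; inj₁; inj₂)
open import Function.Base using (_∘_)
open import Relation.Binary.Core using (Rel)
open import Relation.Binary.Definitions using (Symmetric; Irreflexive; Decidable)
open import Relation.Binary.PropositionalEquality
  using (_≡_; _≢_; refl; sym; trans; cong; cong₂; subst; subst₂)
open import Relation.Nullary using (¬_; Dec; yes; no)
open import Relation.Nullary.Decidable
  using (_×-dec_; _⊎-dec_; _→-dec_; ¬?; from-yes)
open import Level using (0ℓ)

-- A real is a Cauchy sequence of rationals together with a modulus of
-- convergence.  Different sequences may represent the same real; the
-- relations _<_ and _≤_ below do not depend on the representative.

IsCauchy : (ℕ → ℚ) → Set
IsCauchy a = ∀ ε → 0ℚ ℚ.< ε →
  ∃ λ N → ∀ m n → N ℕ.≤ m → N ℕ.≤ n → ℚ.∣ a m ℚ.- a n ∣ ℚ.≤ ε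

record ℝ : Set where
  constructor mkℝ
  field
    seq    : ℕ → ℚ
    cauchy : IsCauchy seq

open ℝ public

infix 4 _<_ _≤_ _≥_

_<_ : Rel ℝ 0ℓ
x < y = ∃ λ ε → 0ℚ ℚ.< ε × ∃ λ N → ∀ n → N ℕ.≤ n → seq x n ℚ.+ ε ℚ.≤ seq y n

_≤_ : Rel ℝ 0ℓ
x ≤ y = ∀ ε → 0ℚ ℚ.< ε → ∃ λ N → ∀ n → N ℕ.≤ n → seq x n ℚ.≤ seq y n ℚ.+ ε

_≥_ : Rel ℝ 0ℓ
x ≥ y = y ≤ x

fromℚ : ℚ → ℝ
fromℚ q = mkℝ (λ _ → q) λ ε 0<ε → 0 , λ _ _ _ _ →
  subst (ℚ._≤ ε) (cong ℚ.∣_∣ (sym (ℚ.+-inverseʳ q))) (ℚ.<⇒≤ 0<ε)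

fromℕ : ℕ → ℝ
fromℕ n = fromℚ (ℤ.+ n ℚ./ 1)

0ℝ 1ℝ : ℝ
0ℝ = fromℚ 0ℚ
1ℝ = fromℚ 1ℚ

half-pos : ∀ {ε} → 0ℚ ℚ.< ε → 0ℚ ℚ.< ½ ℚ.* ε
half-pos {ε} 0<ε = subst (ℚ._< ½ ℚ.* ε) (ℚ.*-zeroʳ ½) (ℚ.*-monoʳ-<-pos ½ 0<ε)

half+half : ∀ ε → ½ ℚ.* ε ℚ.+ ½ ℚ.* ε ≡ ε
half+half = solve 1 (λ e → con ½ :* e :+ con ½ :* e := e) refl
  where open +-*-Solver

*-pos : ∀ {a b} → 0ℚ ℚ.< a → 0ℚ ℚ.< b → 0ℚ ℚ.< a ℚ.* b
*-pos {a} {b} 0<a 0<b = subst (ℚ._< a ℚ.* b) (ℚ.*-zeroʳ a)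
  (ℚ.*-monoʳ-<-pos a {{ℚ.positive 0<a}} 0<b)

*-mono-∣∣ : ∀ {a b c d} → ℚ.∣ a ∣ ℚ.≤ c → ℚ.∣ b ∣ ℚ.≤ d → ℚ.∣ a ℚ.* b ∣ ℚ.≤ c ℚ.* d
*-mono-∣∣ {a} {b} {c} {d} a≤c b≤d = begin
  ℚ.∣ a ℚ.* b ∣          ≡⟨ ℚ.∣p*q∣≡∣p∣*∣q∣ a b ⟩
  ℚ.∣ a ∣ ℚ.* ℚ.∣ b ∣    ≤⟨ ℚ.*-monoʳ-≤-nonNeg ℚ.∣ b ∣ {{ℚ.∣-∣-nonNeg b}} a≤c ⟩
  c ℚ.* ℚ.∣ b ∣          ≤⟨ ℚ.*-monoˡ-≤-nonNeg c {{c≥0}} b≤d ⟩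
  c ℚ.* d                ∎
  where
  open ℚ.≤-Reasoning
  c≥0 = ℚ.nonNegative (ℚ.≤-trans (ℚ.0≤∣p∣ a) a≤c)

eventually-bounded : ∀ x → ∃ λ B → 0ℚ ℚ.< B ×
  ∃ λ N → ∀ n → N ℕ.≤ n → ℚ.∣ seq x n ∣ ℚ.≤ B
eventually-bounded x = B , 0<B , N , λ n N≤n → begin
  ℚ.∣ seq x n ∣
    ≡⟨ cong ℚ.∣_∣ (split (seq x n) (seq x N)) ⟩
  ℚ.∣ (seq x n ℚ.- seq x N) ℚ.+ seq x N ∣
    ≤⟨ ℚ.∣p+q∣≤∣p∣+∣q∣ (seq x n ℚ.- seq x N) (seq x N) ⟩
  ℚ.∣ seq x n ℚ.- seq x N ∣ ℚ.+ ℚ.∣ seq x N ∣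
    ≤⟨ ℚ.+-monoˡ-≤ ℚ.∣ seq x N ∣ (close n N N≤n ℕ.≤-refl) ⟩
  B ∎
  where
  open ℚ.≤-Reasoning
  0<1 : 0ℚ ℚ.< 1ℚ
  0<1 = from-yes (0ℚ ℚ.<? 1ℚ)
  N = proj₁ (cauchy x 1ℚ 0<1)
  close = proj₂ (cauchy x 1ℚ 0<1)
  B = 1ℚ ℚ.+ ℚ.∣ seq x N ∣
  0<B : 0ℚ ℚ.< B
  0<B = ℚ.+-mono-<-≤ 0<1 (ℚ.0≤∣p∣ (seq x N))
  split : ∀ a b → a ≡ (a ℚ.- b) ℚ.+ b
  split = solve 2 (λ a b → a := (a :- b) :+ b) refl
    where open +-*-Solver

rescale : ∀ {B ε} → 0ℚ ℚ.< B → 0ℚ ℚ.< ε →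
  ∃ λ η → 0ℚ ℚ.< η × B ℚ.* η ≡ ½ ℚ.* ε
rescale {B} {ε} 0<B 0<ε = 1/B ℚ.* (½ ℚ.* ε) , *-pos 0<1/B (half-pos 0<ε) , eq
  where
  instance
    B>0 = ℚ.positive 0<B
    B≢0 = ℚ.pos⇒nonZero B
  1/B = ℚ.1/ B
  0<1/B : 0ℚ ℚ.< 1/B
  0<1/B = ℚ.positive⁻¹ 1/B {{ℚ.1/pos⇒pos B}}
  open ℚ.≤-Reasoning
  eq : B ℚ.* (1/B ℚ.* (½ ℚ.* ε)) ≡ ½ ℚ.* ε
  eq = begin-equality
    B ℚ.* (1/B ℚ.* (½ ℚ.* ε))  ≡⟨ ℚ.*-assoc B 1/B (½ ℚ.* ε) ⟨
    B ℚ.* 1/B ℚ.* (½ ℚ.* ε)    ≡⟨ cong (ℚ._* (½ ℚ.* ε)) (ℚ.*-inverseʳ B) ⟩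
    1ℚ ℚ.* (½ ℚ.* ε)           ≡⟨ ℚ.*-identityˡ (½ ℚ.* ε) ⟩
    ½ ℚ.* ε                    ∎

∣a∣-∣b∣≤∣a-b∣ : ∀ a b → ℚ.∣ a ∣ ℚ.- ℚ.∣ b ∣ ℚ.≤ ℚ.∣ a ℚ.- b ∣
∣a∣-∣b∣≤∣a-b∣ a b = begin
  ℚ.∣ a ∣ ℚ.- ℚ.∣ b ∣
    ≡⟨ cong (λ z → ℚ.∣ z ∣ ℚ.- ℚ.∣ b ∣)
            (solve 2 (λ a b → a := (a :- b) :+ b) refl a b) ⟩
  ℚ.∣ (a ℚ.- b) ℚ.+ b ∣ ℚ.- ℚ.∣ b ∣
    ≤⟨ ℚ.+-monoˡ-≤ (ℚ.- ℚ.∣ b ∣) (ℚ.∣p+q∣≤∣p∣+∣q∣ (a ℚ.- b) b) ⟩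
  (ℚ.∣ a ℚ.- b ∣ ℚ.+ ℚ.∣ b ∣) ℚ.- ℚ.∣ b ∣
    ≡⟨ solve 2 (λ c d → (c :+ d) :- d := c) refl ℚ.∣ a ℚ.- b ∣ ℚ.∣ b ∣ ⟩
  ℚ.∣ a ℚ.- b ∣ ∎
  where
  open +-*-Solver
  open ℚ.≤-Reasoning

∣a-b∣≡∣b-a∣ : ∀ a b → ℚ.∣ a ℚ.- b ∣ ≡ ℚ.∣ b ℚ.- a ∣
∣a-b∣≡∣b-a∣ a b = trans (sym (ℚ.∣-p∣≡∣p∣ (a ℚ.- b)))
  (cong ℚ.∣_∣ (solve 2 (λ a b → :- (a :- b) := b :- a) refl a b))
  where open +-*-Solver

∣∣-lipschitz : ∀ a b → ℚ.∣ ℚ.∣ a ∣ ℚ.- ℚ.∣ b ∣ ∣ ℚ.≤ ℚ.∣ a ℚ.- b ∣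
∣∣-lipschitz a b with ℚ.∣p∣≡p∨∣p∣≡-p (ℚ.∣ a ∣ ℚ.- ℚ.∣ b ∣)
... | inj₁ eq = subst (ℚ._≤ ℚ.∣ a ℚ.- b ∣) (sym eq) (∣a∣-∣b∣≤∣a-b∣ a b)
... | inj₂ eq = subst₂ ℚ._≤_
    (trans (solve 2 (λ c d → d :- c := :- (c :- d)) refl ℚ.∣ a ∣ ℚ.∣ b ∣) (sym eq))
    (∣a-b∣≡∣b-a∣ b a)
    (∣a∣-∣b∣≤∣a-b∣ b a)
  where open +-*-Solver

infixl 6 _+_ _-_
infixl 7 _*_
infixr 8 _^_
infix  8 -_

_+_ : ℝ → ℝ → ℝ
x + y = mkℝ (λ n → seq x n ℚ.+ seq y n) λ ε 0<ε →
  let Nx , px = cauchy x (½ ℚ.* ε) (half-pos 0<ε)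
      Ny , py = cauchy y (½ ℚ.* ε) (half-pos 0<ε)
  in Nx ℕ.⊔ Ny , λ m n N≤m N≤n → begin
    ℚ.∣ (seq x m ℚ.+ seq y m) ℚ.- (seq x n ℚ.+ seq y n) ∣
      ≡⟨ cong ℚ.∣_∣ (regroup (seq x m) (seq y m) (seq x n) (seq y n)) ⟩
    ℚ.∣ (seq x m ℚ.- seq x n) ℚ.+ (seq y m ℚ.- seq y n) ∣
      ≤⟨ ℚ.∣p+q∣≤∣p∣+∣q∣ (seq x m ℚ.- seq x n) (seq y m ℚ.- seq y n) ⟩
    ℚ.∣ seq x m ℚ.- seq x n ∣ ℚ.+ ℚ.∣ seq y m ℚ.- seq y n ∣
      ≤⟨ ℚ.+-mono-≤
           (px m n (ℕ.m⊔n≤o⇒m≤o Nx Ny N≤m) (ℕ.m⊔n≤o⇒m≤o Nx Ny N≤n))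
           (py m n (ℕ.m⊔n≤o⇒n≤o Nx Ny N≤m) (ℕ.m⊔n≤o⇒n≤o Nx Ny N≤n)) ⟩
    ½ ℚ.* ε ℚ.+ ½ ℚ.* ε
      ≡⟨ half+half ε ⟩
    ε ∎
  where
  open ℚ.≤-Reasoning
  regroup : ∀ a b c d → (a ℚ.+ b) ℚ.- (c ℚ.+ d) ≡ (a ℚ.- c) ℚ.+ (b ℚ.- d)
  regroup = solve 4 (λ a b c d → (a :+ b) :- (c :+ d) := (a :- c) :+ (b :- d)) refl
    where open +-*-Solver

-_ : ℝ → ℝ
- x = mkℝ (λ n → ℚ.- seq x n) λ ε 0<ε →
  let N , p = cauchy x ε 0<ε
  in N , λ m n N≤m N≤n → subst (ℚ._≤ ε) (flip (seq x m) (seq x n)) (p m n N≤m N≤n)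
  where
  flip : ∀ a b → ℚ.∣ a ℚ.- b ∣ ≡ ℚ.∣ ℚ.- a ℚ.- ℚ.- b ∣
  flip a b = trans (sym (ℚ.∣-p∣≡∣p∣ (a ℚ.- b))) (cong ℚ.∣_∣ (ℚ.neg-distrib-+ a (ℚ.- b)))

_-_ : ℝ → ℝ → ℝ
x - y = x + (- y)

_*_ : ℝ → ℝ → ℝ
x * y = mkℝ (λ n → seq x n ℚ.* seq y n) λ ε 0<ε →
  let Bx , 0<Bx , Mx , bx = eventually-bounded x
      By , 0<By , My , by = eventually-bounded y
      ηx , 0<ηx , ex = rescale 0<By 0<ε
      ηy , 0<ηy , ey = rescale 0<Bx 0<ε
      Nx , px = cauchy x ηx 0<ηx
      Ny , py = cauchy y ηy 0<ηy
      M = Mx ℕ.⊔ My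
      N = Nx ℕ.⊔ Ny
  in M ℕ.⊔ N , λ m n K≤m K≤n →
    let M≤m = ℕ.m⊔n≤o⇒m≤o M N K≤m
        N≤m = ℕ.m⊔n≤o⇒n≤o M N K≤m
        M≤n = ℕ.m⊔n≤o⇒m≤o M N K≤n
        N≤n = ℕ.m⊔n≤o⇒n≤o M N K≤n
    in begin
    ℚ.∣ seq x m ℚ.* seq y m ℚ.- seq x n ℚ.* seq y n ∣
      ≡⟨ cong ℚ.∣_∣ (regroup (seq x m) (seq y m) (seq x n) (seq y n)) ⟩
    ℚ.∣ seq x m ℚ.* (seq y m ℚ.- seq y n) ℚ.+ seq y n ℚ.* (seq x m ℚ.- seq x n) ∣
      ≤⟨ ℚ.∣p+q∣≤∣p∣+∣q∣ (seq x m ℚ.* (seq y m ℚ.- seq y n))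
                         (seq y n ℚ.* (seq x m ℚ.- seq x n)) ⟩
    ℚ.∣ seq x m ℚ.* (seq y m ℚ.- seq y n) ∣ ℚ.+ ℚ.∣ seq y n ℚ.* (seq x m ℚ.- seq x n) ∣
      ≤⟨ ℚ.+-mono-≤
           (*-mono-∣∣ (bx m (ℕ.m⊔n≤o⇒m≤o Mx My M≤m))
             (py m n (ℕ.m⊔n≤o⇒n≤o Nx Ny N≤m) (ℕ.m⊔n≤o⇒n≤o Nx Ny N≤n)))
           (*-mono-∣∣ (by n (ℕ.m⊔n≤o⇒n≤o Mx My M≤n))
             (px m n (ℕ.m⊔n≤o⇒m≤o Nx Ny N≤m) (ℕ.m⊔n≤o⇒m≤o Nx Ny N≤n))) ⟩
    Bx ℚ.* ηy ℚ.+ By ℚ.* ηx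
      ≡⟨ cong₂ ℚ._+_ ey ex ⟩
    ½ ℚ.* ε ℚ.+ ½ ℚ.* ε
      ≡⟨ half+half ε ⟩
    ε ∎
  where
  open ℚ.≤-Reasoning
  regroup : ∀ a b c d →
    a ℚ.* b ℚ.- c ℚ.* d ≡ a ℚ.* (b ℚ.- d) ℚ.+ d ℚ.* (a ℚ.- c)
  regroup = solve 4 (λ a b c d →
    a :* b :- c :* d := a :* (b :- d) :+ d :* (a :- c)) refl
    where open +-*-Solver

_^_ : ℝ → ℕ → ℝ
x ^ zero  = 1ℝ
x ^ suc n = x * x ^ n

abs : ℝ → ℝ
abs x = mkℝ (λ n → ℚ.∣ seq x n ∣) λ ε 0<ε →
  let N , p = cauchy x ε 0<ε
  in N , λ m n N≤m N≤n → ℚ.≤-trans (∣∣-lipschitz (seq x m) (seq x n)) (p m n N≤m N≤n)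

record Graph : Set₁ where
  infix 4 _~_ _~?_
  field
    order        : ℕ
    {{nonEmpty}} : NonZero order
    _~_          : Rel (Fin order) 0ℓ
    _~?_         : Decidable _~_
    ~-sym        : Symmetric _~_
    ~-irrefl     : Irreflexive _≡_ _~_

  Vertex : Set
  Vertex = Fin order

  edges : List (Vertex × Vertex)
  edges = filter (λ (u , v) → (u Fin.<? v) ×-dec (u ~? v))
                 (cartesianProduct (allFin order) (allFin order))

  edgeCount : ℕ
  edgeCount = length edges

open Graph using (order; nonEmpty; Vertex; edges; edgeCount)

complete : ∀ n → {{NonZero n}} → Graph
complete n = record
  { order    = n
  ; _~_      = _≢_
  ; _~?_     = λ u v → ¬? (u Fin.≟ v)
  ; ~-sym    = λ u≢v → u≢v ∘ sym
  ; ~-irrefl = λ u≡v u≢v → u≢v u≡v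
  }

K₃ : Graph
K₃ = complete 3

C₄ : Graph
C₄ = record
  { order    = 4
  ; _~_      = λ u v → next u v ⊎ next v u
  ; _~?_     = λ u v → next? u v ⊎-dec next? v u
  ; ~-sym    = Sum.swap
  ; ~-irrefl = λ { {u} refl → Sum.[ not-next u , not-next u ] }
  }
  where
  next : Rel (Fin 4) 0ℓ
  next u v = suc (toℕ u) ℕ.% 4 ≡ toℕ v

  next? : Decidable next
  next? u v = suc (toℕ u) ℕ.% 4 ℕ.≟ toℕ v

  not-next : ∀ u → ¬ next u u
  not-next = from-yes (all? λ u → ¬? (next? u u))

-- The first `order F` vertices of F △ are those of F; vertex `order F + k`
-- is the apex of the triangle placed on the k-th edge of F.

infix 9 _△

_△ : Graph → Graph
F △ = record
  { order    = order F ℕ.+ edgeCount F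
  ; nonEmpty = ℕ.>-nonZero
      (ℕ.≤-trans (ℕ.>-nonZero⁻¹ (order F)) (ℕ.m≤m+n (order F) (edgeCount F)))
  ; _~_      = λ x y → adj (split x) (split y)
  ; _~?_     = λ x y → adj? (split x) (split y)
  ; ~-sym    = λ {x} {y} → adj-sym (split x) (split y)
  ; ~-irrefl = λ { {x} refl → adj-irrefl (split x) }
  }
  where
  open Graph F using (_~_; _~?_; ~-sym; ~-irrefl)

  split : Fin (order F ℕ.+ edgeCount F) → Vertex F ⊎ Fin (edgeCount F)
  split = splitAt (order F)

  EndOf : Vertex F → Fin (edgeCount F) → Set
  EndOf u k = u ≡ proj₁ (lookup (edges F) k) ⊎ u ≡ proj₂ (lookup (edges F) k)

  endOf? : ∀ u k → Dec (EndOf u k)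
  endOf? u k = (u Fin.≟ _) ⊎-dec (u Fin.≟ _)

  adj : Rel (Vertex F ⊎ Fin (edgeCount F)) 0ℓ
  adj (inj₁ u) (inj₁ v) = u ~ v
  adj (inj₁ u) (inj₂ k) = EndOf u k
  adj (inj₂ k) (inj₁ v) = EndOf v k
  adj (inj₂ k) (inj₂ l) = ⊥

  adj? : Decidable adj
  adj? (inj₁ u) (inj₁ v) = u ~? v
  adj? (inj₁ u) (inj₂ k) = endOf? u k
  adj? (inj₂ k) (inj₁ v) = endOf? v k
  adj? (inj₂ k) (inj₂ l) = no λ ()

  adj-sym : ∀ x y → adj x y → adj y x
  adj-sym (inj₁ u) (inj₁ v) = ~-sym
  adj-sym (inj₁ u) (inj₂ k) = λ p → p
  adj-sym (inj₂ k) (inj₁ v) = λ p → p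

  adj-irrefl : ∀ x → ¬ adj x x
  adj-irrefl (inj₁ u) = ~-irrefl refl

module _ (F G : Graph) where
  private
    module F = Graph F
    module G = Graph G

  IsHom : (Vertex F → Vertex G) → Set
  IsHom f = ∀ u v → u F.~ v → f u G.~ f v

  isHom? : ∀ f → Dec (IsHom f)
  isHom? f = all? λ u → all? λ v → (u F.~? v) →-dec (f u G.~? f v)

  -- finToFun enumerates all maps Vertex F → Vertex G, each exactly once.
  hom : ℕ
  hom = length (filter (isHom? ∘ finToFun) (allFin (order G ℕ.^ order F)))

  t : ℚ
  t = (ℤ.+ hom ℚ./ (order G ℕ.^ order F)) {{ℕ.m^n≢0 (order G) (order F)}}

pairCount : (G : Graph) → Subset (order G) → Subset (order G) → ℕ
pairCount G X Y = length
  (filter (λ (x , y) → (x ∈? X) ×-dec (y ∈? Y) ×-dec (x ~? y))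
          (cartesianProduct (allFin (order G)) (allFin (order G))))
  where open Graph G using (_~?_)

Quasirandom : ℝ → ℝ → Graph → Set
Quasirandom ε p G = ∀ (X Y : Subset (order G)) →
  abs (fromℕ (pairCount G X Y) - p * fromℕ ∣ X ∣ * fromℕ ∣ Y ∣)
    ≤ ε * fromℕ (order G) ^ 2

Forcing : Graph → Graph → Set₁
Forcing F₁ F₂ = ∀ (p ε : ℝ) → 0ℝ < p → p ≤ 1ℝ → 0ℝ < ε →
  ∃ λ δ → 0ℝ < δ × (∀ (G : Graph) →
    fromℚ (t F₁ G) ≥ (1ℝ - δ) * p ^ edgeCount F₁ →
    fromℚ (t F₂ G) ≤ (1ℝ + δ) * p ^ edgeCount F₂ →
    Quasirandom ε p G)

{-# OPTIONS --safe #-}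

-- Let A be the adjacency kernel of G, B = A ∘ A its normalised codegree kernel and c = p³.  The
-- kernel W = A · B of triangles over an edge satisfies t(K₃, G) = E W and t(C₄△, G) = t(C₄, W), so
-- the hypotheses say that W is close to the constant c in cut norm.  As B(x, y) is an average of
-- products A(x, z) A(y, z), this closeness survives multiplication by powers of 1 - B.  Therefore B
-- is bounded below on most pairs, and summing a geometric series to divide by B shows that A is
-- close in cut norm to U = c / β, where β = max(B, c / 2).  Consequently β ≈ U ∘ U in L¹.
--
-- Now the cross-ratios of U and those of β = c / U are bounded by the same constant R, while passing
-- from U to U ∘ U contracts R to (R + 1) / 2, as in Birkhoff's theorem on positive kernels.  Starting
-- from R = O(1 / c²) and iterating, all 2 × 2 minors of U become small in L¹.  Together with
-- U · (U ∘ U) ≈ c this forces U to be nearly constant, and the constant is p.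

module Submission where

open import Algebra.Bundles using (CommutativeRing; Semiring)
import Algebra.Definitions.RawSemiring as RawSemiring
open import Data.Bool.Base using (true; false; if_then_else_)
open import Data.Empty using (⊥-elim)
open import Data.Fin.Base as Fin using (Fin; zero; suc; combine; finToFun; _↑ˡ_; _↑ʳ_)
import Data.Fin.Properties as Fin
open import Data.Fin.Subset using (Subset) renaming (∣_∣ to size)
open import Data.Fin.Subset.Properties using (_∈?_)
import Data.Integer.Base as ℤ
import Data.Integer.Properties as ℤ
open import Data.List.Base as List
  using (List; []; _∷_; _++_; filter; length; tabulate; allFin; cartesianProduct)
open import Data.List.Membership.Propositional using () renaming (_∈_ to _∈ˡ_)
open import Data.List.Membership.Propositional.Properties
  using (∈-filter⁺; ∈-filter⁻; ∈-cartesianProduct⁺; ∈-allFin)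
import Data.List.Properties as List
open import Data.List.Relation.Unary.All as All using (All; []; _∷_)
open import Data.Maybe.Base using (Maybe; just; nothing)
open import Data.Nat.Base as ℕ using (ℕ; zero; suc)
import Data.Nat.Properties as ℕ
open import Data.Product.Base using (∃; _×_; _,_; proj₁; proj₂)
open import Data.Rational
open import Data.Rational.Properties
import Data.Rational.Unnormalised as ℚᵘ
import Data.Rational.Unnormalised.Properties as ℚᵘ
open import Data.Sum.Base using (inj₁; inj₂)
open import Data.Vec.Base using ([]; _∷_)
import Data.Vec.Functional as Vector
open import Function.Base using (_∘_; id)
open import Level using (0ℓ)
open import Relation.Binary.Definitions using (tri<; tri≈; tri>)
open import Relation.Binary.PropositionalEquality
open import Relation.Nullary using (Dec; yes; no; does; ¬_)
open import Relation.Nullary.Decidable using (_×-dec_; from-yes)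
open import Relation.Unary using (Pred; Decidable)
open import Tactic.RingSolver using (solve-∀)
open import Tactic.RingSolver.Core.AlmostCommutativeRing
  using (AlmostCommutativeRing; fromCommutativeRing)

import Defs
open import Defs using
  (Graph; t; hom; IsHom; isHom?; K₃; C₄; _△; pairCount; ℝ; seq; fromℚ; Forcing; Quasirandom)

open CommutativeRing +-*-commutativeRing using () renaming (semiring to ℚ-semiring)
open import Algebra.Properties.Semiring.Sum ℚ-semiring
  using (sum; sum-cong-≗; ∑-distrib-+; ∑-comm; *-distribˡ-sum)
open RawSemiring (Semiring.rawSemiring ℚ-semiring) using (_^_)

-- Ordered field arithmetic

-- Birkhoff's contraction concerns pointwise ratios, but `β ≈ U ∘ U` holds only on average, and a
-- few exceptional pairs would ruin any supremum bound. Every cross-ratio inequality therefore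
-- carries a nonnegative slack in four variables, and only its mean is tracked. One contraction
-- multiplies this mean by a constant of order `1 / c²`, so the number of steps is fixed from `p`
-- and `ε` beforehand and the L¹ error is chosen small enough afterwards.
--
-- The L¹ estimate itself is available because composition smooths. The 0/1-valued kernel `A` is in
-- general far from `U` in L¹, but once a common vertex has been averaged out, the sign of the
-- resulting difference is a legitimate test function. Closeness of `A` and `U` in cut norm thus
-- becomes closeness of `A ∘ A` and `U ∘ U` in L¹.
--
-- A real `p` is visible only through rational approximations that vary with the index. All
-- constants are therefore built from a rational lower bound `p₀` and serve every density in
-- `[p₀, 1]` at once.

ring : AlmostCommutativeRing 0ℓ 0ℓ
ring = fromCommutativeRing +-*-commutativeRing λ x → decide (0ℚ ≟ x)
  where
  decide : ∀ {x} → Dec (0ℚ ≡ x) → Maybe (0ℚ ≡ x)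
  decide (yes eq) = just eq
  decide (no _)   = nothing

-- The standard way of proving inequalities below: the difference is written as a sum of products of
-- nonnegative factors, and the ring solver checks the identity.
≤-by : ∀ {y x} d → 0ℚ ≤ d → y ≡ x + d → x ≤ y
≤-by {y} {x} d 0≤d eq = begin
  x       ≡⟨ +-identityʳ x ⟨
  x + 0ℚ  ≤⟨ +-monoʳ-≤ x 0≤d ⟩
  x + d   ≡⟨ eq ⟨
  y       ∎
  where open ≤-Reasoning

0≤-+ : ∀ {x y} → 0ℚ ≤ x → 0ℚ ≤ y → 0ℚ ≤ x + y
0≤-+ = +-mono-≤

0≤-* : ∀ {x y} → 0ℚ ≤ x → 0ℚ ≤ y → 0ℚ ≤ x * y
0≤-* {x} {y} 0≤x 0≤y =
  subst (_≤ x * y) (*-zeroʳ x) (*-monoˡ-≤-nonNeg x {{nonNegative 0≤x}} 0≤y)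

0≤-square : ∀ x → 0ℚ ≤ x * x
0≤-square x with ≤-total 0ℚ x
... | inj₁ 0≤x = 0≤-* 0≤x 0≤x
... | inj₂ x≤0 = subst (0ℚ ≤_) (lem x) (0≤-* (neg-antimono-≤ x≤0) (neg-antimono-≤ x≤0))
  where
  lem : ∀ x → - x * - x ≡ x * x
  lem = solve-∀ ring

≤⇒0≤- : ∀ {x y} → x ≤ y → 0ℚ ≤ y - x
≤⇒0≤- {x} {y} x≤y = subst (_≤ y - x) (+-inverseʳ x) (+-monoˡ-≤ (- x) x≤y)

0≤1 : 0ℚ ≤ 1ℚ
0≤1 = from-yes (0ℚ ≤? 1ℚ)

*-mono-≤ : ∀ {x w y z} → 0ℚ ≤ x → 0ℚ ≤ w → x ≤ y → z ≤ w → x * z ≤ y * w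
*-mono-≤ {x} {w} {y} {z} 0≤x 0≤w x≤y z≤w = ≤-trans
  (*-monoˡ-≤-nonNeg x {{nonNegative 0≤x}} z≤w)
  (*-monoʳ-≤-nonNeg w {{nonNegative 0≤w}} x≤y)

*-monoˡ : ∀ {y z} x → 0ℚ ≤ x → y ≤ z → x * y ≤ x * z
*-monoˡ x 0≤x = *-monoˡ-≤-nonNeg x {{nonNegative 0≤x}}

*-cancelˡ : ∀ {y z} x → 0ℚ < x → x * y ≤ x * z → y ≤ z
*-cancelˡ x 0<x = *-cancelˡ-≤-pos x {{positive 0<x}}

0<-* : ∀ {x y} → 0ℚ < x → 0ℚ < y → 0ℚ < x * y
0<-* {x} {y} 0<x 0<y =
  subst (_< x * y) (*-zeroʳ x) (*-monoʳ-<-pos x {{positive 0<x}} 0<y)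

square-cancel-≤ : ∀ {y x} → 0ℚ ≤ y → x * x ≤ y * y → x ≤ y
square-cancel-≤ {y} {x} 0≤y xx≤yy = ≮⇒≥ λ y<x →
  <-irrefl refl (≤-<-trans xx≤yy (≤-<-trans (*-monoˡ y 0≤y (<⇒≤ y<x))
    (*-monoˡ-<-pos x {{positive (≤-<-trans 0≤y y<x)}} y<x)))

x≤∣x∣ : ∀ x → x ≤ ∣ x ∣
x≤∣x∣ x with ≤-total 0ℚ x
... | inj₁ 0≤x = ≤-reflexive (sym (0≤p⇒∣p∣≡p 0≤x))
... | inj₂ x≤0 = ≤-trans x≤0 (0≤∣p∣ x)

-x≤∣x∣ : ∀ x → - x ≤ ∣ x ∣
-x≤∣x∣ x = subst (- x ≤_) (∣-p∣≡∣p∣ x) (x≤∣x∣ (- x))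

∣x∣-lub : ∀ {y} x → x ≤ y → - x ≤ y → ∣ x ∣ ≤ y
∣x∣-lub x h₁ h₂ with ∣p∣≡p∨∣p∣≡-p x
... | inj₁ eq = subst (_≤ _) (sym eq) h₁
... | inj₂ eq = subst (_≤ _) (sym eq) h₂

0≤x≤1⇒∣x∣≤1 : ∀ {x} → 0ℚ ≤ x → x ≤ 1ℚ → ∣ x ∣ ≤ 1ℚ
0≤x≤1⇒∣x∣≤1 0≤x x≤1 = subst (_≤ 1ℚ) (sym (0≤p⇒∣p∣≡p 0≤x)) x≤1

∣xy∣≤1 : ∀ x y → ∣ x ∣ ≤ 1ℚ → ∣ y ∣ ≤ 1ℚ → ∣ x * y ∣ ≤ 1ℚ
∣xy∣≤1 x y hx hy = subst (_≤ 1ℚ) (sym (∣p*q∣≡∣p∣*∣q∣ x y))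
  (*-mono-≤ (0≤∣p∣ x) 0≤1 hx hy)

∣x∣≤1⇒xy≤∣y∣ : ∀ x y → ∣ x ∣ ≤ 1ℚ → x * y ≤ ∣ y ∣
∣x∣≤1⇒xy≤∣y∣ x y hx = ≤-trans (x≤∣x∣ (x * y)) (subst₂ _≤_ (sym (∣p*q∣≡∣p∣*∣q∣ x y))
  (*-identityˡ ∣ y ∣) (*-monoʳ-≤-nonNeg ∣ y ∣ {{∣-∣-nonNeg y}} hx))

∣x∣≤1⇒x²≤1 : ∀ x → ∣ x ∣ ≤ 1ℚ → x * x ≤ 1ℚ
∣x∣≤1⇒x²≤1 x hx = ≤-trans (∣x∣≤1⇒xy≤∣y∣ x x hx) hx

square-damp : ∀ x y → ∣ x ∣ ≤ 1ℚ → x * y * (x * y) ≤ y * y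
square-damp x y hx = begin
  x * y * (x * y)  ≡⟨ lem x y ⟩
  x * x * (y * y)  ≤⟨ *-monoʳ-≤-nonNeg (y * y) {{nonNegative (0≤-square y)}} (∣x∣≤1⇒x²≤1 x hx) ⟩
  1ℚ * (y * y)     ≡⟨ *-identityˡ (y * y) ⟩
  y * y            ∎
  where
  open ≤-Reasoning
  lem : ∀ a b → a * b * (a * b) ≡ a * a * (b * b)
  lem = solve-∀ ring

sgn : ℚ → ℚ
sgn x with ≤-total 0ℚ x
... | inj₁ _ = 1ℚ
... | inj₂ _ = - 1ℚ

∣sgn∣≤1 : ∀ x → ∣ sgn x ∣ ≤ 1ℚ
∣sgn∣≤1 x with ≤-total 0ℚ x
... | inj₁ _ = ≤-refl
... | inj₂ _ = ≤-refl

sgn*x≡∣x∣ : ∀ x → sgn x * x ≡ ∣ x ∣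
sgn*x≡∣x∣ x with ≤-total 0ℚ x
... | inj₁ 0≤x = trans (*-identityˡ x) (sym (0≤p⇒∣p∣≡p 0≤x))
... | inj₂ x≤0 = trans (lem x)
  (trans (sym (0≤p⇒∣p∣≡p (neg-antimono-≤ x≤0))) (∣-p∣≡∣p∣ x))
  where
  lem : ∀ x → - 1ℚ * x ≡ - x
  lem = solve-∀ ring

0≤-^ : ∀ {x} k → 0ℚ ≤ x → 0ℚ ≤ x ^ k
0≤-^ zero    0≤x = 0≤1
0≤-^ (suc k) 0≤x = 0≤-* 0≤x (0≤-^ k 0≤x)

^-monoˡ-≤ : ∀ {x y} k → 0ℚ ≤ x → x ≤ y → x ^ k ≤ y ^ k
^-monoˡ-≤ zero    0≤x x≤y = ≤-refl
^-monoˡ-≤ (suc k) 0≤x x≤y =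
  *-mono-≤ 0≤x (0≤-^ k (≤-trans 0≤x x≤y)) x≤y (^-monoˡ-≤ k 0≤x x≤y)

1≤-^ : ∀ {x} k → 1ℚ ≤ x → 1ℚ ≤ x ^ k
1≤-^ zero    1≤x = ≤-refl
1≤-^ (suc k) 1≤x = *-mono-≤ 0≤1 (0≤-^ k (≤-trans 0≤1 1≤x)) 1≤x (1≤-^ k 1≤x)

^≤1 : ∀ {x} k → 0ℚ ≤ x → x ≤ 1ℚ → x ^ k ≤ 1ℚ
^≤1 zero    0≤x x≤1 = ≤-refl
^≤1 (suc k) 0≤x x≤1 = *-mono-≤ 0≤x 0≤1 x≤1 (^≤1 k 0≤x x≤1)

^-distribʳ-* : ∀ k x y → (x * y) ^ k ≡ x ^ k * y ^ k
^-distribʳ-* zero    x y = refl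
^-distribʳ-* (suc k) x y =
  trans (cong (x * y *_) (^-distribʳ-* k x y)) (lem x y (x ^ k) (y ^ k))
  where
  lem : ∀ a b c d → a * b * (c * d) ≡ a * c * (b * d)
  lem = solve-∀ ring

-- Natural numbers as rationals, inverses and the decay of powers

fromNat : ℕ → ℚ
fromNat n = ℤ.+ n / 1

toℚᵘ-fromNat : ∀ n → toℚᵘ (fromNat n) ℚᵘ.≃ ℚᵘ.mkℚᵘ (ℤ.+ n) 0
toℚᵘ-fromNat n = toℚᵘ-fromℚᵘ (ℚᵘ.mkℚᵘ (ℤ.+ n) 0)

fromNat-+ : ∀ m n → fromNat (m ℕ.+ n) ≡ fromNat m + fromNat n
fromNat-+ m n = toℚᵘ-injective (begin
  toℚᵘ (fromNat (m ℕ.+ n))                 ≈⟨ toℚᵘ-fromNat (m ℕ.+ n) ⟩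
  ℚᵘ.mkℚᵘ (ℤ.+ (m ℕ.+ n)) 0                ≈⟨ ℚᵘ.*≡* (cong (ℤ._* ℤ.1ℤ) (cong₂ ℤ._+_ (ℤ.*-identityʳ (ℤ.+ m)) (ℤ.*-identityʳ (ℤ.+ n)))) ⟨
  ℚᵘ.mkℚᵘ (ℤ.+ m) 0 ℚᵘ.+ ℚᵘ.mkℚᵘ (ℤ.+ n) 0 ≈⟨ ℚᵘ.+-cong (toℚᵘ-fromNat m) (toℚᵘ-fromNat n) ⟨
  toℚᵘ (fromNat m) ℚᵘ.+ toℚᵘ (fromNat n)   ≈⟨ toℚᵘ-homo-+ (fromNat m) (fromNat n) ⟨
  toℚᵘ (fromNat m + fromNat n)             ∎)
  where open ℚᵘ.≃-Reasoning

fromNat-* : ∀ m n → fromNat (m ℕ.* n) ≡ fromNat m * fromNat n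
fromNat-* m n = toℚᵘ-injective (begin
  toℚᵘ (fromNat (m ℕ.* n))                 ≈⟨ toℚᵘ-fromNat (m ℕ.* n) ⟩
  ℚᵘ.mkℚᵘ (ℤ.+ (m ℕ.* n)) 0                ≈⟨ ℚᵘ.*≡* (cong (ℤ._* ℤ.1ℤ) (ℤ.pos-* m n)) ⟩
  ℚᵘ.mkℚᵘ (ℤ.+ m) 0 ℚᵘ.* ℚᵘ.mkℚᵘ (ℤ.+ n) 0 ≈⟨ ℚᵘ.*-cong (toℚᵘ-fromNat m) (toℚᵘ-fromNat n) ⟨
  toℚᵘ (fromNat m) ℚᵘ.* toℚᵘ (fromNat n)   ≈⟨ toℚᵘ-homo-* (fromNat m) (fromNat n) ⟨
  toℚᵘ (fromNat m * fromNat n)             ∎)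
  where open ℚᵘ.≃-Reasoning

0≤fromNat : ∀ n → 0ℚ ≤ fromNat n
0≤fromNat n = nonNegative⁻¹ (fromNat n) {{normalize-nonNeg n 1}}

archimedean : ∀ x → ∃ λ n → x ≤ fromNat n
archimedean x@(mkℚ i d _) = ℤ.∣ i ∣ , toℚᵘ-cancel-≤ (ℚᵘ.≤-respʳ-≃ (ℚᵘ.≃-sym (toℚᵘ-fromNat ℤ.∣ i ∣))
  (ℚᵘ.*≤* (ℤ.≤-trans (ℤ.≤-reflexive (ℤ.*-identityʳ i)) (abs-bound i d))))
  where
  abs-bound : ∀ i d → i ℤ.≤ (ℤ.+ ℤ.∣ i ∣) ℤ.* (ℤ.+ suc d)
  abs-bound (ℤ.+ m)    d = subst (ℤ.+ m ℤ.≤_) (ℤ.pos-* m (suc d)) (ℤ.+≤+ (ℕ.m≤m*n m (suc d)))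
  abs-bound ℤ.-[1+ m ] d = ℤ.-≤+

inverse : ∀ {x} → 0ℚ < x → ∃ λ i → 0ℚ < i × x * i ≡ 1ℚ
inverse {x} 0<x = 1/ x , positive⁻¹ (1/ x) {{1/pos⇒pos x}} , *-inverseʳ x
  where instance
  x>0 = positive 0<x
  x≢0 = pos⇒nonZero x

-- Bernoulli's inequality for the reciprocal of `1 - h`, multiplied out to avoid division. The
-- induction step holds because `(1 - h) * (1 + (k + 1) * h)` falls short of `1 + k * h` by
-- `(k + 1) * h²`.
bernoulli : ∀ k h → 0ℚ ≤ h → h ≤ 1ℚ → (1ℚ - h) ^ k * (1ℚ + fromNat k * h) ≤ 1ℚ
bernoulli zero    h 0≤h h≤1 = ≤-reflexive (lem h)
  where
  lem : ∀ h → 1ℚ * (1ℚ + 0ℚ * h) ≡ 1ℚ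
  lem = solve-∀ ring
bernoulli (suc k) h 0≤h h≤1 = ≤-trans
  (≤-by ((1ℚ - h) ^ k * ((fromNat k + 1ℚ) * (h * h)))
    (0≤-* (0≤-^ k (≤⇒0≤- h≤1)) (0≤-* (0≤-+ (0≤fromNat k) 0≤1) (0≤-square h)))
    (trans (lem ((1ℚ - h) ^ k) (fromNat k) h)
      (cong (λ z → (1ℚ - h) * (1ℚ - h) ^ k * (1ℚ + z * h) + (1ℚ - h) ^ k * ((fromNat k + 1ℚ) * (h * h)))
        (sym (fromNat-+ 1 k)))))
  (bernoulli k h 0≤h h≤1)
  where
  lem : ∀ a k h → a * (1ℚ + k * h) ≡ (1ℚ - h) * a * (1ℚ + (1ℚ + k) * h) + a * ((k + 1ℚ) * (h * h))
  lem = solve-∀ ring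

power-tends-to-0 : ∀ {h τ} → 0ℚ < h → h ≤ 1ℚ → 0ℚ < τ → ∃ λ k → (1ℚ - h) ^ k ≤ τ
power-tends-to-0 {h} {τ} 0<h h≤1 0<τ = k , *-cancelˡ q 0<q (begin
  q * (1ℚ - h) ^ k  ≡⟨ *-comm q _ ⟩
  (1ℚ - h) ^ k * q  ≤⟨ bernoulli k h (<⇒≤ 0<h) h≤1 ⟩
  1ℚ                ≡⟨ hτi≡1 ⟨
  h * τ * i         ≤⟨ *-monoˡ (h * τ) (<⇒≤ 0<hτ) i≤k ⟩
  h * τ * fromNat k ≤⟨ ≤-by τ (<⇒≤ 0<τ) (lem h τ (fromNat k)) ⟩
  q * τ             ∎)
  where
  open ≤-Reasoning
  0<hτ = 0<-* 0<h 0<τ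
  i = proj₁ (inverse 0<hτ)
  hτi≡1 = proj₂ (proj₂ (inverse 0<hτ))
  k = proj₁ (archimedean i)
  i≤k = proj₂ (archimedean i)
  q = 1ℚ + fromNat k * h
  0<q : 0ℚ < q
  0<q = +-mono-<-≤ (from-yes (0ℚ <? 1ℚ)) (0≤-* (0≤fromNat k) (<⇒≤ 0<h))
  lem : ∀ h τ k → (1ℚ + k * h) * τ ≡ h * τ * k + τ
  lem = solve-∀ ring

-- Averages over a finite set

0<fromNat : ∀ n {{_ : ℕ.NonZero n}} → 0ℚ < fromNat n
0<fromNat n = positive⁻¹ (fromNat n) {{normalize-pos n 1}}

sum-mono-≤ : ∀ {n} {f g : Fin n → ℚ} → (∀ i → f i ≤ g i) → sum f ≤ sum g
sum-mono-≤ {zero}  f≤g = ≤-refl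
sum-mono-≤ {suc n} f≤g = +-mono-≤ (f≤g zero) (sum-mono-≤ (λ i → f≤g (suc i)))

sum-const : ∀ n a → sum {n} (λ _ → a) ≡ fromNat n * a
sum-const zero    a = sym (*-zeroˡ a)
sum-const (suc n) a = begin
  a + sum {n} (λ _ → a)  ≡⟨ cong (a +_) (sum-const n a) ⟩
  a + fromNat n * a      ≡⟨ lem a (fromNat n) ⟩
  (1ℚ + fromNat n) * a   ≡⟨ cong (_* a) (fromNat-+ 1 n) ⟨
  fromNat (suc n) * a    ∎
  where
  open ≡-Reasoning
  lem : ∀ a k → a + k * a ≡ (1ℚ + k) * a
  lem = solve-∀ ring

module Average (n : ℕ) {{nz : ℕ.NonZero n}} where

  opaque
    n⁻¹ : ℚ
    n⁻¹ = proj₁ (inverse (0<fromNat n))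

    0<n⁻¹ : 0ℚ < n⁻¹
    0<n⁻¹ = proj₁ (proj₂ (inverse (0<fromNat n)))

    n*n⁻¹≡1 : fromNat n * n⁻¹ ≡ 1ℚ
    n*n⁻¹≡1 = proj₂ (proj₂ (inverse (0<fromNat n)))

  opaque
    E : (Fin n → ℚ) → ℚ
    E f = n⁻¹ * sum f

    E-def : ∀ f → E f ≡ n⁻¹ * sum f
    E-def f = refl

    E-cong : ∀ {f g} → (∀ i → f i ≡ g i) → E f ≡ E g
    E-cong f≡g = cong (n⁻¹ *_) (sum-cong-≗ f≡g)

    E-mono : ∀ {f g} → (∀ i → f i ≤ g i) → E f ≤ E g
    E-mono f≤g = *-monoˡ n⁻¹ (<⇒≤ 0<n⁻¹) (sum-mono-≤ f≤g)

    E-+ : ∀ f g → E (λ i → f i + g i) ≡ E f + E g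
    E-+ f g = trans (cong (n⁻¹ *_) (∑-distrib-+ f g)) (*-distribˡ-+ n⁻¹ (sum f) (sum g))

    E-* : ∀ a f → E (λ i → a * f i) ≡ a * E f
    E-* a f = trans (cong (n⁻¹ *_) (sym (*-distribˡ-sum a f))) (lem n⁻¹ a (sum f))
      where
      lem : ∀ x y z → x * (y * z) ≡ y * (x * z)
      lem = solve-∀ ring

    E-const : ∀ a → E (λ _ → a) ≡ a
    E-const a = begin
      n⁻¹ * sum {n} (λ _ → a)  ≡⟨ cong (n⁻¹ *_) (sum-const n a) ⟩
      n⁻¹ * (fromNat n * a)    ≡⟨ lem n⁻¹ (fromNat n) a ⟩
      fromNat n * n⁻¹ * a      ≡⟨ cong (_* a) n*n⁻¹≡1 ⟩
      1ℚ * a                   ≡⟨ *-identityˡ a ⟩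
      a                        ∎
      where
      open ≡-Reasoning
      lem : ∀ x y z → x * (y * z) ≡ y * x * z
      lem = solve-∀ ring

    E-swap : ∀ (K : Fin n → Fin n → ℚ) → E (λ i → E (λ j → K i j)) ≡ E (λ j → E (λ i → K i j))
    E-swap K = cong (n⁻¹ *_) (begin
      sum (λ i → n⁻¹ * sum (K i))            ≡⟨ *-distribˡ-sum n⁻¹ (λ i → sum (K i)) ⟨
      n⁻¹ * sum (λ i → sum (K i))            ≡⟨ cong (n⁻¹ *_) (∑-comm K) ⟩
      n⁻¹ * sum (λ j → sum (λ i → K i j))    ≡⟨ *-distribˡ-sum n⁻¹ (λ j → sum (λ i → K i j)) ⟩
      sum (λ j → n⁻¹ * sum (λ i → K i j))    ∎)
      where open ≡-Reasoning

  V : Set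
  V = Fin n

  E-*ʳ : ∀ f a → E (λ i → f i * a) ≡ E f * a
  E-*ʳ f a = trans (E-cong (λ i → *-comm (f i) a)) (trans (E-* a f) (*-comm a (E f)))

  E-neg : ∀ f → E (λ i → - f i) ≡ - E f
  E-neg f = trans (E-cong (λ i → lem (f i))) (trans (E-* (- 1ℚ) f) (sym (lem (E f))))
    where
    lem : ∀ x → - x ≡ - 1ℚ * x
    lem = solve-∀ ring

  E-- : ∀ f g → E (λ i → f i - g i) ≡ E f - E g
  E-- f g = trans (E-+ f (λ i → - g i)) (cong (E f +_) (E-neg g))

  E-nonNeg : ∀ {f} → (∀ i → 0ℚ ≤ f i) → 0ℚ ≤ E f
  E-nonNeg 0≤f = subst (_≤ E _) (E-const 0ℚ) (E-mono 0≤f)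

  E-≤ : ∀ {f a} → (∀ i → f i ≤ a) → E f ≤ a
  E-≤ {a = a} f≤a = subst (E _ ≤_) (E-const a) (E-mono f≤a)

  ∣E∣≤E∣∣ : ∀ f → ∣ E f ∣ ≤ E (λ i → ∣ f i ∣)
  ∣E∣≤E∣∣ f = ∣x∣-lub (E f) (E-mono (λ i → x≤∣x∣ (f i)))
    (subst (_≤ E (λ i → ∣ f i ∣)) (E-neg f) (E-mono (λ i → -x≤∣x∣ (f i))))

  E-product : ∀ f g → E (λ i → E (λ j → f i * g j)) ≡ E f * E g
  E-product f g = trans (E-cong (λ i → E-* (f i) g)) (E-*ʳ f (E g))

  -- The difference of the two sides is the variance of `f`.
  jensen : ∀ f → E f * E f ≤ E (λ i → f i * f i)
  jensen f = ≤-by (E (λ i → (f i - m) * (f i - m))) (E-nonNeg (λ i → 0≤-square (f i - m)))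
    (sym (begin
      m * m + E (λ i → (f i - m) * (f i - m))
        ≡⟨ cong (m * m +_) (E-cong (λ i → expand (f i) m)) ⟩
      m * m + E (λ i → f i * f i + (- (m + m) * f i + m * m))
        ≡⟨ cong (m * m +_) (trans (E-+ (λ i → f i * f i) (λ i → - (m + m) * f i + m * m))
             (cong (E (λ i → f i * f i) +_) (trans (E-+ (λ i → - (m + m) * f i) (λ _ → m * m))
               (cong₂ _+_ (E-* (- (m + m)) f) (E-const (m * m)))))) ⟩
      m * m + (E (λ i → f i * f i) + (- (m + m) * m + m * m))
        ≡⟨ collect m (E (λ i → f i * f i)) ⟩
      E (λ i → f i * f i) ∎))
    where
    open ≡-Reasoning
    m = E f
    expand : ∀ x m → (x - m) * (x - m) ≡ x * x + (- (m + m) * x + m * m)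
    expand = solve-∀ ring
    collect : ∀ m s → m * m + (s + (- (m + m) * m + m * m)) ≡ s
    collect = solve-∀ ring

  Fun Kernel : Set
  Fun    = V → ℚ
  Kernel = V → V → ℚ

  E₂ : Kernel → ℚ
  E₂ K = E λ x → E λ y → K x y

  E₂-cong : ∀ {K L : Kernel} → (∀ x y → K x y ≡ L x y) → E₂ K ≡ E₂ L
  E₂-cong h = E-cong λ x → E-cong (h x)

  E₂-mono : ∀ {K L : Kernel} → (∀ x y → K x y ≤ L x y) → E₂ K ≤ E₂ L
  E₂-mono h = E-mono λ x → E-mono (h x)

  E₂-+ : ∀ (K L : Kernel) → E₂ (λ x y → K x y + L x y) ≡ E₂ K + E₂ L
  E₂-+ K L = trans (E-cong λ x → E-+ (K x) (L x)) (E-+ (λ x → E (K x)) (λ x → E (L x)))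

  E₂-* : ∀ a (K : Kernel) → E₂ (λ x y → a * K x y) ≡ a * E₂ K
  E₂-* a K = trans (E-cong λ x → E-* a (K x)) (E-* a (λ x → E (K x)))

  E₂-neg : ∀ (K : Kernel) → E₂ (λ x y → - K x y) ≡ - E₂ K
  E₂-neg K = trans (E-cong λ x → E-neg (K x)) (E-neg (λ x → E (K x)))

  E₂-- : ∀ (K L : Kernel) → E₂ (λ x y → K x y - L x y) ≡ E₂ K - E₂ L
  E₂-- K L = trans (E-cong λ x → E-- (K x) (L x)) (E-- (λ x → E (K x)) (λ x → E (L x)))

  E₂-const : ∀ a → E₂ (λ _ _ → a) ≡ a
  E₂-const a = trans (E-cong λ _ → E-const a) (E-const a)

  E₂-nonNeg : ∀ {K : Kernel} → (∀ x y → 0ℚ ≤ K x y) → 0ℚ ≤ E₂ K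
  E₂-nonNeg h = E-nonNeg λ x → E-nonNeg (h x)

  E₂-fst : ∀ (f : Fun) → E₂ (λ x _ → f x) ≡ E f
  E₂-fst f = E-cong λ x → E-const (f x)

  E₂-snd : ∀ (f : Fun) → E₂ (λ _ y → f y) ≡ E f
  E₂-snd f = E-const (E f)

  jensen₂ : ∀ (K : Kernel) → E₂ K * E₂ K ≤ E₂ (λ x y → K x y * K x y)
  jensen₂ K = ≤-trans (jensen (λ x → E (K x))) (E-mono λ x → jensen (K x))

  Bounded : Fun → Set
  Bounded f = ∀ x → ∣ f x ∣ ≤ 1ℚ

  -- A one-sided bound suffices, as f may be replaced by - f.
  CutSmall : ℚ → Kernel → Set
  CutSmall γ K = ∀ f g → Bounded f → Bounded g → E₂ (λ x y → f x * g y * K x y) ≤ γ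

-- Quasirandomness from four-cycles

module _ {n : ℕ} {{nz : ℕ.NonZero n}} where
  open Average n

  -- With `F = G` this turns the second moment of column averages into an average over pairs of
  -- rows, which is how squares become codegrees.
  E-mul : ∀ (F G : Kernel) →
    E (λ y → E (λ x → F x y) * E (λ x → G x y)) ≡ E₂ (λ x x′ → E λ y → F x y * G x′ y)
  E-mul F G = begin
    E (λ y → E (λ x → F x y) * E (λ x → G x y))
      ≡⟨ E-cong (λ y → E-product (λ x → F x y) (λ x′ → G x′ y)) ⟨
    E (λ y → E₂ λ x x′ → F x y * G x′ y)
      ≡⟨ E-swap (λ y x → E λ x′ → F x y * G x′ y) ⟩
    E (λ x → E λ y → E λ x′ → F x y * G x′ y)
      ≡⟨ E-cong (λ x → E-swap (λ y x′ → F x y * G x′ y)) ⟩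
    E₂ (λ x x′ → E λ y → F x y * G x′ y) ∎
    where open ≡-Reasoning

  E₂-square-shift : ∀ (K : Kernel) s →
    E₂ (λ x y → (K x y - s) * (K x y - s)) ≡ E₂ (λ x y → K x y * K x y) + (- (s + s) * E₂ K + s * s)
  E₂-square-shift K s = begin
    E₂ (λ x y → (K x y - s) * (K x y - s))
      ≡⟨ E₂-cong (λ x y → expand (K x y) s) ⟩
    E₂ (λ x y → K x y * K x y + (- (s + s) * K x y + s * s))
      ≡⟨ E₂-+ (λ x y → K x y * K x y) (λ x y → - (s + s) * K x y + s * s) ⟩
    E₂ (λ x y → K x y * K x y) + E₂ (λ x y → - (s + s) * K x y + s * s)
      ≡⟨ cong (E₂ (λ x y → K x y * K x y) +_) (trans (E₂-+ (λ x y → - (s + s) * K x y) (λ _ _ → s * s))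
           (cong₂ _+_ (E₂-* (- (s + s)) K) (E₂-const (s * s)))) ⟩
    E₂ (λ x y → K x y * K x y) + (- (s + s) * E₂ K + s * s) ∎
    where
    open ≡-Reasoning
    expand : ∀ x m → (x - m) * (x - m) ≡ x * x + (- (m + m) * x + m * m)
    expand = solve-∀ ring

  E-square-shift : ∀ (f : Fun) s →
    E (λ x → (f x - s) * (f x - s)) ≡ E (λ x → f x * f x) + (- (s + s) * E f + s * s)
  E-square-shift f s = begin
    E (λ x → (f x - s) * (f x - s))
      ≡⟨ E₂-fst (λ x → (f x - s) * (f x - s)) ⟨
    E₂ (λ x _ → (f x - s) * (f x - s))
      ≡⟨ E₂-square-shift (λ x _ → f x) s ⟩
    E₂ (λ x _ → f x * f x) + (- (s + s) * E₂ (λ x _ → f x) + s * s)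
      ≡⟨ cong₂ (λ p q → p + (- (s + s) * q + s * s)) (E₂-fst (λ x → f x * f x)) (E₂-fst f) ⟩
    E (λ x → f x * f x) + (- (s + s) * E f + s * s) ∎
    where open ≡-Reasoning

  -- For symmetric `W` this is the composition `W ∘ W`; the mean of its square is the four-cycle
  -- density of `W`.
  codegree : Kernel → Kernel
  codegree W x x′ = E λ y → W x y * W x′ y

  -- The theorem of Chung, Graham and Wilson for weighted kernels. Density about `c` already forces
  -- four-cycle density about `c⁴`, so near equality makes codegrees concentrate at `c²` and degrees
  -- at `c`. The root mean square deviations are at most `½ * (θ * θ)` for codegrees and `θ` for
  -- degrees.
  module FourCycle
    (W : Kernel) (W-sym : ∀ x y → W x y ≡ W y x)
    {c δ θ γ : ℚ} (0≤c : 0ℚ ≤ c) (c≤1 : c ≤ 1ℚ) (0≤δ : 0ℚ ≤ δ) (0≤θ : 0ℚ ≤ θ) (0≤γ : 0ℚ ≤ γ)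
    (5δ≤ : (δ + δ) + (δ + δ) + δ ≤ (½ * (θ * θ)) * (½ * (θ * θ)))
    (2δ≤ : δ + δ ≤ ½ * (θ * θ))
    (≤γγ : ½ * (θ * θ) + (θ + θ) ≤ γ * γ)
    (density : c - δ ≤ E₂ W)
    (four-cycles : E₂ (λ x y → codegree W x y * codegree W x y) ≤ (c * c) * (c * c) + δ)
    where

    private
      open ≤-Reasoning

      deg : Fun
      deg x = E (W x)

      s q : ℚ
      s = c * c
      q = E₂ (codegree W)

      0≤1-c : 0ℚ ≤ 1ℚ - c
      0≤1-c = ≤⇒0≤- c≤1

      q≡ : q ≡ E (λ x → deg x * deg x)
      q≡ = trans (sym (E-mul W W)) (E-cong λ y →
        cong (λ z → z * z) (E-cong λ x → W-sym x y))

      q≥ : s - (c + c) * δ ≤ q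
      q≥ = begin
        s - (c + c) * δ
          -- The tangent bound `a² ≥ 2ca - c²` followed by `a ≥ c - δ`; it stays valid when `c - δ`
          -- is negative.
          ≤⟨ ≤-by ((E₂ W - c) * (E₂ W - c) + (c + c) * (E₂ W - (c - δ)))
               (0≤-+ (0≤-square (E₂ W - c)) (0≤-* (0≤-+ 0≤c 0≤c) (≤⇒0≤- density)))
               (lem (E₂ W) c δ) ⟩
        E₂ W * E₂ W  ≤⟨ jensen deg ⟩
        E (λ x → deg x * deg x) ≡⟨ q≡ ⟨
        q ∎
        where
        lem : ∀ a c δ → a * a ≡ c * c - (c + c) * δ + ((a - c) * (a - c) + (c + c) * (a - (c - δ)))
        lem = solve-∀ ring

      variance : ℚ
      variance = E₂ (λ x y → (codegree W x y - s) * (codegree W x y - s))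

      -- The excess consists of `δ` from `four-cycles` and `4c³δ ≤ 4δ` from `q≥`, whence the
      -- hypothesis `5δ≤`.
      variance≤ : variance ≤ (½ * (θ * θ)) * (½ * (θ * θ))
      variance≤ = begin
        variance
          ≡⟨ E₂-square-shift (codegree W) s ⟩
        E₂ (λ x y → codegree W x y * codegree W x y) + (- (s + s) * q + s * s)
          ≤⟨ +-monoˡ-≤ (- (s + s) * q + s * s) four-cycles ⟩
        s * s + δ + (- (s + s) * q + s * s)
          ≤⟨ ≤-by ((s + s) * (q - (s - (c + c) * δ)))
               (0≤-* (0≤-+ (0≤-* 0≤c 0≤c) (0≤-* 0≤c 0≤c)) (≤⇒0≤- q≥)) (lem₁ q c δ) ⟩
        δ + s * c * ((δ + δ) + (δ + δ))
          ≤⟨ +-monoʳ-≤ δ (*-monoʳ-≤-nonNeg _ {{nonNegative 0≤4δ}} s*c≤1) ⟩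
        δ + 1ℚ * ((δ + δ) + (δ + δ))
          ≡⟨ lem₂ δ ⟩
        (δ + δ) + (δ + δ) + δ
          ≤⟨ 5δ≤ ⟩
        (½ * (θ * θ)) * (½ * (θ * θ)) ∎
        where
        lem₁ : ∀ q c δ → δ + c * c * c * ((δ + δ) + (δ + δ)) ≡
          c * c * (c * c) + δ + (- (c * c + c * c) * q + c * c * (c * c)) + (c * c + c * c) * (q - (c * c - (c + c) * δ))
        lem₁ = solve-∀ ring
        lem₂ : ∀ δ → δ + 1ℚ * ((δ + δ) + (δ + δ)) ≡ (δ + δ) + (δ + δ) + δ
        lem₂ = solve-∀ ring
        0≤4δ = 0≤-+ (0≤-+ 0≤δ 0≤δ) (0≤-+ 0≤δ 0≤δ)
        s*c≤1 : s * c ≤ 1ℚ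
        s*c≤1 = *-mono-≤ (0≤-* 0≤c 0≤c) 0≤1 (*-mono-≤ 0≤c 0≤1 c≤1 c≤1) c≤1

      0≤½θθ : 0ℚ ≤ ½ * (θ * θ)
      0≤½θθ = 0≤-* (from-yes (0ℚ ≤? ½)) (0≤-square θ)

      -- The density is bounded only from below, so the upper bound on the second moment of the
      -- degrees has to come from the four-cycles: `q - s` is the mean of the codegree deviation,
      -- and Jensen bounds its square by `variance`.
      q≤ : q ≤ s + ½ * (θ * θ)
      q≤ = subst (_≤ s + ½ * (θ * θ)) (lem q s) (+-monoʳ-≤ s (square-cancel-≤ 0≤½θθ (begin
        (q - s) * (q - s)
          ≡⟨ cong (λ z → z * z) (trans (E₂-- (codegree W) (λ _ _ → s)) (cong (λ z → q - z) (E₂-const s))) ⟨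
        E₂ (λ x y → codegree W x y - s) * E₂ (λ x y → codegree W x y - s)
          ≤⟨ jensen₂ (λ x y → codegree W x y - s) ⟩
        variance
          ≤⟨ variance≤ ⟩
        (½ * (θ * θ)) * (½ * (θ * θ)) ∎)))
        where
        lem : ∀ q s → s + (q - s) ≡ q
        lem = solve-∀ ring

      degree-variance≤ : E (λ x → (deg x - c) * (deg x - c)) ≤ θ * θ
      degree-variance≤ = begin
        E (λ x → (deg x - c) * (deg x - c))
          ≡⟨ E-square-shift deg c ⟩
        E (λ x → deg x * deg x) + (- (c + c) * E deg + s)
          ≡⟨ cong (_+ (- (c + c) * E deg + s)) q≡ ⟨
        q + (- (c + c) * E deg + s)
          ≤⟨ +-monoˡ-≤ _ q≤ ⟩
        s + ½ * (θ * θ) + (- (c + c) * E deg + s)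
          ≤⟨ ≤-by ((c + c) * (E deg - (c - δ)) + (1ℚ - c) * (δ + δ) + (½ * (θ * θ) - (δ + δ)))
               (0≤-+ (0≤-+ (0≤-* (0≤-+ 0≤c 0≤c) (≤⇒0≤- density)) (0≤-* 0≤1-c (0≤-+ 0≤δ 0≤δ))) (≤⇒0≤- 2δ≤))
               (trans (halves (θ * θ)) (lem (½ * (θ * θ)) c (E deg) δ)) ⟩
        θ * θ ∎
        where
        halves : ∀ x → x ≡ ½ * x + ½ * x
        halves = solve-∀ ring
        lem : ∀ h c a δ → h + h ≡ c * c + h + (- (c + c) * a + c * c)
          + ((c + c) * (a - (c - δ)) + (1ℚ - c) * (δ + δ) + (h - (δ + δ)))
        lem = solve-∀ ring

    -- Jensen in `y` together with `square-damp` removes `g`. Expanding the remaining square over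
    -- `x` and `x′` and averaging `(W x y - c) * (W x′ y - c)` over `y` leaves the codegree
    -- deviation minus `c` times the two degree deviations, which are bounded by `X≤` and `-EfY≤`.
    cutSmall : CutSmall γ (λ x y → W x y - c)
    cutSmall f g f-bdd g-bdd = square-cancel-≤ 0≤γ (begin
      E₂ (λ x y → f x * g y * (W x y - c)) * E₂ (λ x y → f x * g y * (W x y - c))
        ≡⟨ cong (λ z → z * z) (trans (E-swap (λ x y → f x * g y * (W x y - c))) (E-cong λ y →
             trans (E-cong λ x → lem₁ (f x) (g y) (W x y - c)) (E-* (g y) (λ x → f x * (W x y - c))))) ⟩
      E (λ y → g y * h y) * E (λ y → g y * h y)
        ≤⟨ jensen (λ y → g y * h y) ⟩
      E (λ y → g y * h y * (g y * h y))
        ≤⟨ E-mono (λ y → square-damp (g y) (h y) (g-bdd y)) ⟩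
      E (λ y → h y * h y)
        ≡⟨ E-mul (λ x y → f x * (W x y - c)) (λ x y → f x * (W x y - c)) ⟩
      E₂ (λ x x′ → E λ y → f x * (W x y - c) * (f x′ * (W x′ y - c)))
        ≡⟨ E₂-cong (λ x x′ → inner x x′) ⟩
      E₂ (λ x x′ → f x * f x′ * (codegree W x x′ - s)
                   - c * (f x * (deg x - c) * f x′ + f x * (f x′ * (deg x′ - c))))
        ≡⟨ E₂-- (λ x x′ → f x * f x′ * (codegree W x x′ - s))
                (λ x x′ → c * (f x * (deg x - c) * f x′ + f x * (f x′ * (deg x′ - c)))) ⟩
      X - E₂ (λ x x′ → c * (f x * (deg x - c) * f x′ + f x * (f x′ * (deg x′ - c))))
        ≡⟨ cong (λ z → X - z) (trans (E₂-* c _) (cong (c *_) (trans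
             (E₂-+ (λ x x′ → f x * (deg x - c) * f x′) (λ x x′ → f x * (f x′ * (deg x′ - c))))
             (cong₂ _+_ (E-product (λ x → f x * (deg x - c)) f) (E-product f (λ x → f x * (deg x - c))))))) ⟩
      X - c * (Y * E f + E f * Y)
        ≡⟨ lem₂ X c (E f) Y ⟩
      X + (c + c) * (- (E f * Y))
        ≤⟨ +-mono-≤ X≤ (≤-trans (*-monoˡ (c + c) (0≤-+ 0≤c 0≤c) -EfY≤)
             (≤-by ((1ℚ - c) * (θ + θ)) (0≤-* 0≤1-c (0≤-+ 0≤θ 0≤θ)) (lem₃ c θ))) ⟩
      ½ * (θ * θ) + (θ + θ)
        ≤⟨ ≤γγ ⟩
      γ * γ ∎)
      where
      h : Fun
      h y = E λ x → f x * (W x y - c)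
      X Y : ℚ
      X = E₂ λ x x′ → f x * f x′ * (codegree W x x′ - s)
      Y = E λ x → f x * (deg x - c)
      lem₁ : ∀ a b d → a * b * d ≡ b * (a * d)
      lem₁ = solve-∀ ring
      lem₂ : ∀ X c e Y → X - c * (Y * e + e * Y) ≡ X + (c + c) * (- (e * Y))
      lem₂ = solve-∀ ring
      lem₃ : ∀ c θ → θ + θ ≡ (c + c) * θ + (1ℚ - c) * (θ + θ)
      lem₃ = solve-∀ ring

      inner : ∀ x x′ → E (λ y → f x * (W x y - c) * (f x′ * (W x′ y - c))) ≡
        f x * f x′ * (codegree W x x′ - s) - c * (f x * (deg x - c) * f x′ + f x * (f x′ * (deg x′ - c)))
      inner x x′ = begin-equality
        E (λ y → f x * (W x y - c) * (f x′ * (W x′ y - c)))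
          ≡⟨ E-cong (λ y → expand (f x) (f x′) (W x y) (W x′ y) c) ⟩
        E (λ y → f x * f x′ * (W x y * W x′ y + (- c * W x y + (- c * W x′ y + c * c))))
          ≡⟨ trans (E-* (f x * f x′) _) (cong (f x * f x′ *_)
               (trans (E-+ (λ y → W x y * W x′ y) _) (cong (codegree W x x′ +_)
                 (trans (E-+ (λ y → - c * W x y) _) (cong₂ _+_ (E-* (- c) (W x))
                   (trans (E-+ (λ y → - c * W x′ y) _) (cong₂ _+_ (E-* (- c) (W x′)) (E-const (c * c))))))))) ⟩
        f x * f x′ * (codegree W x x′ + (- c * deg x + (- c * deg x′ + c * c)))
          ≡⟨ collect (f x) (f x′) (codegree W x x′) (deg x) (deg x′) c ⟩
        f x * f x′ * (codegree W x x′ - s) - c * (f x * (deg x - c) * f x′ + f x * (f x′ * (deg x′ - c))) ∎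
        where
        expand : ∀ a b u v c → a * (u - c) * (b * (v - c)) ≡ a * b * (u * v + (- c * u + (- c * v + c * c)))
        expand = solve-∀ ring
        collect : ∀ a b k u v c → a * b * (k + (- c * u + (- c * v + c * c))) ≡
          a * b * (k - c * c) - c * (a * (u - c) * b + a * (b * (v - c)))
        collect = solve-∀ ring

      X≤ : X ≤ ½ * (θ * θ)
      X≤ = square-cancel-≤ 0≤½θθ (begin
        X * X
          ≤⟨ jensen₂ (λ x x′ → f x * f x′ * (codegree W x x′ - s)) ⟩
        E₂ (λ x x′ → f x * f x′ * (codegree W x x′ - s) * (f x * f x′ * (codegree W x x′ - s)))
          ≤⟨ E₂-mono (λ x x′ → square-damp (f x * f x′) (codegree W x x′ - s) (∣xy∣≤1 (f x) (f x′) (f-bdd x) (f-bdd x′))) ⟩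
        variance
          ≤⟨ variance≤ ⟩
        (½ * (θ * θ)) * (½ * (θ * θ)) ∎)

      -EfY≤ : - (E f * Y) ≤ θ
      -EfY≤ = square-cancel-≤ 0≤θ (begin
        - (E f * Y) * - (E f * Y)
          ≡⟨ lem₄ (E f) Y ⟩
        E f * E f * (Y * Y)
          ≤⟨ *-monoʳ-≤-nonNeg (Y * Y) {{nonNegative (0≤-square Y)}}
               (≤-trans (jensen f) (E-≤ λ x → ∣x∣≤1⇒x²≤1 (f x) (f-bdd x))) ⟩
        1ℚ * (Y * Y)
          ≡⟨ *-identityˡ (Y * Y) ⟩
        Y * Y
          ≤⟨ jensen (λ x → f x * (deg x - c)) ⟩
        E (λ x → f x * (deg x - c) * (f x * (deg x - c)))
          ≤⟨ E-mono (λ x → square-damp (f x) (deg x - c) (f-bdd x)) ⟩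
        E (λ x → (deg x - c) * (deg x - c))
          ≤⟨ degree-variance≤ ⟩
        θ * θ ∎)
        where
        lem₄ : ∀ e y → - (e * y) * - (e * y) ≡ e * e * (y * y)
        lem₄ = solve-∀ ring

-- Cut norm

2ℚ : ℚ
2ℚ = 1ℚ + 1ℚ

0≤2 : 0ℚ ≤ 2ℚ
0≤2 = from-yes (0ℚ ≤? 2ℚ)

0≤½ : 0ℚ ≤ ½
0≤½ = from-yes (0ℚ ≤? ½)

-- At `y = 1 - b` this approximates `1 / b` by a polynomial in `b`. A polynomial is required because
-- bounds in cut norm survive multiplication by powers of a codegree kernel, but not pointwise
-- division.
geometric : ℕ → ℚ → ℚ
geometric zero    y = 0ℚ
geometric (suc k) y = geometric k y + y ^ k

geometric-sum : ∀ k y → (1ℚ - y) * geometric k y ≡ 1ℚ - y ^ k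
geometric-sum zero    y = *-zeroʳ (1ℚ - y)
geometric-sum (suc k) y = begin
  (1ℚ - y) * (geometric k y + y ^ k)             ≡⟨ *-distribˡ-+ (1ℚ - y) (geometric k y) (y ^ k) ⟩
  (1ℚ - y) * geometric k y + (1ℚ - y) * y ^ k    ≡⟨ cong (_+ (1ℚ - y) * y ^ k) (geometric-sum k y) ⟩
  1ℚ - y ^ k + (1ℚ - y) * y ^ k                  ≡⟨ lem y (y ^ k) ⟩
  1ℚ - y ^ suc k                                 ∎
  where
  open ≡-Reasoning
  lem : ∀ y p → 1ℚ - p + (1ℚ - y) * p ≡ 1ℚ - y * p
  lem = solve-∀ ring

0≤geometric : ∀ k {y} → 0ℚ ≤ y → 0ℚ ≤ geometric k y
0≤geometric zero    0≤y = ≤-refl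
0≤geometric (suc k) 0≤y = 0≤-+ (0≤geometric k 0≤y) (0≤-^ k 0≤y)

geometric≤ : ∀ k {y} → 0ℚ ≤ y → y ≤ 1ℚ → geometric k y ≤ fromNat k
geometric≤ zero    0≤y y≤1 = ≤-refl
geometric≤ (suc k) {y} 0≤y y≤1 = begin
  geometric k y + y ^ k  ≤⟨ +-mono-≤ (geometric≤ k 0≤y y≤1) (^≤1 k 0≤y y≤1) ⟩
  fromNat k + 1ℚ         ≡⟨ +-comm (fromNat k) 1ℚ ⟩
  1ℚ + fromNat k         ≡⟨ fromNat-+ 1 k ⟨
  fromNat (suc k)        ∎
  where open ≤-Reasoning

module _ {n : ℕ} {{nz : ℕ.NonZero n}} where
  open Average n

  Bounded-- : ∀ {f} → Bounded f → Bounded (λ x → - f x)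
  Bounded-- {f} f-bdd x = subst (_≤ 1ℚ) (sym (∣-p∣≡∣p∣ (f x))) (f-bdd x)

  Bounded-1 : Bounded (λ _ → 1ℚ)
  Bounded-1 _ = ≤-refl

  cutSmall-cong : ∀ {γ} {K L : Kernel} → (∀ x y → K x y ≡ L x y) → CutSmall γ K → CutSmall γ L
  cutSmall-cong K≡L K-small f g f-bdd g-bdd =
    subst (_≤ _) (E₂-cong λ x y → cong (f x * g y *_) (K≡L x y)) (K-small f g f-bdd g-bdd)

  cutSmall-weaken : ∀ {γ δ} {K : Kernel} → γ ≤ δ → CutSmall γ K → CutSmall δ K
  cutSmall-weaken γ≤δ K-small f g f-bdd g-bdd = ≤-trans (K-small f g f-bdd g-bdd) γ≤δ

  cutSmall-+ : ∀ {γ δ} {K L : Kernel} → CutSmall γ K → CutSmall δ L →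
    CutSmall (γ + δ) (λ x y → K x y + L x y)
  cutSmall-+ {γ} {δ} {K} {L} K-small L-small f g f-bdd g-bdd = begin
    E₂ (λ x y → f x * g y * (K x y + L x y))
      ≡⟨ E₂-cong (λ x y → *-distribˡ-+ (f x * g y) (K x y) (L x y)) ⟩
    E₂ (λ x y → f x * g y * K x y + f x * g y * L x y)
      ≡⟨ E₂-+ (λ x y → f x * g y * K x y) (λ x y → f x * g y * L x y) ⟩
    E₂ (λ x y → f x * g y * K x y) + E₂ (λ x y → f x * g y * L x y)
      ≤⟨ +-mono-≤ (K-small f g f-bdd g-bdd) (L-small f g f-bdd g-bdd) ⟩
    γ + δ ∎
    where open ≤-Reasoning

  cutSmall-neg : ∀ {γ} {K : Kernel} → CutSmall γ K → CutSmall γ (λ x y → - K x y)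
  cutSmall-neg {γ} {K} K-small f g f-bdd g-bdd = subst (_≤ γ)
    (E₂-cong λ x y → lem (f x) (g y) (K x y))
    (K-small (λ x → - f x) g (Bounded-- f-bdd) g-bdd)
    where
    lem : ∀ a b k → - a * b * k ≡ a * b * - k
    lem = solve-∀ ring

  cutSmall-E₂ : ∀ {γ} {K : Kernel} → CutSmall γ K → E₂ K ≤ γ
  cutSmall-E₂ {γ} {K} K-small = subst (_≤ γ)
    (E₂-cong λ x y → lem (K x y)) (K-small (λ _ → 1ℚ) (λ _ → 1ℚ) Bounded-1 Bounded-1)
    where
    lem : ∀ k → 1ℚ * 1ℚ * k ≡ k
    lem = solve-∀ ring

  cutSmall-L¹ : ∀ {γ} {K : Kernel} → E₂ (λ x y → ∣ K x y ∣) ≤ γ → CutSmall γ K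
  cutSmall-L¹ {γ} {K} K-small f g f-bdd g-bdd = ≤-trans
    (E₂-mono λ x y → ∣x∣≤1⇒xy≤∣y∣ (f x * g y) (K x y) (∣xy∣≤1 (f x) (g y) (f-bdd x) (g-bdd y)))
    K-small

  -- For each fixed `z` the factors `A x z` and `A y z` are absorbed into the test functions `f` and
  -- `g`, so the bound holds for every `z` and hence for the average.
  cutSmall-codegree : ∀ {γ} {A K : Kernel} → (∀ x → Bounded (A x)) → CutSmall γ K →
    CutSmall γ (λ x y → K x y * codegree A x y)
  cutSmall-codegree {γ} {A} {K} A-bdd K-small f g f-bdd g-bdd = begin
    E₂ (λ x y → f x * g y * (K x y * codegree A x y))
      ≡⟨ E₂-cong (λ x y → sym (trans (E-cong λ z → lem (f x) (g y) (K x y) (A x z) (A y z))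
           (trans (E-* (f x * g y * K x y) (λ z → A x z * A y z)) (*-assoc (f x * g y) (K x y) (codegree A x y))))) ⟩
    E₂ (λ x y → E λ z → f x * A x z * (g y * A y z) * K x y)
      ≡⟨ E-cong (λ x → E-swap λ y z → f x * A x z * (g y * A y z) * K x y) ⟩
    E (λ x → E λ z → E λ y → f x * A x z * (g y * A y z) * K x y)
      ≡⟨ E-swap (λ x z → E λ y → f x * A x z * (g y * A y z) * K x y) ⟩
    E (λ z → E₂ λ x y → f x * A x z * (g y * A y z) * K x y)
      ≤⟨ E-≤ (λ z → K-small (λ x → f x * A x z) (λ y → g y * A y z)
           (λ x → ∣xy∣≤1 (f x) (A x z) (f-bdd x) (A-bdd x z))
           (λ y → ∣xy∣≤1 (g y) (A y z) (g-bdd y) (A-bdd y z))) ⟩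
    γ ∎
    where
    open ≤-Reasoning
    lem : ∀ a b k u v → a * u * (b * v) * k ≡ a * b * k * (u * v)
    lem = solve-∀ ring

  -- The passage from cut norm to L¹. For fixed `x`, the sign of `R x y` is a test function of `y`
  -- and `F x` is one of `z`; together they extract the mean of the absolute value over `y`.
  L¹-of-cutSmall : ∀ {γ} {F K : Kernel} → (∀ x → Bounded (F x)) → CutSmall γ K →
    E₂ (λ x y → ∣ E (λ z → F x z * K y z) ∣) ≤ γ
  L¹-of-cutSmall {γ} {F} {K} F-bdd K-small = E-≤ λ x → begin
    E (λ y → ∣ R x y ∣)
      ≡⟨ E-cong (λ y → sgn*x≡∣x∣ (R x y)) ⟨
    E (λ y → sgn (R x y) * R x y)
      ≡⟨ E-cong (λ y → trans (E-cong λ z → *-assoc (sgn (R x y)) (F x z) (K y z))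
           (E-* (sgn (R x y)) (λ z → F x z * K y z))) ⟨
    E₂ (λ y z → sgn (R x y) * F x z * K y z)
      ≤⟨ K-small (λ y → sgn (R x y)) (F x) (λ y → ∣sgn∣≤1 (R x y)) (F-bdd x) ⟩
    γ ∎
    where
    open ≤-Reasoning
    R : Kernel
    R x y = E (λ z → F x z * K y z)

  -- The two factors of the product are replaced one after the other. The second replacement is
  -- tested against `U`, which need not be bounded by 1; it is halved to become a test function,
  -- which costs the factor `2ℚ`.
  codegree-close : ∀ {γ} {A U : Kernel} → (∀ x → Bounded (A x)) → (∀ x → Bounded (λ z → ½ * U x z)) →
    CutSmall γ (λ x y → A x y - U x y) →
    E₂ (λ x y → ∣ codegree A x y - codegree U x y ∣) ≤ γ + 2ℚ * γ
  codegree-close {γ} {A} {U} A-bdd U-bdd small = begin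
    E₂ (λ x y → ∣ codegree A x y - codegree U x y ∣)
      ≤⟨ E₂-mono (λ x y → ≤-trans (≤-reflexive (cong ∣_∣ (split x y))) (≤-trans
           (∣p+q∣≤∣p∣+∣q∣ (R₁ x y) (2ℚ * R₂ y x))
           (≤-reflexive (cong (∣ R₁ x y ∣ +_) (∣p*q∣≡∣p∣*∣q∣ 2ℚ (R₂ y x)))))) ⟩
    E₂ (λ x y → ∣ R₁ x y ∣ + 2ℚ * ∣ R₂ y x ∣)
      ≡⟨ E₂-+ (λ x y → ∣ R₁ x y ∣) (λ x y → 2ℚ * ∣ R₂ y x ∣) ⟩
    E₂ (λ x y → ∣ R₁ x y ∣) + E₂ (λ x y → 2ℚ * ∣ R₂ y x ∣)
      ≡⟨ cong (E₂ (λ x y → ∣ R₁ x y ∣) +_) (trans (E₂-* 2ℚ (λ x y → ∣ R₂ y x ∣))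
           (cong (2ℚ *_) (E-swap (λ x y → ∣ R₂ y x ∣)))) ⟩
    E₂ (λ x y → ∣ R₁ x y ∣) + 2ℚ * E₂ (λ y x → ∣ R₂ y x ∣)
      ≤⟨ +-mono-≤ (L¹-of-cutSmall A-bdd small) (*-monoˡ 2ℚ 0≤2 (L¹-of-cutSmall U-bdd small)) ⟩
    γ + 2ℚ * γ ∎
    where
    open ≤-Reasoning
    R₁ R₂ : Kernel
    R₁ x y = E (λ z → A x z * (A y z - U y z))
    R₂ y x = E (λ z → ½ * U y z * (A x z - U x z))
    lem : ∀ a b u v → a * b - u * v ≡ a * (b - v) + 2ℚ * (½ * v * (a - u))
    lem = solve-∀ ring
    split : ∀ x y → codegree A x y - codegree U x y ≡ R₁ x y + 2ℚ * R₂ y x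
    split x y = trans (sym (E-- (λ z → A x z * A y z) (λ z → U x z * U y z)))
      (trans (E-cong λ z → lem (A x z) (A y z) (U x z) (U y z))
      (trans (E-+ (λ z → A x z * (A y z - U y z)) (λ z → 2ℚ * (½ * U y z * (A x z - U x z))))
      (cong (R₁ x y +_) (E-* 2ℚ (λ z → ½ * U y z * (A x z - U x z))))))

-- The adjacency kernel is close to the reciprocal of the codegree kernel

module Reciprocal {n : ℕ} {{nz : ℕ.NonZero n}}
  (A : Average.Kernel n)
  (0≤A : ∀ x y → 0ℚ ≤ A x y) (A≤1 : ∀ x y → A x y ≤ 1ℚ)
  {c γ : ℚ} (0<c : 0ℚ < c) (c≤1 : c ≤ 1ℚ) (0≤γ : 0ℚ ≤ γ)
  (small : Average.CutSmall n γ (λ x y → A x y * codegree A x y - c))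
  where
  open Average n
  private
    open ≤-Reasoning

    0≤c : 0ℚ ≤ c
    0≤c = <⇒≤ 0<c

    0≤1-c : 0ℚ ≤ 1ℚ - c
    0≤1-c = ≤⇒0≤- c≤1

    B Y : Kernel
    B = codegree A
    Y x y = 1ℚ - B x y

    0≤B : ∀ x y → 0ℚ ≤ B x y
    0≤B x y = E-nonNeg λ z → 0≤-* (0≤A x z) (0≤A y z)

    B≤1 : ∀ x y → B x y ≤ 1ℚ
    B≤1 x y = E-≤ λ z → *-mono-≤ (0≤A x z) 0≤1 (A≤1 x z) (A≤1 y z)

    0≤Y : ∀ x y → 0ℚ ≤ Y x y
    0≤Y x y = ≤⇒0≤- (B≤1 x y)

    Y≤1 : ∀ x y → Y x y ≤ 1ℚ
    Y≤1 x y = ≤-by (B x y) (0≤B x y) (lem (B x y))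
      where
      lem : ∀ b → 1ℚ ≡ 1ℚ - b + b
      lem = solve-∀ ring

    A-bdd : ∀ x → Bounded (A x)
    A-bdd x y = 0≤x≤1⇒∣x∣≤1 (0≤A x y) (A≤1 x y)

    -- Multiplication by `Y = 1 - B` subtracts `K * B` from `K`. Both kernels obey the same cut norm
    -- bound, so every power of `Y` doubles it.
    pow : ℕ → ℚ
    pow k = 2ℚ ^ k * γ

    0≤pow : ∀ k → 0ℚ ≤ pow k
    0≤pow k = 0≤-* (0≤-^ k 0≤2) 0≤γ

    double : ∀ k → pow k + pow k ≡ pow (suc k)
    double k = lem (2ℚ ^ k) γ
      where
      lem : ∀ a γ → a * γ + a * γ ≡ (1ℚ + 1ℚ) * a * γ
      lem = solve-∀ ring

    small-Y^ : ∀ k → CutSmall (pow k) (λ x y → (A x y * B x y - c) * Y x y ^ k)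
    small-Y^ zero = cutSmall-weaken (≤-reflexive (sym (*-identityˡ γ)))
      (cutSmall-cong (λ x y → sym (*-identityʳ (A x y * B x y - c))) small)
    small-Y^ (suc k) = cutSmall-weaken (≤-reflexive (double k)) (cutSmall-cong
      (λ x y → lem (A x y * B x y - c) (Y x y ^ k) (B x y))
      (cutSmall-+ (small-Y^ k) (cutSmall-neg (cutSmall-codegree A-bdd (small-Y^ k)))))
      where
      lem : ∀ v p b → v * p + - (v * p * b) ≡ v * ((1ℚ - b) * p)
      lem = solve-∀ ring

    small-geometric : ∀ k → CutSmall (pow k) (λ x y → (A x y * B x y - c) * geometric k (Y x y))
    small-geometric zero = cutSmall-L¹ (begin
      E₂ (λ x y → ∣ (A x y * B x y - c) * 0ℚ ∣)
        ≡⟨ E₂-cong (λ x y → cong ∣_∣ (*-zeroʳ (A x y * B x y - c))) ⟩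
      E₂ (λ _ _ → 0ℚ)  ≡⟨ E₂-const 0ℚ ⟩
      0ℚ               ≤⟨ 0≤pow zero ⟩
      pow zero         ∎)
    small-geometric (suc k) = cutSmall-weaken (≤-reflexive (double k)) (cutSmall-cong
      (λ x y → sym (*-distribˡ-+ (A x y * B x y - c) (geometric k (Y x y)) (Y x y ^ k)))
      (cutSmall-+ (small-geometric k) (small-Y^ k)))

    -- Since `A ≤ 1`, `Y = 1 - B ≤ 1 - A * B`, and under the average against `Y ^ k` the product
    -- `A * B` may be replaced by `c` at the cost `pow k`. Each further power thus gains a factor
    -- `1 - c`.
    moment : ∀ k → E₂ (λ x y → Y x y ^ k) ≤ (1ℚ - c) ^ k + pow k
    moment zero = begin
      E₂ (λ _ _ → 1ℚ)  ≡⟨ E₂-const 1ℚ ⟩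
      1ℚ               ≤⟨ ≤-by (pow zero) (0≤pow zero) refl ⟩
      1ℚ + pow zero    ∎
    moment (suc k) = begin
      E₂ (λ x y → Y x y * Y x y ^ k)
        ≤⟨ E₂-mono (λ x y → ≤-by ((1ℚ - A x y) * B x y * Y x y ^ k)
             (0≤-* (0≤-* (≤⇒0≤- (A≤1 x y)) (0≤B x y)) (0≤-^ k (0≤Y x y)))
             (lem₁ (A x y) (B x y) c (Y x y ^ k))) ⟩
      E₂ (λ x y → (1ℚ - c) * Y x y ^ k + - ((A x y * B x y - c) * Y x y ^ k))
        ≡⟨ E₂-+ (λ x y → (1ℚ - c) * Y x y ^ k) (λ x y → - ((A x y * B x y - c) * Y x y ^ k)) ⟩
      E₂ (λ x y → (1ℚ - c) * Y x y ^ k) + E₂ (λ x y → - ((A x y * B x y - c) * Y x y ^ k))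
        ≤⟨ +-mono-≤ (≤-reflexive (E₂-* (1ℚ - c) (λ x y → Y x y ^ k)))
             (cutSmall-E₂ (cutSmall-neg (small-Y^ k))) ⟩
      (1ℚ - c) * E₂ (λ x y → Y x y ^ k) + pow k
        ≤⟨ +-monoˡ-≤ (pow k) (*-monoˡ (1ℚ - c) 0≤1-c (moment k)) ⟩
      (1ℚ - c) * ((1ℚ - c) ^ k + pow k) + pow k
        ≤⟨ ≤-by (c * pow k) (0≤-* 0≤c (0≤pow k)) (lem₂ c ((1ℚ - c) ^ k) (pow k)) ⟩
      (1ℚ - c) ^ suc k + (pow k + pow k)
        ≡⟨ cong ((1ℚ - c) ^ suc k +_) (double k) ⟩
      (1ℚ - c) ^ suc k + pow (suc k) ∎
      where
      lem₁ : ∀ a b c p → (1ℚ - c) * p + - ((a * b - c) * p) ≡ (1ℚ - b) * p + (1ℚ - a) * b * p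
      lem₁ = solve-∀ ring
      lem₂ : ∀ c a p → (1ℚ - c) * a + (p + p) ≡ (1ℚ - c) * (a + p) + p + c * p
      lem₂ = solve-∀ ring

    -- dominates the indicator function of B ≤ ½ * c
    bad : ℕ → Kernel
    bad j x y = ((1ℚ + c) * Y x y) ^ j

    0≤1+c : 0ℚ ≤ 1ℚ + c
    0≤1+c = 0≤-+ 0≤1 0≤c

    0≤bad : ∀ j x y → 0ℚ ≤ bad j x y
    0≤bad j x y = 0≤-^ j (0≤-* 0≤1+c (0≤Y x y))

    -- A Markov bound with high moments. The factor `1 + c` is large enough that
    -- `(1 + c) * (1 - ½ * c) ≥ 1`, so `bad` is at least 1 where `B ≤ ½ * c`, and small enough that
    -- `(1 + c) * (1 - c) = 1 - c²` still makes the mean decay.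
    E-bad : ∀ j → E₂ (bad j) ≤ (1ℚ - c * c) ^ j + 2ℚ ^ j * pow j
    E-bad j = begin
      E₂ (bad j)
        ≡⟨ E₂-cong (λ x y → ^-distribʳ-* j (1ℚ + c) (Y x y)) ⟩
      E₂ (λ x y → (1ℚ + c) ^ j * Y x y ^ j)
        ≡⟨ E₂-* ((1ℚ + c) ^ j) (λ x y → Y x y ^ j) ⟩
      (1ℚ + c) ^ j * E₂ (λ x y → Y x y ^ j)
        ≤⟨ *-monoˡ ((1ℚ + c) ^ j) (0≤-^ j 0≤1+c) (moment j) ⟩
      (1ℚ + c) ^ j * ((1ℚ - c) ^ j + pow j)
        ≡⟨ *-distribˡ-+ ((1ℚ + c) ^ j) ((1ℚ - c) ^ j) (pow j) ⟩
      (1ℚ + c) ^ j * (1ℚ - c) ^ j + (1ℚ + c) ^ j * pow j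
        ≤⟨ +-mono-≤
             (≤-reflexive (trans (sym (^-distribʳ-* j (1ℚ + c) (1ℚ - c))) (cong (_^ j) (lem c))))
             (*-monoʳ-≤-nonNeg (pow j) {{nonNegative (0≤pow j)}} (^-monoˡ-≤ j 0≤1+c (+-monoʳ-≤ 1ℚ c≤1))) ⟩
      (1ℚ - c * c) ^ j + 2ℚ ^ j * pow j ∎
      where
      lem : ∀ c → (1ℚ + c) * (1ℚ - c) ≡ 1ℚ - c * c
      lem = solve-∀ ring

    ½c≤1 : ½ * c ≤ 1ℚ
    ½c≤1 = *-mono-≤ 0≤½ 0≤1 (from-yes (½ ≤? 1ℚ)) c≤1

    1≤bad : ∀ j x y → B x y ≤ ½ * c → 1ℚ ≤ bad j x y
    1≤bad j x y B≤½c = 1≤-^ j (≤-by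
      ((1ℚ + c) * (½ * c - B x y) + ½ * c * (1ℚ - c))
      (0≤-+ (0≤-* 0≤1+c (≤⇒0≤- B≤½c)) (0≤-* (0≤-* 0≤½ 0≤c) 0≤1-c))
      (lem c (B x y)))
      where
      lem : ∀ c b → (1ℚ + c) * (1ℚ - b) ≡ 1ℚ + ((1ℚ + c) * (½ * c - b) + ½ * c * (1ℚ - c))
      lem = solve-∀ ring

  0<½c : 0ℚ < ½ * c
  0<½c = 0<-* (from-yes (0ℚ <? ½)) 0<c

  -- Truncation keeps the reciprocal `U = c / β` between `c` and 2. It alters `B` only where `bad`
  -- is at least 1.
  β : Kernel
  β x y = codegree A x y ⊔ (½ * c)

  ½c≤β : ∀ x y → ½ * c ≤ β x y
  ½c≤β x y = p≤q⊔p (codegree A x y) (½ * c)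

  0<β : ∀ x y → 0ℚ < β x y
  0<β x y = <-≤-trans 0<½c (½c≤β x y)

  β≤1 : ∀ x y → β x y ≤ 1ℚ
  β≤1 x y = ⊔-lub (B≤1 x y) ½c≤1

  U : Kernel
  U x y = c * proj₁ (inverse (0<β x y))

  U*β≡c : ∀ x y → U x y * β x y ≡ c
  U*β≡c x y = trans (lem c i (β x y)) (trans (cong (c *_) (proj₂ (proj₂ (inverse (0<β x y))))) (*-identityʳ c))
    where
    i = proj₁ (inverse (0<β x y))
    lem : ∀ c i b → c * i * b ≡ c * (b * i)
    lem = solve-∀ ring

  0≤U : ∀ x y → 0ℚ ≤ U x y
  0≤U x y = 0≤-* 0≤c (<⇒≤ (proj₁ (proj₂ (inverse (0<β x y)))))

  c≤U : ∀ x y → c ≤ U x y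
  c≤U x y = begin
    c              ≡⟨ U*β≡c x y ⟨
    U x y * β x y  ≤⟨ *-monoˡ (U x y) (0≤U x y) (β≤1 x y) ⟩
    U x y * 1ℚ     ≡⟨ *-identityʳ (U x y) ⟩
    U x y          ∎

  U≤2 : ∀ x y → U x y ≤ 2ℚ
  U≤2 x y = *-cancelˡ (½ * c) 0<½c (begin
    ½ * c * U x y  ≡⟨ *-comm (½ * c) (U x y) ⟩
    U x y * (½ * c) ≤⟨ *-monoˡ (U x y) (0≤U x y) (½c≤β x y) ⟩
    U x y * β x y  ≡⟨ U*β≡c x y ⟩
    c              ≡⟨ lem c ⟩
    ½ * c * 2ℚ     ∎)
    where
    lem : ∀ c → c ≡ ½ * c * (1ℚ + 1ℚ)
    lem = solve-∀ ring

  β-sym : ∀ x y → β x y ≡ β y x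
  β-sym x y = cong (_⊔ (½ * c)) (E-cong λ z → *-comm (A x z) (A y z))

  U-sym : ∀ x y → U x y ≡ U y x
  U-sym x y = begin-equality
    U x y                          ≡⟨ *-identityʳ (U x y) ⟨
    U x y * 1ℚ                     ≡⟨ cong (U x y *_) (proj₂ (proj₂ (inverse (0<β y x)))) ⟨
    U x y * (β y x * i)            ≡⟨ cong (λ b → U x y * (b * i)) (β-sym y x) ⟩
    U x y * (β x y * i)            ≡⟨ *-assoc (U x y) (β x y) i ⟨
    U x y * β x y * i              ≡⟨ cong (_* i) (U*β≡c x y) ⟩
    c * i                          ∎
    where
    i = proj₁ (inverse (0<β y x))

  private
    0≤β-B : ∀ x y → 0ℚ ≤ β x y - B x y
    0≤β-B x y = ≤⇒0≤- (p≤p⊔q (B x y) (½ * c))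

    β-B≤bad : ∀ j x y → β x y - B x y ≤ bad j x y
    β-B≤bad j x y with ≤-total (B x y) (½ * c)
    ... | inj₁ B≤½c = begin
      β x y - B x y  ≤⟨ ≤-by (B x y) (0≤B x y) (lem (β x y) (B x y)) ⟩
      β x y          ≤⟨ β≤1 x y ⟩
      1ℚ             ≤⟨ 1≤bad j x y B≤½c ⟩
      bad j x y      ∎
      where
      lem : ∀ a b → a ≡ a - b + b
      lem = solve-∀ ring
    ... | inj₂ ½c≤B = begin
      β x y - B x y  ≡⟨ cong (_- B x y) (p≥q⇒p⊔q≡p ½c≤B) ⟩
      B x y - B x y  ≡⟨ +-inverseʳ (B x y) ⟩
      0ℚ             ≤⟨ 0≤bad j x y ⟩
      bad j x y      ∎

    -- Where `B` is at least `½ * c`, it equals `β`, so `c = U * (1 - Y)` and the series telescopes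
    -- to `U * (1 - Y ^ k)`. Elsewhere the trivial bound `k + 2` is charged to `bad`.
    truncation : ∀ k j x y →
      ∣ c * geometric k (Y x y) - U x y ∣ ≤ 2ℚ * Y x y ^ k + (fromNat k + 2ℚ) * bad j x y
    truncation k j x y with ≤-total (B x y) (½ * c)
    ... | inj₁ B≤½c = begin
      ∣ c * G - U x y ∣          ≤⟨ ∣p-q∣≤∣p∣+∣q∣ (c * G) (U x y) ⟩
      ∣ c * G ∣ + ∣ U x y ∣      ≡⟨ cong₂ _+_ (0≤p⇒∣p∣≡p (0≤-* 0≤c 0≤G)) (0≤p⇒∣p∣≡p (0≤U x y)) ⟩
      c * G + U x y              ≤⟨ +-mono-≤ (≤-trans (*-mono-≤ 0≤c (0≤fromNat k) c≤1 (geometric≤ k (0≤Y x y) (Y≤1 x y)))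
                                      (≤-reflexive (*-identityˡ (fromNat k)))) (U≤2 x y) ⟩
      fromNat k + 2ℚ             ≡⟨ *-identityʳ _ ⟨
      (fromNat k + 2ℚ) * 1ℚ      ≤⟨ *-monoˡ _ (0≤-+ (0≤fromNat k) 0≤2) (1≤bad j x y B≤½c) ⟩
      (fromNat k + 2ℚ) * bad j x y
        ≤⟨ ≤-by (2ℚ * Y x y ^ k) (0≤-* 0≤2 (0≤-^ k (0≤Y x y))) (+-comm (2ℚ * Y x y ^ k) _) ⟩
      2ℚ * Y x y ^ k + (fromNat k + 2ℚ) * bad j x y ∎
      where
      G = geometric k (Y x y)
      0≤G = 0≤geometric k (0≤Y x y)
    ... | inj₂ ½c≤B = begin
      ∣ c * G - U x y ∣          ≡⟨ cong ∣_∣ cG-U ⟩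
      ∣ - (U x y * Y x y ^ k) ∣  ≡⟨ trans (∣-p∣≡∣p∣ (U x y * Y x y ^ k)) (0≤p⇒∣p∣≡p (0≤-* (0≤U x y) 0≤Y^)) ⟩
      U x y * Y x y ^ k          ≤⟨ *-monoʳ-≤-nonNeg (Y x y ^ k) {{nonNegative 0≤Y^}} (U≤2 x y) ⟩
      2ℚ * Y x y ^ k
        ≤⟨ ≤-by _ (0≤-* (0≤-+ (0≤fromNat k) 0≤2) (0≤bad j x y)) refl ⟩
      2ℚ * Y x y ^ k + (fromNat k + 2ℚ) * bad j x y ∎
      where
      G = geometric k (Y x y)
      0≤Y^ = 0≤-^ k (0≤Y x y)
      lem₁ : ∀ u b g → u * b * g - u ≡ u * ((1ℚ - (1ℚ - b)) * g) - u
      lem₁ = solve-∀ ring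
      lem₂ : ∀ u p → u * (1ℚ - p) - u ≡ - (u * p)
      lem₂ = solve-∀ ring
      cG-U : c * G - U x y ≡ - (U x y * Y x y ^ k)
      cG-U = begin-equality
        c * G - U x y
          ≡⟨ cong (λ z → z * G - U x y) (U*β≡c x y) ⟨
        U x y * β x y * G - U x y
          ≡⟨ cong (λ b → U x y * b * G - U x y) (p≥q⇒p⊔q≡p ½c≤B) ⟩
        U x y * B x y * G - U x y
          ≡⟨ lem₁ (U x y) (B x y) G ⟩
        U x y * ((1ℚ - Y x y) * G) - U x y
          ≡⟨ cong (λ z → U x y * z - U x y) (geometric-sum k (Y x y)) ⟩
        U x y * (1ℚ - Y x y ^ k) - U x y
          ≡⟨ lem₂ (U x y) (Y x y ^ k) ⟩
        - (U x y * Y x y ^ k) ∎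

  -- `k` is the length of the geometric series and `j` the exponent in `bad`. They are independent
  -- because `ν` enters with the factor `k + 2`, so that `j` has to be chosen after `k`.
  module Estimates (k j : ℕ) {μ ν : ℚ}
    (≤μ : (1ℚ - c) ^ k + 2ℚ ^ k * γ ≤ μ) (≤ν : (1ℚ - c * c) ^ j + 2ℚ ^ j * (2ℚ ^ j * γ) ≤ ν)
    where

    private
      remainder : Kernel
      remainder x y = A x y * Y x y ^ k + (c * geometric k (Y x y) - U x y)

      remainder-small : E₂ (λ x y → ∣ remainder x y ∣) ≤ (1ℚ + 2ℚ) * μ + (fromNat k + 2ℚ) * ν
      remainder-small = begin
        E₂ (λ x y → ∣ remainder x y ∣)
          ≤⟨ E₂-mono (λ x y → begin
               ∣ remainder x y ∣
                 ≤⟨ ∣p+q∣≤∣p∣+∣q∣ (A x y * Y x y ^ k) (c * geometric k (Y x y) - U x y) ⟩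
               ∣ A x y * Y x y ^ k ∣ + ∣ c * geometric k (Y x y) - U x y ∣
                 ≤⟨ +-mono-≤ (≤-trans
                      (≤-reflexive (0≤p⇒∣p∣≡p (0≤-* (0≤A x y) (0≤-^ k (0≤Y x y)))))
                      (*-monoʳ-≤-nonNeg (Y x y ^ k) {{nonNegative (0≤-^ k (0≤Y x y))}} (A≤1 x y)))
                      (truncation k j x y) ⟩
               1ℚ * Y x y ^ k + (2ℚ * Y x y ^ k + (fromNat k + 2ℚ) * bad j x y)
                 ≡⟨ lem (Y x y ^ k) ((fromNat k + 2ℚ) * bad j x y) ⟩
               (1ℚ + 2ℚ) * Y x y ^ k + (fromNat k + 2ℚ) * bad j x y ∎) ⟩
        E₂ (λ x y → (1ℚ + 2ℚ) * Y x y ^ k + (fromNat k + 2ℚ) * bad j x y)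
          ≡⟨ trans (E₂-+ (λ x y → (1ℚ + 2ℚ) * Y x y ^ k) (λ x y → (fromNat k + 2ℚ) * bad j x y))
               (cong₂ _+_ (E₂-* (1ℚ + 2ℚ) (λ x y → Y x y ^ k)) (E₂-* (fromNat k + 2ℚ) (bad j))) ⟩
        (1ℚ + 2ℚ) * E₂ (λ x y → Y x y ^ k) + (fromNat k + 2ℚ) * E₂ (bad j)
          ≤⟨ +-mono-≤ (*-monoˡ (1ℚ + 2ℚ) (0≤-+ 0≤1 0≤2) (≤-trans (moment k) ≤μ))
               (*-monoˡ (fromNat k + 2ℚ) (0≤-+ (0≤fromNat k) 0≤2) (≤-trans (E-bad j) ≤ν)) ⟩
        (1ℚ + 2ℚ) * μ + (fromNat k + 2ℚ) * ν ∎
        where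
        lem : ∀ p b → 1ℚ * p + ((1ℚ + 1ℚ) * p + b) ≡ (1ℚ + (1ℚ + 1ℚ)) * p + b
        lem = solve-∀ ring

      pow≤μ : pow k ≤ μ
      pow≤μ = ≤-trans (≤-by ((1ℚ - c) ^ k) (0≤-^ k 0≤1-c) (+-comm ((1ℚ - c) ^ k) (pow k))) ≤μ

    -- As `B * geometric k Y = 1 - Y ^ k`, the kernel `A` equals
    -- `A * B * geometric k Y + A * Y ^ k`. Replacing `A * B` by `c` is cheap in cut norm, and what
    -- then separates the result from `U` is `remainder`, which is small even in L¹.
    A≈U : CutSmall (μ + ((1ℚ + 2ℚ) * μ + (fromNat k + 2ℚ) * ν)) (λ x y → A x y - U x y)
    A≈U = cutSmall-cong (λ x y → sym (decompose x y))
      (cutSmall-+ (cutSmall-weaken pow≤μ (small-geometric k)) (cutSmall-L¹ remainder-small))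
      where
      decompose : ∀ x y → A x y - U x y ≡
        (A x y * B x y - c) * geometric k (Y x y) + remainder x y
      decompose x y = begin-equality
        A x y - U x y
          ≡⟨ lem₁ (A x y) (U x y) (Y x y ^ k) ⟩
        A x y * (1ℚ - Y x y ^ k) + (A x y * Y x y ^ k - U x y)
          ≡⟨ cong (λ z → A x y * z + (A x y * Y x y ^ k - U x y)) (geometric-sum k (Y x y)) ⟨
        A x y * ((1ℚ - Y x y) * geometric k (Y x y)) + (A x y * Y x y ^ k - U x y)
          ≡⟨ lem₂ (A x y) (B x y) c (geometric k (Y x y)) (Y x y ^ k) (U x y) ⟩
        (A x y * B x y - c) * geometric k (Y x y) + remainder x y ∎
        where
        lem₁ : ∀ a u p → a - u ≡ a * (1ℚ - p) + (a * p - u)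
        lem₁ = solve-∀ ring
        lem₂ : ∀ a b c g p u → a * ((1ℚ - (1ℚ - b)) * g) + (a * p - u) ≡
          (a * b - c) * g + (a * p + (c * g - u))
        lem₂ = solve-∀ ring

    β≈U² : ∀ {κ} → CutSmall κ (λ x y → A x y - U x y) →
      E₂ (λ x y → ∣ β x y - codegree U x y ∣) ≤ ν + (κ + 2ℚ * κ)
    β≈U² {κ} A≈U = begin
      E₂ (λ x y → ∣ β x y - codegree U x y ∣)
        ≤⟨ E₂-mono (λ x y → begin
             ∣ β x y - codegree U x y ∣
               ≡⟨ cong ∣_∣ (lem (β x y) (B x y) (codegree U x y)) ⟩
             ∣ (β x y - B x y) + (B x y - codegree U x y) ∣
               ≤⟨ ∣p+q∣≤∣p∣+∣q∣ (β x y - B x y) (B x y - codegree U x y) ⟩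
             ∣ β x y - B x y ∣ + ∣ B x y - codegree U x y ∣
               ≤⟨ +-monoˡ-≤ ∣ B x y - codegree U x y ∣
                    (≤-trans (≤-reflexive (0≤p⇒∣p∣≡p (0≤β-B x y))) (β-B≤bad j x y)) ⟩
             bad j x y + ∣ B x y - codegree U x y ∣ ∎) ⟩
      E₂ (λ x y → bad j x y + ∣ B x y - codegree U x y ∣)
        ≡⟨ E₂-+ (bad j) (λ x y → ∣ B x y - codegree U x y ∣) ⟩
      E₂ (bad j) + E₂ (λ x y → ∣ B x y - codegree U x y ∣)
        ≤⟨ +-mono-≤ (≤-trans (E-bad j) ≤ν) (codegree-close A-bdd ½U-bdd A≈U) ⟩
      ν + (κ + 2ℚ * κ) ∎
      where
      lem : ∀ a b c → a - c ≡ (a - b) + (b - c)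
      lem = solve-∀ ring
      ½U-bdd : ∀ x → Bounded (λ z → ½ * U x z)
      ½U-bdd x z = 0≤x≤1⇒∣x∣≤1 (0≤-* 0≤½ (0≤U x z)) (*-monoˡ ½ 0≤½ (U≤2 x z))

-- Contraction of cross-ratios

4ℚ : ℚ
4ℚ = 2ℚ * 2ℚ

0≤4 : 0ℚ ≤ 4ℚ
0≤4 = from-yes (0ℚ ≤? 4ℚ)

-- Without the errors this is (b - a)(q - p) ≤ ½ (R - 1)(aq + bp), the average of the bounds
-- b - a ≤ (R - 1)a and q - p ≤ (R - 1)p multiplied by the respective other factor.
aligned-contraction : ∀ {R} a b p q d e → 1ℚ ≤ R → 0ℚ ≤ a → 0ℚ ≤ p → b ≤ 4ℚ → q ≤ 4ℚ →
  0ℚ ≤ d → 0ℚ ≤ e → a ≤ b → p ≤ q → b ≤ R * a + d → q ≤ R * p + e →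
  a * p + b * q ≤ ½ * (R + 1ℚ) * (a * q + b * p) + 2ℚ * (d + e)
aligned-contraction {R} a b p q d e 1≤R 0≤a 0≤p b≤4 q≤4 0≤d 0≤e a≤b p≤q hb hq = ≤-by _
  (0≤-+ (0≤-+ (0≤-+ (0≤-+
    (0≤-* (≤⇒0≤- 1≤R) (0≤-* 0≤a 0≤p))
    (0≤-* 0≤½ (0≤-* (≤⇒0≤- hb) (≤⇒0≤- p≤q))))
    (0≤-* 0≤½ (0≤-* (≤⇒0≤- hq) (≤⇒0≤- a≤b))))
    (0≤-* 0≤½ (0≤-* 0≤d (0≤-+ (≤⇒0≤- q≤4) 0≤p))))
    (0≤-* 0≤½ (0≤-* 0≤e (0≤-+ (≤⇒0≤- b≤4) 0≤a))))
  (lem R a b p q d e)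
  where
  lem : ∀ R a b p q d e →
    ½ * (R + 1ℚ) * (a * q + b * p) + (1ℚ + 1ℚ) * (d + e) ≡ a * p + b * q
      + ((R - 1ℚ) * (a * p) + ½ * ((R * a + d - b) * (q - p)) + ½ * ((R * p + e - q) * (b - a))
         + ½ * (d * ((1ℚ + 1ℚ) * (1ℚ + 1ℚ) - q + p)) + ½ * (e * ((1ℚ + 1ℚ) * (1ℚ + 1ℚ) - b + a)))
  lem = solve-∀ ring

-- If `a, b` and `p, q` are oppositely ordered, the rearrangement inequality gives
-- `ap + bq ≤ aq + bp`, so contraction matters only for equal orders, and these two cases are mirror
-- images. The upper bounds by 4 turn half a slack times a difference of values into at most twice
-- the slack.
cross-ratio-contraction : ∀ {R a b p q d₁ d₂ e₁ e₂} → 1ℚ ≤ R →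
  0ℚ ≤ a → 0ℚ ≤ b → 0ℚ ≤ p → 0ℚ ≤ q → a ≤ 4ℚ → b ≤ 4ℚ → p ≤ 4ℚ → q ≤ 4ℚ →
  0ℚ ≤ d₁ → 0ℚ ≤ d₂ → 0ℚ ≤ e₁ → 0ℚ ≤ e₂ →
  a ≤ R * b + d₁ → b ≤ R * a + d₂ → p ≤ R * q + e₁ → q ≤ R * p + e₂ →
  a * p + b * q ≤ ½ * (R + 1ℚ) * (a * q + b * p) + 2ℚ * (d₁ + d₂ + (e₁ + e₂))
cross-ratio-contraction {R} {a} {b} {p} {q} {d₁} {d₂} {e₁} {e₂}
  1≤R 0≤a 0≤b 0≤p 0≤q a≤4 b≤4 p≤4 q≤4 0≤d₁ 0≤d₂ 0≤e₁ 0≤e₂ a≤ b≤ p≤ q≤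
  with ≤-total a b | ≤-total p q
... | inj₁ a≤b | inj₁ p≤q = ≤-trans
  (aligned-contraction a b p q d₂ e₂ 1≤R 0≤a 0≤p b≤4 q≤4 0≤d₂ 0≤e₂ a≤b p≤q b≤ q≤)
  (≤-by (2ℚ * (d₁ + e₁)) (0≤-* 0≤2 (0≤-+ 0≤d₁ 0≤e₁)) (lem (½ * (R + 1ℚ) * (a * q + b * p)) d₁ d₂ e₁ e₂))
  where
  lem : ∀ x d₁ d₂ e₁ e₂ → x + (1ℚ + 1ℚ) * (d₁ + d₂ + (e₁ + e₂)) ≡
    x + (1ℚ + 1ℚ) * (d₂ + e₂) + (1ℚ + 1ℚ) * (d₁ + e₁)
  lem = solve-∀ ring
... | inj₂ b≤a | inj₂ q≤p = subst (_≤ ½ * (R + 1ℚ) * (a * q + b * p) + 2ℚ * (d₁ + d₂ + (e₁ + e₂)))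
  (+-comm (b * q) (a * p)) (≤-trans
  (aligned-contraction b a q p d₁ e₁ 1≤R 0≤b 0≤q a≤4 p≤4 0≤d₁ 0≤e₁ b≤a q≤p a≤ p≤)
  (≤-by (2ℚ * (d₂ + e₂)) (0≤-* 0≤2 (0≤-+ 0≤d₂ 0≤e₂)) (lem (½ * (R + 1ℚ)) (b * p) (a * q) d₁ d₂ e₁ e₂)))
  where
  lem : ∀ r x y d₁ d₂ e₁ e₂ → r * (y + x) + (1ℚ + 1ℚ) * (d₁ + d₂ + (e₁ + e₂)) ≡
    r * (x + y) + (1ℚ + 1ℚ) * (d₁ + e₁) + (1ℚ + 1ℚ) * (d₂ + e₂)
  lem = solve-∀ ring
... | inj₁ a≤b | inj₂ q≤p = ≤-by _
  (0≤-+ (0≤-+ (0≤-* (0≤-* 0≤½ (≤⇒0≤- 1≤R)) (0≤-+ (0≤-* 0≤a 0≤q) (0≤-* 0≤b 0≤p)))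
              (0≤-* (≤⇒0≤- a≤b) (≤⇒0≤- q≤p)))
        (0≤-* 0≤2 (0≤-+ (0≤-+ 0≤d₁ 0≤d₂) (0≤-+ 0≤e₁ 0≤e₂))))
  (lem R a b p q (d₁ + d₂ + (e₁ + e₂)))
  where
  lem : ∀ R a b p q e → ½ * (R + 1ℚ) * (a * q + b * p) + (1ℚ + 1ℚ) * e ≡ a * p + b * q
    + (½ * (R - 1ℚ) * (a * q + b * p) + (b - a) * (p - q) + (1ℚ + 1ℚ) * e)
  lem = solve-∀ ring
... | inj₂ b≤a | inj₁ p≤q = ≤-by _
  (0≤-+ (0≤-+ (0≤-* (0≤-* 0≤½ (≤⇒0≤- 1≤R)) (0≤-+ (0≤-* 0≤a 0≤q) (0≤-* 0≤b 0≤p)))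
              (0≤-* (≤⇒0≤- b≤a) (≤⇒0≤- p≤q)))
        (0≤-* 0≤2 (0≤-+ (0≤-+ 0≤d₁ 0≤d₂) (0≤-+ 0≤e₁ 0≤e₂))))
  (lem R a b p q (d₁ + d₂ + (e₁ + e₂)))
  where
  lem : ∀ R a b p q e → ½ * (R + 1ℚ) * (a * q + b * p) + (1ℚ + 1ℚ) * e ≡ a * p + b * q
    + (½ * (R - 1ℚ) * (a * q + b * p) + (a - b) * (q - p) + (1ℚ + 1ℚ) * e)
  lem = solve-∀ ring

module _ {n : ℕ} {{nz : ℕ.NonZero n}} where
  open Average n

  Kernel₄ : Set
  Kernel₄ = V → V → Kernel

  E₄ : Kernel₄ → ℚ
  E₄ N = E₂ λ x y → E₂ (N x y)

  E₄-+ : ∀ (N O : Kernel₄) → E₄ (λ x y z w → N x y z w + O x y z w) ≡ E₄ N + E₄ O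
  E₄-+ N O = trans (E₂-cong λ x y → E₂-+ (N x y) (O x y)) (E₂-+ (λ x y → E₂ (N x y)) (λ x y → E₂ (O x y)))

  E₄-* : ∀ a (N : Kernel₄) → E₄ (λ x y z w → a * N x y z w) ≡ a * E₄ N
  E₄-* a N = trans (E₂-cong λ x y → E₂-* a (N x y)) (E₂-* a (λ x y → E₂ (N x y)))

  E₄-12 : ∀ (K : Kernel) → E₄ (λ x y _ _ → K x y) ≡ E₂ K
  E₄-12 K = E₂-cong λ x y → E₂-const (K x y)

  E₄-34 : ∀ (K : Kernel) → E₄ (λ _ _ z w → K z w) ≡ E₂ K
  E₄-34 K = E₂-const (E₂ K)

  E₄-13 : ∀ (K : Kernel) → E₄ (λ x _ z _ → K x z) ≡ E₂ K
  E₄-13 K = E-cong λ x → trans (E-const (E₂ (λ z _ → K x z))) (E₂-fst (K x))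

  E₄-14 : ∀ (K : Kernel) → E₄ (λ x _ _ w → K x w) ≡ E₂ K
  E₄-14 K = E-cong λ x → trans (E-const (E₂ (λ _ w → K x w))) (E₂-snd (K x))

  E₄-23 : ∀ (K : Kernel) → E₄ (λ _ y z _ → K y z) ≡ E₂ K
  E₄-23 K = trans (E-const (E λ y → E₂ (λ z _ → K y z))) (E-cong λ y → E₂-fst (K y))

  E₄-24 : ∀ (K : Kernel) → E₄ (λ _ y _ w → K y w) ≡ E₂ K
  E₄-24 K = trans (E-const (E λ y → E₂ (λ _ w → K y w))) (E-cong λ y → E₂-snd (K y))

module Contraction {n : ℕ} {{nz : ℕ.NonZero n}}
  (β U : Average.Kernel n) (U-sym : ∀ x y → U x y ≡ U y x)
  (0≤β : ∀ x y → 0ℚ ≤ β x y) (β≤1 : ∀ x y → β x y ≤ 1ℚ)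
  (0≤U : ∀ x y → 0ℚ ≤ U x y) (U≤2 : ∀ x y → U x y ≤ 2ℚ)
  {c M κ : ℚ} (0<c : 0ℚ < c) (0≤M : 0ℚ ≤ M) (16≤Mcc : 4ℚ * 4ℚ ≤ c * c * M) (0≤κ : 0ℚ ≤ κ)
  (U*β≡c : ∀ x y → U x y * β x y ≡ c)
  (β≈U² : Average.E₂ n (λ x y → ∣ β x y - codegree U x y ∣) ≤ κ)
  where
  open Average n

  private
    open ≤-Reasoning

    0<cc : 0ℚ < c * c
    0<cc = 0<-* 0<c 0<c

    T D : Kernel
    T = codegree U
    D x y = ∣ β x y - T x y ∣

    0≤D : ∀ x y → 0ℚ ≤ D x y
    0≤D x y = 0≤∣p∣ (β x y - T x y)

    UU≤4 : ∀ x y z w → U x y * U z w ≤ 4ℚ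
    UU≤4 x y z w = *-mono-≤ (0≤U x y) 0≤2 (U≤2 x y) (U≤2 z w)

    0≤UU : ∀ x y z w → 0ℚ ≤ U x y * U z w
    0≤UU x y z w = 0≤-* (0≤U x y) (0≤U z w)

    0≤T : ∀ x y → 0ℚ ≤ T x y
    0≤T x y = E-nonNeg λ z → 0≤UU x z y z

    T≤4 : ∀ x y → T x y ≤ 4ℚ
    T≤4 x y = E-≤ λ z → UU≤4 x z y z

  -- `R` bounds the cross-ratios of `β` up to an additive error that is small only in the mean. An
  -- additive error, unlike an exceptional set, passes through averages and products by linear
  -- estimates.
  record CrossRatio≤ (R η : ℚ) : Set where
    field
      slack   : Kernel₄
      0≤slack : ∀ x y z w → 0ℚ ≤ slack x y z w
      bound   : ∀ x y z w → β x z * β y w ≤ R * (β x w * β y z) + slack x y z w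
      small   : E₄ slack ≤ η

    -- Since `U * β` is constant, a cross-ratio of `U` is the inverse of that of `β`; this is why
    -- the columns `s` and `t` trade places in `slack`. The bound for `β` is multiplied by both
    -- products of `U`; these are at most 4 each, and `16 ≤ c² * M` makes `M` pay for cancelling
    -- `c²`.
    U-bound : 0ℚ ≤ R → ∀ x y s t → U x s * U y t ≤ R * (U x t * U y s) + M * slack x y t s
    U-bound 0≤R x y s t = *-cancelˡ (c * c) 0<cc (begin
      c * c * a
        ≡⟨ cong (_* a) (cong₂ _*_ (U*β≡c x t) (U*β≡c y s)) ⟨
      U x t * β x t * (U y s * β y s) * a
        ≡⟨ lem₁ (U x t) (β x t) (U y s) (β y s) a ⟩
      b * a * (β x t * β y s)
        ≤⟨ *-monoˡ (b * a) (0≤-* 0≤b 0≤a) (bound x y t s) ⟩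
      b * a * (R * (β x s * β y t) + N)
        ≡⟨ lem₂ b (U x s) (U y t) R (β x s) (β y t) N ⟩
      R * b * (U x s * β x s * (U y t * β y t)) + a * b * N
        ≡⟨ cong (λ z → R * b * z + a * b * N) (cong₂ _*_ (U*β≡c x s) (U*β≡c y t)) ⟩
      R * b * (c * c) + a * b * N
        ≤⟨ +-monoʳ-≤ (R * b * (c * c)) (*-monoʳ-≤-nonNeg N {{nonNegative (0≤slack x y t s)}}
             (≤-trans (*-mono-≤ 0≤a 0≤4 (UU≤4 x s y t) (UU≤4 x t y s)) 16≤Mcc)) ⟩
      R * b * (c * c) + c * c * M * N
        ≡⟨ lem₃ R b (c * c) M N ⟩
      c * c * (R * b + M * N) ∎)
      where
      a = U x s * U y t
      b = U x t * U y s
      0≤a = 0≤UU x s y t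
      0≤b = 0≤UU x t y s
      N = slack x y t s
      lem₁ : ∀ u v u′ v′ a → u * v * (u′ * v′) * a ≡ u * u′ * a * (v * v′)
      lem₁ = solve-∀ ring
      lem₂ : ∀ b u u′ R v v′ N → b * (u * u′) * (R * (v * v′) + N) ≡
        R * b * (u * v * (u′ * v′)) + u * u′ * b * N
      lem₂ = solve-∀ ring
      lem₃ : ∀ R b d M N → R * b * d + d * M * N ≡ d * (R * b + M * N)
      lem₃ = solve-∀ ring

  open CrossRatio≤

  -- Cross-ratios of `T = U ∘ U` are bounded by `½ * (R + 1ℚ)`, and exchanging `T` for `β` costs
  -- multiples of `D`. `R₀` lets all iterations share one error recursion, although the ratio itself
  -- changes.
  contract : ∀ {R R₀ η} → 1ℚ ≤ R → ½ * (R + 1ℚ) ≤ R₀ → CrossRatio≤ R η →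
    CrossRatio≤ (½ * (R + 1ℚ)) (4ℚ * M * η + (1ℚ + R₀) * (1ℚ + 4ℚ) * κ)
  contract {R} {R₀} {η} 1≤R R′≤R₀ CR = record
    { slack   = slack′
    ; 0≤slack = λ x y z w → 0≤-+ (0≤T-slack x y z w) (0≤-+
        (0≤-+ (0≤D x z) (0≤-* 0≤4 (0≤D y w)))
        (0≤-* 0≤R′ (0≤-+ (0≤-* 0≤4 (0≤D x w)) (0≤D y z))))
    ; bound   = bound′
    ; small   = small′
    }
    where
    R′ = ½ * (R + 1ℚ)
    0≤R = ≤-trans 0≤1 1≤R
    0≤R′ : 0ℚ ≤ R′
    0≤R′ = 0≤-* 0≤½ (0≤-+ 0≤R 0≤1)
    N = slack CR

    N̄ : Kernel
    N̄ x y = E₂ (N x y)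

    T-slack slack′ : Kernel₄
    T-slack x y z w = M * (2ℚ * N̄ x y + 2ℚ * N̄ z w)
    slack′ x y z w = T-slack x y z w + ((D x z + 4ℚ * D y w) + R′ * (4ℚ * D x w + D y z))

    0≤T-slack : ∀ x y z w → 0ℚ ≤ T-slack x y z w
    0≤T-slack x y z w = 0≤-* 0≤M (0≤-+
      (0≤-* 0≤2 (E₂-nonNeg (0≤slack CR x y))) (0≤-* 0≤2 (E₂-nonNeg (0≤slack CR z w))))

    T-product : ∀ x y z w → T x z * T y w ≡ E₂ (λ s t → U x s * U y t * (U z s * U w t))
    T-product x y z w = trans (sym (E-product (λ s → U x s * U z s) (λ t → U y t * U w t)))
      (E₂-cong λ s t → lem (U x s) (U z s) (U y t) (U w t))
      where
      lem : ∀ a b c d → a * b * (c * d) ≡ a * c * (b * d)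
      lem = solve-∀ ring

    E₂-errors : ∀ x y z w →
      E₂ (λ s t → M * N x y t s + M * N x y s t + (M * N z w t s + M * N z w s t)) ≡ T-slack x y z w
    E₂-errors x y z w = begin-equality
      E₂ (λ s t → M * N x y t s + M * N x y s t + (M * N z w t s + M * N z w s t))
        ≡⟨ E₂-+ (λ s t → M * N x y t s + M * N x y s t) (λ s t → M * N z w t s + M * N z w s t) ⟩
      E₂ (λ s t → M * N x y t s + M * N x y s t) + E₂ (λ s t → M * N z w t s + M * N z w s t)
        ≡⟨ cong₂ _+_ (half x y) (half z w) ⟩
      M * (2ℚ * N̄ x y) + M * (2ℚ * N̄ z w)
        ≡⟨ *-distribˡ-+ M (2ℚ * N̄ x y) (2ℚ * N̄ z w) ⟨
      T-slack x y z w ∎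
      where
      lem : ∀ m a → m * a + m * a ≡ m * ((1ℚ + 1ℚ) * a)
      lem = solve-∀ ring
      half : ∀ x y → E₂ (λ s t → M * N x y t s + M * N x y s t) ≡ M * (2ℚ * N̄ x y)
      half x y = trans (E₂-+ (λ s t → M * N x y t s) (λ s t → M * N x y s t))
        (trans (cong₂ _+_ (trans (E₂-* M (λ s t → N x y t s)) (cong (M *_) (E-swap (λ s t → N x y t s))))
                          (E₂-* M (N x y)))
               (lem M (N̄ x y)))

    -- `T x z * T y w` is an average over ordered pairs `(s, t)`. Adding its image under the
    -- exchange of `s` and `t` produces the terms `ap + bq` of `cross-ratio-contraction`, with `b`
    -- and `q` the exchanged products, while `aq + bp` averages to twice `T x w * T y z`.
    T-bound : ∀ x y z w → T x z * T y w ≤ R′ * (T x w * T y z) + T-slack x y z w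
    T-bound x y z w = *-cancelˡ 2ℚ (from-yes (0ℚ <? 2ℚ)) (begin
      2ℚ * (T x z * T y w)
        ≡⟨ dbl (T x z * T y w) ⟩
      T x z * T y w + T x z * T y w
        ≡⟨ cong₂ _+_ (T-product x y z w) (trans (T-product x y z w) (E-swap (λ s t → a s t * p s t))) ⟩
      E₂ (λ s t → a s t * p s t) + E₂ (λ s t → a t s * p t s)
        ≡⟨ E₂-+ (λ s t → a s t * p s t) (λ s t → a t s * p t s) ⟨
      E₂ (λ s t → a s t * p s t + a t s * p t s)
        ≤⟨ E₂-mono (λ s t → cross-ratio-contraction 1≤R
             (0≤UU x s y t) (0≤UU x t y s) (0≤UU z s w t) (0≤UU z t w s)
             (UU≤4 x s y t) (UU≤4 x t y s) (UU≤4 z s w t) (UU≤4 z t w s)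
             (0≤-* 0≤M (0≤slack CR x y t s)) (0≤-* 0≤M (0≤slack CR x y s t))
             (0≤-* 0≤M (0≤slack CR z w t s)) (0≤-* 0≤M (0≤slack CR z w s t))
             (U-bound CR 0≤R x y s t) (U-bound CR 0≤R x y t s)
             (U-bound CR 0≤R z w s t) (U-bound CR 0≤R z w t s)) ⟩
      E₂ (λ s t → R′ * (a s t * p t s + a t s * p s t) + 2ℚ * err s t)
        ≡⟨ trans (E₂-+ (λ s t → R′ * (a s t * p t s + a t s * p s t)) (λ s t → 2ℚ * err s t))
             (cong₂ _+_ (trans (E₂-* R′ (λ s t → a s t * p t s + a t s * p s t))
                               (cong (R′ *_) (E₂-+ (λ s t → a s t * p t s) (λ s t → a t s * p s t))))
                        (trans (E₂-* 2ℚ err) (cong (2ℚ *_) (E₂-errors x y z w)))) ⟩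
      R′ * (E₂ (λ s t → a s t * p t s) + E₂ (λ s t → a t s * p s t)) + 2ℚ * T-slack x y z w
        ≡⟨ cong (λ q → R′ * q + 2ℚ * T-slack x y z w) (cong₂ _+_ crossed
             (trans (E-swap (λ s t → a t s * p s t)) crossed)) ⟩
      R′ * (T x w * T y z + T x w * T y z) + 2ℚ * T-slack x y z w
        ≡⟨ collect R′ (T x w * T y z) (T-slack x y z w) ⟩
      2ℚ * (R′ * (T x w * T y z) + T-slack x y z w) ∎)
      where
      a p err : Kernel
      a s t = U x s * U y t
      p s t = U z s * U w t
      err s t = M * N x y t s + M * N x y s t + (M * N z w t s + M * N z w s t)
      dbl : ∀ a → (1ℚ + 1ℚ) * a ≡ a + a
      dbl = solve-∀ ring
      collect : ∀ r a b → r * (a + a) + (1ℚ + 1ℚ) * b ≡ (1ℚ + 1ℚ) * (r * a + b)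
      collect = solve-∀ ring
      crossed : E₂ (λ s t → a s t * p t s) ≡ T x w * T y z
      crossed = trans (E₂-cong λ s t → cong (a s t *_) (*-comm (U z t) (U w s)))
        (sym (T-product x y w z))

    bound′ : ∀ x y z w → β x z * β y w ≤ R′ * (β x w * β y z) + slack′ x y z w
    bound′ x y z w = begin
      β x z * β y w
        -- One factor is replaced at a time. The other one is then either a value of `β`, at most 1,
        -- or of `T`, at most 4, which explains the coefficients 1 and 4 and the factor `1ℚ + 4ℚ` in
        -- the final bound.
        ≤⟨ ≤-by _ (0≤-+ (0≤-+ (0≤-* (≤⇒0≤- (β≤1 y w)) (0≤D x z)) (0≤-* (0≤β y w) (≤⇒0≤- (x≤∣x∣ (β x z - T x z)))))
                  (0≤-+ (0≤-* (≤⇒0≤- (T≤4 x z)) (0≤D y w)) (0≤-* (0≤T x z) (≤⇒0≤- (x≤∣x∣ (β y w - T y w))))))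
             (lem₁ (β x z) (β y w) (T x z) (T y w) (D x z) (D y w)) ⟩
      T x z * T y w + (D x z + 4ℚ * D y w)
        ≤⟨ +-monoˡ-≤ (D x z + 4ℚ * D y w) (T-bound x y z w) ⟩
      R′ * (T x w * T y z) + T-slack x y z w + (D x z + 4ℚ * D y w)
        ≤⟨ +-monoˡ-≤ (D x z + 4ℚ * D y w) (+-monoˡ-≤ (T-slack x y z w) (*-monoˡ R′ 0≤R′
             (≤-by _ (0≤-+ (0≤-+ (0≤-* (≤⇒0≤- (T≤4 y z)) (0≤D x w)) (0≤-* (0≤T y z) (≤⇒0≤- (-x≤∣x∣ (β x w - T x w)))))
                     (0≤-+ (0≤-* (≤⇒0≤- (β≤1 x w)) (0≤D y z)) (0≤-* (0≤β x w) (≤⇒0≤- (-x≤∣x∣ (β y z - T y z))))))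
                (lem₂ (β x w) (β y z) (T x w) (T y z) (D x w) (D y z))))) ⟩
      R′ * (β x w * β y z + (4ℚ * D x w + D y z)) + T-slack x y z w + (D x z + 4ℚ * D y w)
        ≡⟨ lem₃ R′ (β x w * β y z) (4ℚ * D x w + D y z) (T-slack x y z w) (D x z + 4ℚ * D y w) ⟩
      R′ * (β x w * β y z) + slack′ x y z w ∎
      where
      lem₁ : ∀ b b′ t t′ d d′ → t * t′ + (d + (1ℚ + 1ℚ) * (1ℚ + 1ℚ) * d′) ≡ b * b′ +
        ((1ℚ - b′) * d + b′ * (d - (b - t)) + (((1ℚ + 1ℚ) * (1ℚ + 1ℚ) - t) * d′ + t * (d′ - (b′ - t′))))
      lem₁ = solve-∀ ring
      lem₂ : ∀ b b′ t t′ d d′ → b * b′ + ((1ℚ + 1ℚ) * (1ℚ + 1ℚ) * d + d′) ≡ t * t′ +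
        (((1ℚ + 1ℚ) * (1ℚ + 1ℚ) - t′) * d + t′ * (d - (- (b - t))) + ((1ℚ - b) * d′ + b * (d′ - (- (b′ - t′)))))
      lem₂ = solve-∀ ring
      lem₃ : ∀ r a b s d → r * (a + b) + s + d ≡ r * a + (s + (d + r * b))
      lem₃ = solve-∀ ring

    small′ : E₄ slack′ ≤ 4ℚ * M * η + (1ℚ + R₀) * (1ℚ + 4ℚ) * κ
    small′ = begin
      E₄ slack′
        ≡⟨ E₄-+ T-slack (λ x y z w → (D x z + 4ℚ * D y w) + R′ * (4ℚ * D x w + D y z)) ⟩
      E₄ T-slack + E₄ (λ x y z w → (D x z + 4ℚ * D y w) + R′ * (4ℚ * D x w + D y z))
        ≡⟨ cong₂ _+_
             (trans (E₄-* M (λ x y z w → 2ℚ * N̄ x y + 2ℚ * N̄ z w)) (cong (M *_)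
               (trans (E₄-+ (λ x y _ _ → 2ℚ * N̄ x y) (λ _ _ z w → 2ℚ * N̄ z w))
                 (cong₂ _+_ (trans (E₄-12 (λ x y → 2ℚ * N̄ x y)) (E₂-* 2ℚ N̄))
                            (trans (E₄-34 (λ x y → 2ℚ * N̄ x y)) (E₂-* 2ℚ N̄))))))
             (trans (E₄-+ (λ x y z w → D x z + 4ℚ * D y w) (λ x y z w → R′ * (4ℚ * D x w + D y z)))
               (cong₂ _+_
                 (trans (E₄-+ (λ x y z w → D x z) (λ x y z w → 4ℚ * D y w))
                   (cong₂ _+_ (E₄-13 D) (trans (E₄-24 (λ y w → 4ℚ * D y w)) (E₂-* 4ℚ D))))
                 (trans (E₄-* R′ (λ x y z w → 4ℚ * D x w + D y z)) (cong (R′ *_)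
                   (trans (E₄-+ (λ x y z w → 4ℚ * D x w) (λ x y z w → D y z))
                     (cong₂ _+_ (trans (E₄-14 (λ y w → 4ℚ * D y w)) (E₂-* 4ℚ D)) (E₄-23 D))))))) ⟩
      M * (2ℚ * E₄ N + 2ℚ * E₄ N) + ((E₂ D + 4ℚ * E₂ D) + R′ * (4ℚ * E₂ D + E₂ D))
        ≡⟨ collect M (E₄ N) (E₂ D) R′ ⟩
      4ℚ * M * E₄ N + (1ℚ + R′) * (1ℚ + 4ℚ) * E₂ D
        ≤⟨ +-mono-≤ (*-monoˡ (4ℚ * M) (0≤-* 0≤4 0≤M) (small CR))
             (*-mono-≤ (0≤-* (0≤-+ 0≤1 0≤R′) 0≤5) 0≤κ
               (*-monoʳ-≤-nonNeg (1ℚ + 4ℚ) {{nonNegative 0≤5}} (+-monoʳ-≤ 1ℚ R′≤R₀)) β≈U²) ⟩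
      4ℚ * M * η + (1ℚ + R₀) * (1ℚ + 4ℚ) * κ ∎
      where
      0≤5 = 0≤-+ 0≤1 0≤4
      collect : ∀ m a d r →
        m * ((1ℚ + 1ℚ) * a + (1ℚ + 1ℚ) * a) +
          ((d + (1ℚ + 1ℚ) * (1ℚ + 1ℚ) * d) + r * ((1ℚ + 1ℚ) * (1ℚ + 1ℚ) * d + d)) ≡
        (1ℚ + 1ℚ) * (1ℚ + 1ℚ) * m * a + (1ℚ + r) * (1ℚ + (1ℚ + 1ℚ) * (1ℚ + 1ℚ)) * d
      collect = solve-∀ ring

-- the factor by which k contraction steps starting from ratio M amplify the error κ
amplification : ℚ → ℕ → ℚ
amplification M zero    = 0ℚ
amplification M (suc k) = 4ℚ * M * amplification M k + (1ℚ + M) * (1ℚ + 4ℚ)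

-- The excess of the cross-ratio bound over 1 after `k` steps: the map from `R` to `(R + 1) / 2`
-- halves `R - 1`.
ratio : ℚ → ℕ → ℚ
ratio M k = (M - 1ℚ) * ½ ^ k

-- From small minors to a nearly constant kernel

module Constancy {n : ℕ} {{nz : ℕ.NonZero n}}
  (β U : Average.Kernel n) (U-sym : ∀ x y → U x y ≡ U y x)
  {c M κ : ℚ} (0<c : 0ℚ < c) (c≤1 : c ≤ 1ℚ) (0≤M : 0ℚ ≤ M) (16≤Mcc : 4ℚ * 4ℚ ≤ c * c * M) (0≤κ : 0ℚ ≤ κ)
  (½c≤β : ∀ x y → ½ * c ≤ β x y) (β≤1 : ∀ x y → β x y ≤ 1ℚ)
  (c≤U : ∀ x y → c ≤ U x y) (U≤2 : ∀ x y → U x y ≤ 2ℚ)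
  (U*β≡c : ∀ x y → U x y * β x y ≡ c)
  (β≈U² : Average.E₂ n (λ x y → ∣ β x y - codegree U x y ∣) ≤ κ)
  where
  open Average n

  private
    open ≤-Reasoning

    0≤c : 0ℚ ≤ c
    0≤c = <⇒≤ 0<c

    0≤½c : 0ℚ ≤ ½ * c
    0≤½c = 0≤-* 0≤½ 0≤c

    0≤β : ∀ x y → 0ℚ ≤ β x y
    0≤β x y = ≤-trans 0≤½c (½c≤β x y)

    0≤U : ∀ x y → 0ℚ ≤ U x y
    0≤U x y = ≤-trans 0≤c (c≤U x y)

    open Contraction β U U-sym 0≤β β≤1 0≤U U≤2 0<c 0≤M 16≤Mcc 0≤κ U*β≡c β≈U²
    open CrossRatio≤

    4≤M½c½c : 4ℚ ≤ M * (½ * c * (½ * c))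
    4≤M½c½c = begin
      4ℚ                     ≤⟨ from-yes (4ℚ ≤? ½ * ½ * (4ℚ * 4ℚ)) ⟩
      ½ * ½ * (4ℚ * 4ℚ)      ≤⟨ *-monoˡ (½ * ½) (from-yes (0ℚ ≤? ½ * ½)) 16≤Mcc ⟩
      ½ * ½ * (c * c * M)    ≡⟨ lem ½ c M ⟩
      M * (½ * c * (½ * c))  ∎
      where
      lem : ∀ h c m → h * h * (c * c * m) ≡ m * (h * c * (h * c))
      lem = solve-∀ ring

    1≤M½c½c : 1ℚ ≤ M * (½ * c * (½ * c))
    1≤M½c½c = ≤-trans (from-yes (1ℚ ≤? 4ℚ)) 4≤M½c½c

    ½c*½c≤1 : ½ * c * (½ * c) ≤ 1ℚ
    ½c*½c≤1 = *-mono-≤ 0≤½c 0≤1 ½c≤1 ½c≤1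
      where
      ½c≤1 : ½ * c ≤ 1ℚ
      ½c≤1 = *-mono-≤ 0≤½ 0≤1 (from-yes (½ ≤? 1ℚ)) c≤1

    1≤M : 1ℚ ≤ M
    1≤M = ≤-trans 1≤M½c½c (≤-trans (*-monoˡ M 0≤M ½c*½c≤1) (≤-reflexive (*-identityʳ M)))

    -- All values of `β` lie between `½ * c` and 1, so a quotient of two products is at most
    -- `4 / c² ≤ M`, without any slack.
    initial : CrossRatio≤ M 0ℚ
    initial = record
      { slack   = λ _ _ _ _ → 0ℚ
      ; 0≤slack = λ _ _ _ _ → ≤-refl
      ; bound   = λ x y z w → begin
          β x z * β y w                 ≤⟨ *-mono-≤ (0≤β x z) 0≤1 (β≤1 x z) (β≤1 y w) ⟩
          1ℚ                            ≤⟨ 1≤M½c½c ⟩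
          M * (½ * c * (½ * c))         ≤⟨ *-monoˡ M 0≤M (*-mono-≤ 0≤½c (0≤β y z) (½c≤β x w) (½c≤β y z)) ⟩
          M * (β x w * β y z)           ≡⟨ +-identityʳ _ ⟨
          M * (β x w * β y z) + 0ℚ      ∎
      ; small   = ≤-reflexive (trans (E₂-cong λ _ _ → E₂-const 0ℚ) (E₂-const 0ℚ))
      }

    0≤M-1 : 0ℚ ≤ M - 1ℚ
    0≤M-1 = ≤⇒0≤- 1≤M

    0≤ratio : ∀ k → 0ℚ ≤ ratio M k
    0≤ratio k = 0≤-* 0≤M-1 (0≤-^ k 0≤½)

    ratio≤ : ∀ k → 1ℚ + ratio M k ≤ M
    ratio≤ k = begin
      1ℚ + (M - 1ℚ) * ½ ^ k  ≤⟨ +-monoʳ-≤ 1ℚ (*-monoˡ (M - 1ℚ) 0≤M-1 (^≤1 k 0≤½ (from-yes (½ ≤? 1ℚ)))) ⟩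
      1ℚ + (M - 1ℚ) * 1ℚ     ≡⟨ lem M ⟩
      M                      ∎
      where
      lem : ∀ m → 1ℚ + (m - 1ℚ) * 1ℚ ≡ m
      lem = solve-∀ ring

    iterate : ∀ k → CrossRatio≤ (1ℚ + ratio M k) (amplification M k * κ)
    iterate zero = subst₂ CrossRatio≤ (lem M) (sym (*-zeroˡ κ)) initial
      where
      lem : ∀ m → m ≡ 1ℚ + (m - 1ℚ) * 1ℚ
      lem = solve-∀ ring
    iterate (suc k) = subst₂ CrossRatio≤ halve (lem₂ (4ℚ * M) (amplification M k) κ ((1ℚ + M) * (1ℚ + 4ℚ)))
      (contract (≤-by (ratio M k) (0≤ratio k) refl) (≤-trans (≤-reflexive halve) (ratio≤ (suc k))) (iterate k))
      where
      lem₁ : ∀ m h → ½ * (1ℚ + (m - 1ℚ) * h + 1ℚ) ≡ 1ℚ + (m - 1ℚ) * (½ * h)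
      lem₁ = solve-∀ ring
      halve : ½ * (1ℚ + ratio M k + 1ℚ) ≡ 1ℚ + ratio M (suc k)
      halve = lem₁ M (½ ^ k)
      lem₂ : ∀ a b c d → a * (b * c) + d * c ≡ (a * b + d) * c
      lem₂ = solve-∀ ring

    T D : Kernel
    T = codegree U
    D x y = ∣ β x y - T x y ∣

    0≤D : ∀ x y → 0ℚ ≤ D x y
    0≤D x y = 0≤∣p∣ (β x y - T x y)

    scale : ∀ {u} x → 0ℚ ≤ u → u ≤ 2ℚ → ∣ u * x ∣ ≤ 2ℚ * ∣ x ∣
    scale {u} x 0≤u u≤2 = begin
      ∣ u * x ∣      ≡⟨ ∣p*q∣≡∣p∣*∣q∣ u x ⟩
      ∣ u ∣ * ∣ x ∣  ≡⟨ cong (_* ∣ x ∣) (0≤p⇒∣p∣≡p 0≤u) ⟩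
      u * ∣ x ∣      ≤⟨ *-monoʳ-≤-nonNeg ∣ x ∣ {{∣-∣-nonNeg x}} u≤2 ⟩
      2ℚ * ∣ x ∣     ∎

    scaleU : ∀ x y z → ∣ U x y * z ∣ ≤ 2ℚ * ∣ z ∣
    scaleU x y z = scale z (0≤U x y) (U≤2 x y)

  module _ (k : ℕ) where
    private
      ρ η : ℚ
      ρ = ratio M k
      η = amplification M k * κ
      CR = iterate k
      N = slack CR

      minor : Kernel₄
      minor x y s t = U x s * U y t - U x t * U y s

      m : Kernel₄
      m x y s t = 4ℚ * ρ + M * (N x y t s + N x y s t)

      minor≤ : ∀ x y s t → minor x y s t ≤ 4ℚ * ρ + M * N x y t s
      minor≤ x y s t = begin
        U x s * U y t - b
          ≤⟨ +-monoˡ-≤ (- b) (U-bound CR (0≤-+ 0≤1 (0≤ratio k)) x y s t) ⟩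
        (1ℚ + ρ) * b + M * N x y t s - b
          ≤⟨ ≤-by (ρ * (4ℚ - b)) (0≤-* (0≤ratio k) (≤⇒0≤- (*-mono-≤ (0≤U x t) 0≤2 (U≤2 x t) (U≤2 y s))))
               (lem ρ b (M * N x y t s) 4ℚ) ⟩
        4ℚ * ρ + M * N x y t s ∎
        where
        b = U x t * U y s
        lem : ∀ ρ b d f → f * ρ + d ≡ (1ℚ + ρ) * b + d - b + ρ * (f - b)
        lem = solve-∀ ring

      -- Exchanging the columns negates the minor, so `m` collects the slack for both orders of `s`
      -- and `t`.
      ∣minor∣≤ : ∀ x y s t → ∣ minor x y s t ∣ ≤ m x y s t
      ∣minor∣≤ x y s t = ∣x∣-lub (minor x y s t)
        (≤-trans (minor≤ x y s t) (≤-by (M * N x y s t) (0≤-* 0≤M (0≤slack CR x y s t))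
          (lem (4ℚ * ρ) M (N x y t s) (N x y s t))))
        (subst (_≤ m x y s t) (flip (U x t * U y s) (U x s * U y t))
          (≤-trans (minor≤ x y t s) (≤-by (M * N x y t s) (0≤-* 0≤M (0≤slack CR x y t s))
            (trans (cong (λ q → 4ℚ * ρ + M * q) (+-comm (N x y t s) (N x y s t)))
                   (lem (4ℚ * ρ) M (N x y s t) (N x y t s))))))
        where
        lem : ∀ a m p q → a + m * (p + q) ≡ a + m * p + m * q
        lem = solve-∀ ring
        flip : ∀ p q → p - q ≡ - (q - p)
        flip = solve-∀ ring

      E₄-m : E₄ m ≤ 4ℚ * ρ + M * (η + η)
      E₄-m = begin
        E₄ m
          ≡⟨ trans (E₄-+ (λ _ _ _ _ → 4ℚ * ρ) (λ x y s t → M * (N x y t s + N x y s t)))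
               (cong₂ _+_ (trans (E₂-cong λ _ _ → E₂-const (4ℚ * ρ)) (E₂-const (4ℚ * ρ)))
                 (trans (E₄-* M (λ x y s t → N x y t s + N x y s t)) (cong (M *_)
                   (trans (E₄-+ (λ x y s t → N x y t s) N)
                     (cong (_+ E₄ N) (E₂-cong λ x y → E-swap (λ s t → N x y t s))))))) ⟩
        4ℚ * ρ + M * (E₄ N + E₄ N)
          ≤⟨ +-monoʳ-≤ (4ℚ * ρ) (*-monoˡ M 0≤M (+-mono-≤ (small CR) (small CR))) ⟩
        4ℚ * ρ + M * (η + η) ∎

      -- u β′ - u′ β determines u² - u′², because u β = u′ β′ = c.
      from-quotients : ∀ x y y′ → ∣ U x y′ - U x y ∣ ≤ M * ∣ U x y′ * β x y - U x y * β x y′ ∣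
      from-quotients x y y′ = *-cancelˡ (c * c) (0<-* 0<c 0<c) (begin
        c * c * ∣ u′ - u ∣
          ≤⟨ *-monoʳ-≤-nonNeg ∣ u′ - u ∣ {{∣-∣-nonNeg (u′ - u)}} (*-monoˡ c 0≤c c≤u′+u) ⟩
        c * (u′ + u) * ∣ u′ - u ∣
          ≡⟨ cong (_* ∣ u′ - u ∣) (0≤p⇒∣p∣≡p (0≤-* 0≤c 0≤u′+u)) ⟨
        ∣ c * (u′ + u) ∣ * ∣ u′ - u ∣
          ≡⟨ ∣p*q∣≡∣p∣*∣q∣ (c * (u′ + u)) (u′ - u) ⟨
        ∣ c * (u′ + u) * (u′ - u) ∣
          ≡⟨ cong ∣_∣ eq ⟩
        ∣ u * (u′ * g) ∣
          ≤⟨ ≤-trans (scaleU x y (u′ * g)) (*-monoˡ 2ℚ 0≤2 (scaleU x y′ g)) ⟩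
        2ℚ * (2ℚ * ∣ g ∣)
          ≡⟨ *-assoc 2ℚ 2ℚ ∣ g ∣ ⟨
        4ℚ * ∣ g ∣
          ≤⟨ *-monoʳ-≤-nonNeg ∣ g ∣ {{∣-∣-nonNeg g}} (≤-trans (from-yes (4ℚ ≤? 4ℚ * 4ℚ)) 16≤Mcc) ⟩
        c * c * M * ∣ g ∣
          ≡⟨ *-assoc (c * c) M ∣ g ∣ ⟩
        c * c * (M * ∣ g ∣) ∎)
        where
        u = U x y
        u′ = U x y′
        g = u′ * β x y - u * β x y′
        c≤u′+u : c ≤ u′ + u
        c≤u′+u = ≤-trans (c≤U x y′) (≤-by u (0≤U x y) refl)
        0≤u′+u = ≤-trans 0≤c c≤u′+u
        lem₁ : ∀ c u′ u → c * (u′ + u) * (u′ - u) ≡ c * (u′ * u′) - c * (u * u)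
        lem₁ = solve-∀ ring
        lem₂ : ∀ u b u′ b′ → u * b * (u′ * u′) - u′ * b′ * (u * u) ≡ u * (u′ * (u′ * b - u * b′))
        lem₂ = solve-∀ ring
        eq : c * (u′ + u) * (u′ - u) ≡ u * (u′ * g)
        eq = begin-equality
          c * (u′ + u) * (u′ - u)          ≡⟨ lem₁ c u′ u ⟩
          c * (u′ * u′) - c * (u * u)
            ≡⟨ cong₂ (λ p q → p * (u′ * u′) - q * (u * u)) (U*β≡c x y) (U*β≡c x y′) ⟨
          u * β x y * (u′ * u′) - u′ * β x y′ * (u * u)  ≡⟨ lem₂ u (β x y) u′ (β x y′) ⟩
          u * (u′ * g)                     ∎

      row-error : V → Kernel
      row-error x y y′ = M * ((2ℚ * D x y + 2ℚ * D x y′) + 2ℚ * E (m y′ y x))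

      -- After `β` is replaced by `T` in `from-quotients`, the difference `u′ * T x y - u * T x y′`
      -- is an average over `z` of `U x z` times the minor with rows `y′, y` and columns `x, z`.
      -- Small minors therefore make each row nearly constant on average.
      row-close : ∀ x y y′ → ∣ U x y′ - U x y ∣ ≤ row-error x y y′
      row-close x y y′ = ≤-trans (from-quotients x y y′) (*-monoˡ M 0≤M (begin
        ∣ u′ * β x y - u * β x y′ ∣
          ≡⟨ cong ∣_∣ (lem u u′ (β x y) (β x y′) (T x y) (T x y′)) ⟩
        ∣ (u′ * (β x y - T x y) - u * (β x y′ - T x y′)) + (u′ * T x y - u * T x y′) ∣
          ≤⟨ ∣p+q∣≤∣p∣+∣q∣ (u′ * (β x y - T x y) - u * (β x y′ - T x y′)) (u′ * T x y - u * T x y′) ⟩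
        ∣ u′ * (β x y - T x y) - u * (β x y′ - T x y′) ∣ + ∣ u′ * T x y - u * T x y′ ∣
          ≤⟨ +-mono-≤ (≤-trans (∣p-q∣≤∣p∣+∣q∣ (u′ * (β x y - T x y)) (u * (β x y′ - T x y′)))
               (+-mono-≤ (scaleU x y′ (β x y - T x y)) (scaleU x y (β x y′ - T x y′)))) minor-part ⟩
        (2ℚ * D x y + 2ℚ * D x y′) + 2ℚ * E (m y′ y x) ∎))
        where
        u = U x y
        u′ = U x y′
        lem : ∀ u u′ b b′ t t′ → u′ * b - u * b′ ≡ (u′ * (b - t) - u * (b′ - t′)) + (u′ * t - u * t′)
        lem = solve-∀ ring
        lem₂ : ∀ u u′ z v v′ → u′ * (z * v) - u * (z * v′) ≡ z * (u′ * v - v′ * u)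
        lem₂ = solve-∀ ring
        minor-part : ∣ u′ * T x y - u * T x y′ ∣ ≤ 2ℚ * E (m y′ y x)
        minor-part = begin
          ∣ u′ * T x y - u * T x y′ ∣
            ≡⟨ cong ∣_∣ (trans (E-- (λ z → u′ * (U x z * U y z)) (λ z → u * (U x z * U y′ z)))
                 (cong₂ _-_ (E-* u′ (λ z → U x z * U y z)) (E-* u (λ z → U x z * U y′ z)))) ⟨
          ∣ E (λ z → u′ * (U x z * U y z) - u * (U x z * U y′ z)) ∣
            ≤⟨ ∣E∣≤E∣∣ (λ z → u′ * (U x z * U y z) - u * (U x z * U y′ z)) ⟩
          E (λ z → ∣ u′ * (U x z * U y z) - u * (U x z * U y′ z) ∣)
            ≤⟨ E-mono (λ z → begin
                 ∣ u′ * (U x z * U y z) - u * (U x z * U y′ z) ∣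
                   ≡⟨ cong ∣_∣ (trans (lem₂ u u′ (U x z) (U y z) (U y′ z))
                        (cong₂ (λ p q → U x z * (p * U y z - U y′ z * q)) (U-sym x y′) (U-sym x y))) ⟩
                 ∣ U x z * minor y′ y x z ∣
                   ≤⟨ ≤-trans (scaleU x z (minor y′ y x z)) (*-monoˡ 2ℚ 0≤2 (∣minor∣≤ y′ y x z)) ⟩
                 2ℚ * m y′ y x z ∎) ⟩
          E (λ z → 2ℚ * m y′ y x z)
            ≡⟨ E-* 2ℚ (m y′ y x) ⟩
          2ℚ * E (m y′ y x) ∎

    row-bound : ℚ
    row-bound = M * ((2ℚ * κ + 2ℚ * κ) + 2ℚ * (4ℚ * ρ + M * (η + η)))

    private
      E-row-error : E (λ x → E₂ (row-error x)) ≤ row-bound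
      E-row-error = begin
        E (λ x → E₂ (row-error x))
          ≡⟨ E-cong (λ x → trans (E₂-* M (λ y y′ → (2ℚ * D x y + 2ℚ * D x y′) + 2ℚ * E (m y′ y x)))
               (cong (M *_) (trans (E₂-+ (λ y y′ → 2ℚ * D x y + 2ℚ * D x y′) (λ y y′ → 2ℚ * E (m y′ y x)))
                 (cong₂ _+_ (trans (E₂-+ (λ y y′ → 2ℚ * D x y) (λ y y′ → 2ℚ * D x y′))
                   (cong₂ _+_ (trans (E₂-fst (λ y → 2ℚ * D x y)) (E-* 2ℚ (D x)))
                              (trans (E₂-snd (λ y → 2ℚ * D x y)) (E-* 2ℚ (D x)))))
                   (E₂-* 2ℚ (λ y y′ → E (m y′ y x))))))) ⟩
        E (λ x → M * ((2ℚ * E (D x) + 2ℚ * E (D x)) + 2ℚ * E₂ (λ y y′ → E (m y′ y x))))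
          ≡⟨ trans (E-* M _) (cong (M *_) (trans (E-+ (λ x → 2ℚ * E (D x) + 2ℚ * E (D x)) _)
               (cong₂ _+_ (trans (E-+ (λ x → 2ℚ * E (D x)) (λ x → 2ℚ * E (D x)))
                            (cong₂ _+_ (E-* 2ℚ (λ x → E (D x))) (E-* 2ℚ (λ x → E (D x)))))
                          (trans (E-* 2ℚ (λ x → E₂ (λ y y′ → E (m y′ y x)))) (cong (2ℚ *_) permute))))) ⟩
        M * ((2ℚ * E₂ D + 2ℚ * E₂ D) + 2ℚ * E₄ m)
          ≤⟨ *-monoˡ M 0≤M (+-mono-≤ (+-mono-≤ (*-monoˡ 2ℚ 0≤2 β≈U²) (*-monoˡ 2ℚ 0≤2 β≈U²)) (*-monoˡ 2ℚ 0≤2 E₄-m)) ⟩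
        row-bound ∎
        where
        permute : E (λ x → E₂ (λ y y′ → E (m y′ y x))) ≡ E₄ m
        permute = trans (E-cong λ x → E-swap (λ y y′ → E (m y′ y x)))
          (trans (E-swap (λ x y′ → E λ y → E (m y′ y x))) (E-cong λ y′ → E-swap (λ x y → E (m y′ y x))))

      cube-error : Kernel
      cube-error x y = 2ℚ * D x y + (4ℚ * E (row-error x y) + 4ℚ * E (row-error y x))

      -- `c = u * β ≈ u * T`, and `T x y` averages `U x z * U y z`. The first factor is compared
      -- with `u` along row `x`, the second along row `y` by symmetry, so `T x y ≈ u²`.
      cube-close : ∀ x y → ∣ c - U x y * U x y * U x y ∣ ≤ cube-error x y
      cube-close x y = begin
        ∣ c - u * u * u ∣
          ≡⟨ cong ∣_∣ (trans (cong (_- u * u * u) (sym (U*β≡c x y))) (lem₁ u (β x y) (T x y) (u * u * u))) ⟩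
        ∣ u * (β x y - T x y) + (u * T x y - u * u * u) ∣
          ≤⟨ ∣p+q∣≤∣p∣+∣q∣ (u * (β x y - T x y)) (u * T x y - u * u * u) ⟩
        ∣ u * (β x y - T x y) ∣ + ∣ u * T x y - u * u * u ∣
          ≤⟨ +-mono-≤ (scaleU x y (β x y - T x y)) triangle-part ⟩
        cube-error x y ∎
        where
        u = U x y
        lem₁ : ∀ u b t d → u * b - d ≡ u * (b - t) + (u * t - d)
        lem₁ = solve-∀ ring
        lem₂ : ∀ u v w → u * (v * w) - u * u * u ≡ u * (w * (v - u)) + u * (u * (w - u))
        lem₂ = solve-∀ ring
        twice : ∀ {v w} z → 0ℚ ≤ v → v ≤ 2ℚ → 0ℚ ≤ w → w ≤ 2ℚ → ∣ v * (w * z) ∣ ≤ 4ℚ * ∣ z ∣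
        twice {v} {w} z 0≤v v≤2 0≤w w≤2 = ≤-trans (scale (w * z) 0≤v v≤2)
          (≤-trans (*-monoˡ 2ℚ 0≤2 (scale z 0≤w w≤2)) (≤-reflexive (sym (*-assoc 2ℚ 2ℚ ∣ z ∣))))
        triangle-part : ∣ u * T x y - u * u * u ∣ ≤ 4ℚ * E (row-error x y) + 4ℚ * E (row-error y x)
        triangle-part = begin
          ∣ u * T x y - u * u * u ∣
            ≡⟨ cong ∣_∣ (trans (E-- (λ z → u * (U x z * U y z)) (λ _ → u * u * u))
                 (cong₂ _-_ (E-* u (λ z → U x z * U y z)) (E-const (u * u * u)))) ⟨
          ∣ E (λ z → u * (U x z * U y z) - u * u * u) ∣
            ≤⟨ ∣E∣≤E∣∣ (λ z → u * (U x z * U y z) - u * u * u) ⟩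
          E (λ z → ∣ u * (U x z * U y z) - u * u * u ∣)
            ≤⟨ E-mono (λ z → begin
                 ∣ u * (U x z * U y z) - u * u * u ∣
                   ≡⟨ cong ∣_∣ (lem₂ u (U x z) (U y z)) ⟩
                 ∣ u * (U y z * (U x z - u)) + u * (u * (U y z - u)) ∣
                   ≤⟨ ∣p+q∣≤∣p∣+∣q∣ (u * (U y z * (U x z - u))) (u * (u * (U y z - u))) ⟩
                 ∣ u * (U y z * (U x z - u)) ∣ + ∣ u * (u * (U y z - u)) ∣
                   ≤⟨ +-mono-≤ (twice (U x z - u) (0≤U x y) (U≤2 x y) (0≤U y z) (U≤2 y z))
                               (twice (U y z - u) (0≤U x y) (U≤2 x y) (0≤U x y) (U≤2 x y)) ⟩
                 4ℚ * ∣ U x z - u ∣ + 4ℚ * ∣ U y z - u ∣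
                   ≡⟨ cong (λ v → 4ℚ * ∣ U x z - u ∣ + 4ℚ * ∣ U y z - v ∣) (U-sym x y) ⟩
                 4ℚ * ∣ U x z - U x y ∣ + 4ℚ * ∣ U y z - U y x ∣
                   ≤⟨ +-mono-≤ (*-monoˡ 4ℚ 0≤4 (row-close x y z)) (*-monoˡ 4ℚ 0≤4 (row-close y x z)) ⟩
                 4ℚ * row-error x y z + 4ℚ * row-error y x z ∎) ⟩
          E (λ z → 4ℚ * row-error x y z + 4ℚ * row-error y x z)
            ≡⟨ trans (E-+ (λ z → 4ℚ * row-error x y z) (λ z → 4ℚ * row-error y x z))
                 (cong₂ _+_ (E-* 4ℚ (row-error x y)) (E-* 4ℚ (row-error y x))) ⟩
          4ℚ * E (row-error x y) + 4ℚ * E (row-error y x) ∎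

      E-cube-error : E₂ cube-error ≤ 2ℚ * κ + (4ℚ * row-bound + 4ℚ * row-bound)
      E-cube-error = begin
        E₂ cube-error
          ≡⟨ trans (E₂-+ (λ x y → 2ℚ * D x y) (λ x y → 4ℚ * E (row-error x y) + 4ℚ * E (row-error y x)))
               (cong₂ _+_ (E₂-* 2ℚ D)
                 (trans (E₂-+ (λ x y → 4ℚ * E (row-error x y)) (λ x y → 4ℚ * E (row-error y x)))
                   (cong₂ _+_ (E₂-* 4ℚ (λ x y → E (row-error x y)))
                     (trans (E₂-* 4ℚ (λ x y → E (row-error y x)))
                       (cong (4ℚ *_) (E-swap (λ x y → E (row-error y x)))))))) ⟩
        2ℚ * E₂ D + (4ℚ * E (λ x → E₂ (row-error x)) + 4ℚ * E (λ x → E₂ (row-error x)))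
          ≤⟨ +-mono-≤ (*-monoˡ 2ℚ 0≤2 β≈U²)
               (+-mono-≤ (*-monoˡ 4ℚ 0≤4 E-row-error) (*-monoˡ 4ℚ 0≤4 E-row-error)) ⟩
        2ℚ * κ + (4ℚ * row-bound + 4ℚ * row-bound) ∎

    module _ {p : ℚ} (0≤p : 0ℚ ≤ p) (p≤1 : p ≤ 1ℚ) (ppp≡c : p * p * p ≡ c) where
      private
        -- `p³ - u³` is `p - u` times `p² + pu + u²`, and the latter is at least `p² ≥ p³ = c`.
        -- Dividing by it costs at most `1 / c ≤ M`.
        from-cubes : ∀ x y → ∣ U x y - p ∣ ≤ M * ∣ c - U x y * U x y * U x y ∣
        from-cubes x y = *-cancelˡ c 0<c (begin
          c * ∣ u - p ∣
            ≡⟨ cong (c *_) (trans (sym (∣-p∣≡∣p∣ (u - p))) (cong ∣_∣ (flip u p))) ⟩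
          c * ∣ p - u ∣
            ≤⟨ *-monoʳ-≤-nonNeg ∣ p - u ∣ {{∣-∣-nonNeg (p - u)}} c≤s ⟩
          s * ∣ p - u ∣
            ≡⟨ cong (_* ∣ p - u ∣) (0≤p⇒∣p∣≡p (≤-trans 0≤c c≤s)) ⟨
          ∣ s ∣ * ∣ p - u ∣
            ≡⟨ trans (sym (∣p*q∣≡∣p∣*∣q∣ s (p - u))) (cong ∣_∣ (trans (factor p u) (cong (_- u * u * u) ppp≡c))) ⟩
          ∣ c - u * u * u ∣
            ≡⟨ *-identityˡ _ ⟨
          1ℚ * ∣ c - u * u * u ∣
            ≤⟨ *-monoʳ-≤-nonNeg _ {{∣-∣-nonNeg (c - u * u * u)}} 1≤cM ⟩
          c * M * ∣ c - u * u * u ∣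
            ≡⟨ *-assoc c M _ ⟩
          c * (M * ∣ c - u * u * u ∣) ∎)
          where
          u = U x y
          s = p * p + (u * p + u * u)
          flip : ∀ u p → - (u - p) ≡ p - u
          flip = solve-∀ ring
          factor : ∀ p u → (p * p + (u * p + u * u)) * (p - u) ≡ p * p * p - u * u * u
          factor = solve-∀ ring
          c≤s : c ≤ s
          c≤s = ≤-by (p * p * (1ℚ - p) + (u * p + u * u))
            (0≤-+ (0≤-* (0≤-square p) (≤⇒0≤- p≤1)) (0≤-+ (0≤-* (0≤U x y) 0≤p) (0≤-square u)))
            (trans (lem p u) (cong (_+ (p * p * (1ℚ - p) + (u * p + u * u))) ppp≡c))
            where
            lem : ∀ p u → p * p + (u * p + u * u) ≡ p * p * p + (p * p * (1ℚ - p) + (u * p + u * u))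
            lem = solve-∀ ring
          1≤cM : 1ℚ ≤ c * M
          1≤cM = begin
            1ℚ             ≤⟨ from-yes (1ℚ ≤? 4ℚ * 4ℚ) ⟩
            4ℚ * 4ℚ        ≤⟨ 16≤Mcc ⟩
            c * c * M      ≤⟨ *-monoʳ-≤-nonNeg M {{nonNegative 0≤M}} (*-monoˡ c 0≤c c≤1) ⟩
            c * 1ℚ * M     ≡⟨ cong (_* M) (*-identityʳ c) ⟩
            c * M          ∎

      U≈p : E₂ (λ x y → ∣ U x y - p ∣) ≤ M * (2ℚ * κ + (4ℚ * row-bound + 4ℚ * row-bound))
      U≈p = begin
        E₂ (λ x y → ∣ U x y - p ∣)
          ≤⟨ E₂-mono (λ x y → ≤-trans (from-cubes x y) (*-monoˡ M 0≤M (cube-close x y))) ⟩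
        E₂ (λ x y → M * cube-error x y)
          ≡⟨ E₂-* M cube-error ⟩
        M * E₂ cube-error
          ≤⟨ *-monoˡ M 0≤M E-cube-error ⟩
        M * (2ℚ * κ + (4ℚ * row-bound + 4ℚ * row-bound)) ∎

-- Choice of constants

0<1 : 0ℚ < 1ℚ
0<1 = from-yes (0ℚ <? 1ℚ)

0<½ : 0ℚ < ½
0<½ = from-yes (0ℚ <? ½)

0<⊓ : ∀ {x y} → 0ℚ < x → 0ℚ < y → 0ℚ < x ⊓ y
0<⊓ {x} {y} 0<x 0<y with ≤-total x y
... | inj₁ x≤y = subst (0ℚ <_) (sym (p≤q⇒p⊓q≡p x≤y)) 0<x
... | inj₂ y≤x = subst (0ℚ <_) (sym (p≥q⇒p⊓q≡q y≤x)) 0<y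

shrink : ∀ {L ε} → 0ℚ ≤ L → 0ℚ < ε → ∃ λ τ → 0ℚ < τ × L * τ ≤ ε
-- The choice `ε / (1 + L)` spares a case distinction for `L = 0`.
shrink {L} {ε} 0≤L 0<ε = i * ε , 0<-* 0<i 0<ε , (begin
  L * (i * ε)         ≤⟨ ≤-by (i * ε) (<⇒≤ (0<-* 0<i 0<ε)) (lem L (i * ε)) ⟩
  (1ℚ + L) * (i * ε)  ≡⟨ *-assoc (1ℚ + L) i ε ⟨
  (1ℚ + L) * i * ε    ≡⟨ cong (_* ε) (proj₂ (proj₂ inv)) ⟩
  1ℚ * ε              ≡⟨ *-identityˡ ε ⟩
  ε                   ∎)
  where
  open ≤-Reasoning
  inv = inverse (+-mono-<-≤ 0<1 0≤L)
  i = proj₁ inv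
  0<i = proj₁ (proj₂ inv)
  lem : ∀ l x → (1ℚ + l) * x ≡ l * x + x
  lem = solve-∀ ring

halves : ∀ x → ½ * x + ½ * x ≡ x
halves = solve-∀ ring

-- The constants are chosen against the direction of the argument: `steps` makes the ratio term
-- small, `κ` beats the resulting amplification, then come `μ` and `k`, `ν` and `j`, and finally
-- `γ`, `θ` and `δ`.
module Constants {p₀ ε : ℚ} (0<p₀ : 0ℚ < p₀) (p₀≤1 : p₀ ≤ 1ℚ) (0<ε : 0ℚ < ε) where
  c₀ h i M : ℚ
  c₀ = p₀ * p₀ * p₀
  -- For `c₀ ≤ c` this is at most `c` as well as `c * c`, so it serves as decay rate for both
  -- exponents `k` and `j`.
  h = c₀ * c₀

  0<c₀ : 0ℚ < c₀
  0<c₀ = 0<-* (0<-* 0<p₀ 0<p₀) 0<p₀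

  c₀≤1 : c₀ ≤ 1ℚ
  c₀≤1 = *-mono-≤ (0≤-square p₀) 0≤1 (*-mono-≤ (<⇒≤ 0<p₀) 0≤1 p₀≤1 p₀≤1) p₀≤1

  0<h : 0ℚ < h
  0<h = 0<-* 0<c₀ 0<c₀

  h≤c₀ : h ≤ c₀
  h≤c₀ = ≤-trans (*-monoˡ c₀ (<⇒≤ 0<c₀) c₀≤1) (≤-reflexive (*-identityʳ c₀))

  h≤1 : h ≤ 1ℚ
  h≤1 = ≤-trans h≤c₀ c₀≤1

  i = proj₁ (inverse 0<h)
  M = i * (4ℚ * 4ℚ)

  0≤M : 0ℚ ≤ M
  0≤M = 0≤-* (<⇒≤ (proj₁ (proj₂ (inverse 0<h)))) (0≤-* 0≤4 0≤4)

  hM≡16 : h * M ≡ 4ℚ * 4ℚ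
  hM≡16 = trans (sym (*-assoc h i (4ℚ * 4ℚ)))
    (trans (cong (_* (4ℚ * 4ℚ)) (proj₂ (proj₂ (inverse 0<h)))) (*-identityˡ (4ℚ * 4ℚ)))

  16≤Mcc : ∀ {c} → c₀ ≤ c → 4ℚ * 4ℚ ≤ c * c * M
  16≤Mcc {c} c₀≤c = subst (_≤ c * c * M) hM≡16
    (*-monoʳ-≤-nonNeg M {{nonNegative 0≤M}} (*-mono-≤ 0≤c₀ (≤-trans 0≤c₀ c₀≤c) c₀≤c c₀≤c))
    where
    0≤c₀ = <⇒≤ 0<c₀

  1≤M : 1ℚ ≤ M
  1≤M = begin
    1ℚ       ≤⟨ from-yes (1ℚ ≤? 4ℚ * 4ℚ) ⟩
    4ℚ * 4ℚ  ≡⟨ hM≡16 ⟨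
    h * M    ≤⟨ *-monoʳ-≤-nonNeg M {{nonNegative 0≤M}} h≤1 ⟩
    1ℚ * M   ≡⟨ *-identityˡ M ⟩
    M        ∎
    where open ≤-Reasoning

  0<½ε : 0ℚ < ½ * ε
  0<½ε = 0<-* 0<½ 0<ε

  -- The coefficients of `½ ^ steps` and of `κ` in the total error, as collected in `total`.
  L₁ L₂ : ℚ
  L₁ = 4ℚ * 4ℚ * 4ℚ * (M * M * (M - 1ℚ))

  0≤L₁ : 0ℚ ≤ L₁
  0≤L₁ = 0≤-* (0≤-* (0≤-* 0≤4 0≤4) 0≤4) (0≤-* (0≤-* 0≤M 0≤M) (≤⇒0≤- 1≤M))

  steps : ℕ
  steps = proj₁ (power-tends-to-0 0<½ (from-yes (½ ≤? 1ℚ)) (proj₁ (proj₂ (shrink 0≤L₁ 0<½ε))))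

  ½^steps≤ : L₁ * ½ ^ steps ≤ ½ * ε
  ½^steps≤ = ≤-trans
    (*-monoˡ L₁ 0≤L₁ (proj₂ (power-tends-to-0 0<½ (from-yes (½ ≤? 1ℚ)) (proj₁ (proj₂ (shrink 0≤L₁ 0<½ε))))))
    (proj₂ (proj₂ (shrink 0≤L₁ 0<½ε)))

  amp : ℚ
  amp = amplification M steps

  0≤amplification : ∀ k → 0ℚ ≤ amplification M k
  0≤amplification zero    = ≤-refl
  0≤amplification (suc k) = 0≤-+ (0≤-* (0≤-* 0≤4 0≤M) (0≤amplification k))
    (0≤-* (0≤-+ 0≤1 0≤M) (0≤-+ 0≤1 0≤4))

  L₂ = 1ℚ + M * (2ℚ * 4ℚ + 2ℚ * 4ℚ * M * (4ℚ * 4ℚ + 4ℚ * 4ℚ * M * amp))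

  0≤L₂ : 0ℚ ≤ L₂
  0≤L₂ = 0≤-+ 0≤1 (0≤-* 0≤M (0≤-+ (0≤-* 0≤2 0≤4) (0≤-* (0≤-* (0≤-* 0≤2 0≤4) 0≤M)
    (0≤-+ (0≤-* 0≤4 0≤4) (0≤-* (0≤-* (0≤-* 0≤4 0≤4) 0≤M) (0≤amplification steps))))))

  κ : ℚ
  κ = proj₁ (shrink 0≤L₂ 0<½ε)

  0<κ : 0ℚ < κ
  0<κ = proj₁ (proj₂ (shrink 0≤L₂ 0<½ε))

  L₂κ≤ : L₂ * κ ≤ ½ * ε
  L₂κ≤ = proj₂ (proj₂ (shrink 0≤L₂ 0<½ε))

  μ : ℚ
  -- Four copies of `μ` use up one half of `κ`; the other half is left for `(k + 2) * ν`.
  μ = ½ * (½ * (½ * κ))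

  0<½μ : 0ℚ < ½ * μ
  0<½μ = 0<-* 0<½ (0<-* 0<½ (0<-* 0<½ (0<-* 0<½ 0<κ)))

  k : ℕ
  k = proj₁ (power-tends-to-0 0<h h≤1 0<½μ)

  private
    0≤k+2 : 0ℚ ≤ fromNat k + 2ℚ
    0≤k+2 = 0≤-+ (0≤fromNat k) 0≤2

    shrink-ν = shrink 0≤k+2 (0<-* 0<½ 0<κ)

  ν : ℚ
  ν = proj₁ shrink-ν

  0<½ν : 0ℚ < ½ * ν
  0<½ν = 0<-* 0<½ (proj₁ (proj₂ shrink-ν))

  j : ℕ
  j = proj₁ (power-tends-to-0 0<h h≤1 0<½ν)

  private
    shrink-γ₁ = shrink (0≤-^ k 0≤2) 0<½μ
    shrink-γ₂ = shrink (0≤-* (0≤-^ j 0≤2) (0≤-^ j 0≤2)) 0<½ν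

  γ : ℚ
  -- The first two caps absorb the losses `2 ^ k` and `4 ^ j` incurred by powers of `1 - B`; the cap
  -- 1 is for `θ≤1`.
  γ = proj₁ shrink-γ₁ ⊓ (proj₁ shrink-γ₂ ⊓ 1ℚ)

  0<γ : 0ℚ < γ
  0<γ = 0<⊓ (proj₁ (proj₂ shrink-γ₁)) (0<⊓ (proj₁ (proj₂ shrink-γ₂)) 0<1)

  γ≤1 : γ ≤ 1ℚ
  γ≤1 = ≤-trans (p⊓q≤q (proj₁ shrink-γ₁) (proj₁ shrink-γ₂ ⊓ 1ℚ)) (p⊓q≤q (proj₁ shrink-γ₂) 1ℚ)

  ≤μ : ∀ {c} → c₀ ≤ c → c ≤ 1ℚ → (1ℚ - c) ^ k + 2ℚ ^ k * γ ≤ μ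
  ≤μ {c} c₀≤c c≤1 = subst ((1ℚ - c) ^ k + 2ℚ ^ k * γ ≤_) (halves μ) (+-mono-≤
    (≤-trans (^-monoˡ-≤ k (≤⇒0≤- c≤1) (+-monoʳ-≤ 1ℚ (neg-antimono-≤ (≤-trans h≤c₀ c₀≤c))))
      (proj₂ (power-tends-to-0 0<h h≤1 0<½μ)))
    (≤-trans (*-monoˡ (2ℚ ^ k) (0≤-^ k 0≤2) (p⊓q≤p (proj₁ shrink-γ₁) (proj₁ shrink-γ₂ ⊓ 1ℚ)))
      (proj₂ (proj₂ shrink-γ₁))))

  ≤ν : ∀ {c} → c₀ ≤ c → c ≤ 1ℚ → (1ℚ - c * c) ^ j + 2ℚ ^ j * (2ℚ ^ j * γ) ≤ ν
  ≤ν {c} c₀≤c c≤1 = subst ((1ℚ - c * c) ^ j + 2ℚ ^ j * (2ℚ ^ j * γ) ≤_) (halves ν) (+-mono-≤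
    (≤-trans (^-monoˡ-≤ j (≤⇒0≤- (*-mono-≤ 0≤c 0≤1 c≤1 c≤1)) (+-monoʳ-≤ 1ℚ (neg-antimono-≤
        (*-mono-≤ (<⇒≤ 0<c₀) 0≤c c₀≤c c₀≤c))))
      (proj₂ (power-tends-to-0 0<h h≤1 0<½ν)))
    (≤-trans (≤-reflexive (sym (*-assoc (2ℚ ^ j) (2ℚ ^ j) γ)))
      (≤-trans (*-monoˡ (2ℚ ^ j * 2ℚ ^ j) (0≤-* (0≤-^ j 0≤2) (0≤-^ j 0≤2))
        (≤-trans (p⊓q≤q (proj₁ shrink-γ₁) (proj₁ shrink-γ₂ ⊓ 1ℚ)) (p⊓q≤p (proj₁ shrink-γ₂) 1ℚ)))
        (proj₂ (proj₂ shrink-γ₂)))))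
    where
    0≤c = ≤-trans (<⇒≤ 0<c₀) c₀≤c

  μν≤κ : μ + ((1ℚ + 2ℚ) * μ + (fromNat k + 2ℚ) * ν) ≤ κ
  μν≤κ = begin
    μ + ((1ℚ + 2ℚ) * μ + (fromNat k + 2ℚ) * ν)  ≡⟨ lem μ ((fromNat k + 2ℚ) * ν) ⟩
    4ℚ * μ + (fromNat k + 2ℚ) * ν               ≤⟨ +-monoʳ-≤ (4ℚ * μ) (proj₂ (proj₂ shrink-ν)) ⟩
    4ℚ * μ + ½ * κ                              ≡⟨ lem₂ κ ⟩
    κ                                           ∎
    where
    open ≤-Reasoning
    lem : ∀ m x → m + ((1ℚ + (1ℚ + 1ℚ)) * m + x) ≡ (1ℚ + 1ℚ) * (1ℚ + 1ℚ) * m + x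
    lem = solve-∀ ring
    lem₂ : ∀ x → (1ℚ + 1ℚ) * (1ℚ + 1ℚ) * (½ * (½ * (½ * x))) + ½ * x ≡ x
    lem₂ = solve-∀ ring

  ν≤κ : ν ≤ κ
  ν≤κ = ≤-trans
    (≤-by (4ℚ * μ + (fromNat k + 1ℚ) * ν)
      (0≤-+ (0≤-* 0≤4 0≤μ) (0≤-* (0≤-+ (0≤fromNat k) 0≤1) 0≤ν))
      (lem μ (fromNat k) ν)) μν≤κ
    where
    0≤μ : 0ℚ ≤ μ
    0≤μ = 0≤-* 0≤½ (0≤-* 0≤½ (0≤-* 0≤½ (<⇒≤ 0<κ)))
    0≤ν : 0ℚ ≤ ν
    0≤ν = <⇒≤ (proj₁ (proj₂ shrink-ν))
    lem : ∀ m k n → m + ((1ℚ + (1ℚ + 1ℚ)) * m + (k + (1ℚ + 1ℚ)) * n) ≡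
      n + ((1ℚ + 1ℚ) * (1ℚ + 1ℚ) * m + (k + 1ℚ) * n)
    lem = solve-∀ ring

  ν+3κ≤4κ : ν + (κ + 2ℚ * κ) ≤ 4ℚ * κ
  ν+3κ≤4κ = ≤-trans (+-monoˡ-≤ (κ + 2ℚ * κ) ν≤κ) (≤-reflexive (lem κ))
    where
    lem : ∀ x → x + (x + (1ℚ + 1ℚ) * x) ≡ (1ℚ + 1ℚ) * (1ℚ + 1ℚ) * x
    lem = solve-∀ ring

  θ δ : ℚ
  -- For `θ ≤ 1` the sum `½ * θ² + 2 * θ` is at most `4 * θ`, which is exactly `γ²`.
  θ = ½ * γ * (½ * γ)

  0<θ : 0ℚ < θ
  0<θ = 0<-* (0<-* 0<½ 0<γ) (0<-* 0<½ 0<γ)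

  θ≤1 : θ ≤ 1ℚ
  θ≤1 = *-mono-≤ (<⇒≤ 0<½γ) 0≤1 ½γ≤1 ½γ≤1
    where
    0<½γ = 0<-* 0<½ 0<γ
    ½γ≤1 : ½ * γ ≤ 1ℚ
    ½γ≤1 = *-mono-≤ 0≤½ 0≤1 (from-yes (½ ≤? 1ℚ)) γ≤1

  ≤γγ : ½ * (θ * θ) + (θ + θ) ≤ γ * γ
  ≤γγ = begin
    ½ * (θ * θ) + (θ + θ)
      ≤⟨ ≤-by (½ * (θ * (1ℚ - θ)) + (½ * θ + θ)) (0≤-+ (0≤-* 0≤½ (0≤-* 0≤θ (≤⇒0≤- θ≤1)))
           (0≤-+ (0≤-* 0≤½ 0≤θ) 0≤θ)) (lem₁ θ) ⟩
    4ℚ * θ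
      ≡⟨ lem₂ γ ⟩
    γ * γ ∎
    where
    open ≤-Reasoning
    0≤θ = <⇒≤ 0<θ
    lem₁ : ∀ t → (1ℚ + 1ℚ) * (1ℚ + 1ℚ) * t ≡ ½ * (t * t) + (t + t) + (½ * (t * (1ℚ - t)) + (½ * t + t))
    lem₁ = solve-∀ ring
    lem₂ : ∀ g → (1ℚ + 1ℚ) * (1ℚ + 1ℚ) * (½ * g * (½ * g)) ≡ g * g
    lem₂ = solve-∀ ring

  private
    x : ℚ
    x = ½ * (θ * θ)

    0<x : 0ℚ < x
    0<x = 0<-* 0<½ (0<-* 0<θ 0<θ)

    x≤1 : x ≤ 1ℚ
    x≤1 = *-mono-≤ 0≤½ 0≤1 (from-yes (½ ≤? 1ℚ)) (*-mono-≤ (<⇒≤ 0<θ) 0≤1 θ≤1 θ≤1)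

    shrink-δ = shrink (0≤-+ 0≤4 0≤1) (0<-* 0<x 0<x)

  δ = proj₁ shrink-δ

  0<δ : 0ℚ < δ
  0<δ = proj₁ (proj₂ shrink-δ)

  5δ≤ : (δ + δ) + (δ + δ) + δ ≤ (½ * (θ * θ)) * (½ * (θ * θ))
  5δ≤ = ≤-trans (≤-reflexive (lem δ)) (proj₂ (proj₂ shrink-δ))
    where
    lem : ∀ d → (d + d) + (d + d) + d ≡ ((1ℚ + 1ℚ) * (1ℚ + 1ℚ) + 1ℚ) * d
    lem = solve-∀ ring

  2δ≤ : δ + δ ≤ ½ * (θ * θ)
  2δ≤ = begin
    δ + δ                    ≤⟨ ≤-by (δ + δ + δ) (0≤-+ (0≤-+ 0≤δ 0≤δ) 0≤δ) (lem δ) ⟩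
    (δ + δ) + (δ + δ) + δ    ≤⟨ 5δ≤ ⟩
    x * x                    ≤⟨ *-monoˡ x (<⇒≤ 0<x) x≤1 ⟩
    x * 1ℚ                   ≡⟨ *-identityʳ x ⟩
    x                        ∎
    where
    open ≤-Reasoning
    0≤δ = <⇒≤ 0<δ
    lem : ∀ d → (d + d) + (d + d) + d ≡ d + d + (d + d + d)
    lem = solve-∀ ring

  module _ {n : ℕ} {{nz : ℕ.NonZero n}}
    (A : Average.Kernel n) (A-sym : ∀ x y → A x y ≡ A y x)
    (0≤A : ∀ x y → 0ℚ ≤ A x y) (A≤1 : ∀ x y → A x y ≤ 1ℚ)
    {p : ℚ} (p₀≤p : p₀ ≤ p) (p≤1 : p ≤ 1ℚ)
    where
    open Average n
    private
      W : Kernel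
      W x y = A x y * codegree A x y

      c : ℚ
      c = p * p * p

      0≤p₀ : 0ℚ ≤ p₀
      0≤p₀ = <⇒≤ 0<p₀

      0≤p : 0ℚ ≤ p
      0≤p = ≤-trans 0≤p₀ p₀≤p

      c₀≤c : c₀ ≤ c
      c₀≤c = *-mono-≤ (0≤-square p₀) 0≤p (*-mono-≤ 0≤p₀ 0≤p p₀≤p p₀≤p) p₀≤p

      c≤1 : c ≤ 1ℚ
      c≤1 = *-mono-≤ (0≤-square p) 0≤1 (*-mono-≤ 0≤p 0≤1 p≤1 p≤1) p≤1

      0<c : 0ℚ < c
      0<c = <-≤-trans 0<c₀ c₀≤c

    quasirandom : c - δ ≤ E₂ W → E₂ (λ x y → codegree W x y * codegree W x y) ≤ (c * c) * (c * c) + δ →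
      CutSmall ε (λ x y → A x y - p)
    quasirandom density four-cycles = cutSmall-weaken total
      (cutSmall-cong (λ x y → lem (A x y) (U x y) p) (cutSmall-+ A-U-small (cutSmall-L¹ (U≈p steps 0≤p p≤1 refl))))
      where
      lem : ∀ a u p → (a - u) + (u - p) ≡ a - p
      lem = solve-∀ ring
      W-sym : ∀ x y → W x y ≡ W y x
      W-sym x y = cong₂ _*_ (A-sym x y) (E-cong λ z → *-comm (A x z) (A y z))
      open Reciprocal A 0≤A A≤1 0<c c≤1 (<⇒≤ 0<γ)
        (FourCycle.cutSmall W W-sym (<⇒≤ 0<c) c≤1 (<⇒≤ 0<δ) (<⇒≤ 0<θ) (<⇒≤ 0<γ) 5δ≤ 2δ≤ ≤γγ density four-cycles)
      open Estimates k j (≤μ c₀≤c c≤1) (≤ν c₀≤c c≤1)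
      A-U-small : CutSmall κ (λ x y → A x y - U x y)
      A-U-small = cutSmall-weaken μν≤κ A≈U
      0≤4κ : 0ℚ ≤ 4ℚ * κ
      0≤4κ = 0≤-* 0≤4 (<⇒≤ 0<κ)
      open Constancy β U U-sym 0<c c≤1 0≤M (16≤Mcc c₀≤c) 0≤4κ ½c≤β β≤1 c≤U U≤2 U*β≡c
        (≤-trans (β≈U² A-U-small) ν+3κ≤4κ)
      total : κ + M * (2ℚ * (4ℚ * κ) + (4ℚ * row-bound steps + 4ℚ * row-bound steps)) ≤ ε
      total = begin
        κ + M * (2ℚ * (4ℚ * κ) + (4ℚ * row-bound steps + 4ℚ * row-bound steps))
          ≡⟨ collect M κ (½ ^ steps) amp ⟩
        L₂ * κ + L₁ * ½ ^ steps
          ≤⟨ +-mono-≤ L₂κ≤ ½^steps≤ ⟩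
        ½ * ε + ½ * ε
          ≡⟨ halves ε ⟩
        ε ∎
        where
        open ≤-Reasoning
        collect : ∀ M κ h a →
          κ + M * ((1ℚ + 1ℚ) * ((1ℚ + 1ℚ) * (1ℚ + 1ℚ) * κ) +
            ((1ℚ + 1ℚ) * (1ℚ + 1ℚ) * (M * (((1ℚ + 1ℚ) * ((1ℚ + 1ℚ) * (1ℚ + 1ℚ) * κ) + (1ℚ + 1ℚ) * ((1ℚ + 1ℚ) * (1ℚ + 1ℚ) * κ)) + (1ℚ + 1ℚ) * ((1ℚ + 1ℚ) * (1ℚ + 1ℚ) * ((M - 1ℚ) * h) + M * (a * ((1ℚ + 1ℚ) * (1ℚ + 1ℚ) * κ) + a * ((1ℚ + 1ℚ) * (1ℚ + 1ℚ) * κ)))))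
            + (1ℚ + 1ℚ) * (1ℚ + 1ℚ) * (M * (((1ℚ + 1ℚ) * ((1ℚ + 1ℚ) * (1ℚ + 1ℚ) * κ) + (1ℚ + 1ℚ) * ((1ℚ + 1ℚ) * (1ℚ + 1ℚ) * κ)) + (1ℚ + 1ℚ) * ((1ℚ + 1ℚ) * (1ℚ + 1ℚ) * ((M - 1ℚ) * h) + M * (a * ((1ℚ + 1ℚ) * (1ℚ + 1ℚ) * κ) + a * ((1ℚ + 1ℚ) * (1ℚ + 1ℚ) * κ)))))))
          ≡ (1ℚ + M * ((1ℚ + 1ℚ) * ((1ℚ + 1ℚ) * (1ℚ + 1ℚ)) + (1ℚ + 1ℚ) * ((1ℚ + 1ℚ) * (1ℚ + 1ℚ)) * M * ((1ℚ + 1ℚ) * (1ℚ + 1ℚ) * ((1ℚ + 1ℚ) * (1ℚ + 1ℚ)) + (1ℚ + 1ℚ) * (1ℚ + 1ℚ) * ((1ℚ + 1ℚ) * (1ℚ + 1ℚ)) * M * a))) * κ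
            + (1ℚ + 1ℚ) * (1ℚ + 1ℚ) * ((1ℚ + 1ℚ) * (1ℚ + 1ℚ)) * ((1ℚ + 1ℚ) * (1ℚ + 1ℚ)) * (M * M * (M - 1ℚ)) * h
        collect = solve-∀ ring

-- Counting homomorphisms

indicator : ∀ {P : Set} → Dec P → ℚ
indicator d = if does d then 1ℚ else 0ℚ

0≤indicator : ∀ {P : Set} (d : Dec P) → 0ℚ ≤ indicator d
0≤indicator (yes _) = 0≤1
0≤indicator (no _)  = ≤-refl

indicator≤1 : ∀ {P : Set} (d : Dec P) → indicator d ≤ 1ℚ
indicator≤1 (yes _) = ≤-refl
indicator≤1 (no _)  = 0≤1

indicator-yes : ∀ {P : Set} (d : Dec P) → P → indicator d ≡ 1ℚ
indicator-yes (yes _) p = refl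
indicator-yes (no ¬p) p = ⊥-elim (¬p p)

indicator-unique : ∀ {P : Set} {x} (d : Dec P) → (P → x ≡ 1ℚ) → (¬ P → x ≡ 0ℚ) → indicator d ≡ x
indicator-unique (yes p) x≡1 x≡0 = sym (x≡1 p)
indicator-unique (no ¬p) x≡1 x≡0 = sym (x≡0 ¬p)

indicator-× : ∀ {P Q : Set} (d : Dec P) (e : Dec Q) → indicator (d ×-dec e) ≡ indicator d * indicator e
indicator-× (yes _) e = sym (*-identityˡ (indicator e))
indicator-× (no _)  e = sym (*-zeroˡ (indicator e))

module _ {A : Set} {P : Pred A 0ℓ} (P? : Decidable P) where

  count : List A → ℚ
  count xs = fromNat (length (filter P? xs))

  count-∷ : ∀ x xs → count (x ∷ xs) ≡ indicator (P? x) + count xs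
  count-∷ x xs with does (P? x)
  ... | true  = fromNat-+ 1 (length (filter P? xs))
  ... | false = sym (+-identityˡ (count xs))

  count-++ : ∀ xs ys → count (xs ++ ys) ≡ count xs + count ys
  count-++ xs ys = trans (cong fromNat (trans (cong length (List.filter-++ P? xs ys))
    (List.length-++ (filter P? xs)))) (fromNat-+ (length (filter P? xs)) (length (filter P? ys)))

  count-tabulate : ∀ {N} (f : Fin N → A) → count (tabulate f) ≡ sum (λ i → indicator (P? (f i)))
  count-tabulate {zero}  f = refl
  count-tabulate {suc N} f = trans (count-∷ (f zero) (tabulate (f ∘ suc)))
    (cong (indicator (P? (f zero)) +_) (count-tabulate (f ∘ suc)))

count-product : ∀ {A B : Set} {P : Pred (A × B) 0ℓ} (P? : Decidable P) {M N} (f : Fin M → A) (g : Fin N → B) →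
  count P? (cartesianProduct (tabulate f) (tabulate g)) ≡ sum (λ i → sum (λ j → indicator (P? (f i , g j))))
count-product P? {zero}  f g = refl
count-product P? {suc M} f g = begin
  count P? (List.map (f zero ,_) (tabulate g) ++ cartesianProduct (tabulate (f ∘ suc)) (tabulate g))
    ≡⟨ count-++ P? (List.map (f zero ,_) (tabulate g)) _ ⟩
  count P? (List.map (f zero ,_) (tabulate g)) + count P? (cartesianProduct (tabulate (f ∘ suc)) (tabulate g))
    ≡⟨ cong₂ _+_ (trans (cong (count P?) (List.map-tabulate g (f zero ,_))) (count-tabulate P? (λ j → f zero , g j)))
         (count-product P? (f ∘ suc) g) ⟩
  sum (λ i → sum (λ j → indicator (P? (f i , g j)))) ∎
  where open ≡-Reasoning

sum-+ : ∀ m {n} (f : Fin (m ℕ.+ n) → ℚ) → sum f ≡ sum (λ i → f (i ↑ˡ n)) + sum (λ j → f (m ↑ʳ j))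
sum-+ zero    f = sym (+-identityˡ (sum f))
sum-+ (suc m) f = trans (cong (f zero +_) (sum-+ m (f ∘ suc))) (sym (+-assoc (f zero) _ _))

sum-combine : ∀ m n (f : Fin (m ℕ.* n) → ℚ) → sum f ≡ sum (λ i → sum (λ j → f (combine {m} {n} i j)))
sum-combine zero    n f = refl
sum-combine (suc m) n f = trans (sum-+ n f) (cong (sum (λ j → f (j ↑ˡ (m ℕ.* n))) +_) (sum-combine m n (λ i → f (n ↑ʳ i))))

finToFun-combine : ∀ {m n} (v : Fin m) (j : Fin (m ℕ.^ n)) i → finToFun {m} {suc n} (combine v j) i ≡ (v Vector.∷ finToFun j) i
finToFun-combine {m} {n} v j zero    = cong proj₁ (Fin.remQuot-combine v j)
finToFun-combine {m} {n} v j (suc i) = cong (λ r → finToFun {m} {n} (proj₂ r) i) (Fin.remQuot-combine v j)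

/-*-cancel : ∀ h N .{{_ : ℕ.NonZero N}} → (ℤ.+ h / N) * fromNat N ≡ fromNat h
/-*-cancel h (suc N) = toℚᵘ-injective (begin
  toℚᵘ ((ℤ.+ h / suc N) * fromNat (suc N))
    ≈⟨ toℚᵘ-homo-* (ℤ.+ h / suc N) (fromNat (suc N)) ⟩
  toℚᵘ (ℤ.+ h / suc N) ℚᵘ.* toℚᵘ (fromNat (suc N))
    ≈⟨ ℚᵘ.*-cong (toℚᵘ-fromℚᵘ (ℚᵘ.mkℚᵘ (ℤ.+ h) N)) (toℚᵘ-fromNat (suc N)) ⟩
  ℚᵘ.mkℚᵘ (ℤ.+ h) N ℚᵘ.* ℚᵘ.mkℚᵘ (ℤ.+ suc N) 0
    ≈⟨ ℚᵘ.*≡* (trans (ℤ.*-identityʳ _) (cong (λ d → ℤ.+ h ℤ.* (ℤ.+ d)) (sym (ℕ.*-identityʳ (suc N))))) ⟩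
  ℚᵘ.mkℚᵘ (ℤ.+ h) 0
    ≈⟨ toℚᵘ-fromNat h ⟨
  toℚᵘ (fromNat h) ∎)
  where open ℚᵘ.≃-Reasoning

module _ {n : ℕ} {{nz : ℕ.NonZero n}} where
  open Average n

  n*E≡sum : ∀ f → fromNat n * E f ≡ sum f
  n*E≡sum f = trans (cong (fromNat n *_) (E-def f)) (trans (sym (*-assoc (fromNat n) n⁻¹ (sum f)))
    (trans (cong (_* sum f) n*n⁻¹≡1) (*-identityˡ (sum f))))

  -- The average over all `k`-tuples, taken one coordinate at a time so that for a concrete graph it
  -- reduces by computation to nested averages over the vertices.
  Ê : ∀ k → ((Fin k → V) → ℚ) → ℚ
  Ê zero    F = F λ ()
  Ê (suc k) F = E λ v → Ê k λ g → F (v Vector.∷ g)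

  -- `F-ext` stands in for function extensionality: the tuple decoded from a combined index agrees
  -- with the extended tuple only pointwise.
  Ê≡sum : ∀ k (F : (Fin k → V) → ℚ) → (∀ {g h} → (∀ i → g i ≡ h i) → F g ≡ F h) →
    fromNat (n ℕ.^ k) * Ê k F ≡ sum (λ i → F (finToFun {n} {k} i))
  Ê≡sum zero    F F-ext = trans (*-identityˡ (F λ ())) (trans (F-ext λ ()) (sym (+-identityʳ _)))
  Ê≡sum (suc k) F F-ext = begin
    fromNat (n ℕ.* n ℕ.^ k) * E (λ v → Ê k (F∷ v))
      ≡⟨ cong (_* E (λ v → Ê k (F∷ v))) (fromNat-* n (n ℕ.^ k)) ⟩
    fromNat n * fromNat (n ℕ.^ k) * E (λ v → Ê k (F∷ v))
      ≡⟨ *-assoc (fromNat n) (fromNat (n ℕ.^ k)) _ ⟩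
    fromNat n * (fromNat (n ℕ.^ k) * E (λ v → Ê k (F∷ v)))
      ≡⟨ cong (fromNat n *_) (E-* (fromNat (n ℕ.^ k)) (λ v → Ê k (F∷ v))) ⟨
    fromNat n * E (λ v → fromNat (n ℕ.^ k) * Ê k (F∷ v))
      ≡⟨ n*E≡sum (λ v → fromNat (n ℕ.^ k) * Ê k (F∷ v)) ⟩
    sum (λ v → fromNat (n ℕ.^ k) * Ê k (F∷ v))
      ≡⟨ sum-cong-≗ (λ v → Ê≡sum k (F∷ v) λ g≗h → F-ext λ { zero → refl ; (suc i) → g≗h i }) ⟩
    sum (λ v → sum (λ j → F (v Vector.∷ finToFun {n} {k} j)))
      ≡⟨ sum-cong-≗ (λ v → sum-cong-≗ λ j → F-ext (finToFun-combine {n} {k} v j)) ⟨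
    sum (λ v → sum (λ j → F (finToFun {n} {suc k} (combine {n} {n ℕ.^ k} v j))))
      ≡⟨ sum-combine n (n ℕ.^ k) (λ i → F (finToFun {n} {suc k} i)) ⟨
    sum (λ i → F (finToFun {n} {suc k} i)) ∎
    where
    open ≡-Reasoning
    F∷ : V → (Fin k → V) → ℚ
    F∷ v g = F (v Vector.∷ g)

module _ (G : Graph) where
  open Graph G using (order; _~_; _~?_; ~-sym; nonEmpty)
  open Average order

  adjacency : Kernel
  adjacency x y = indicator (x ~? y)

  adjacency-sym : ∀ x y → adjacency x y ≡ adjacency y x
  adjacency-sym x y with x ~? y | y ~? x
  ... | yes _   | yes _   = refl
  ... | yes x~y | no ¬y~x = ⊥-elim (¬y~x (~-sym x~y))
  ... | no ¬x~y | yes y~x = ⊥-elim (¬x~y (~-sym y~x))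
  ... | no _    | no _    = refl

  edgeProduct : ∀ {k} → (Fin k → V) → List (Fin k × Fin k) → ℚ
  edgeProduct g []             = 1ℚ
  edgeProduct g ((u , v) ∷ es) = adjacency (g u) (g v) * edgeProduct g es

  edgeProduct-ext : ∀ {k} {g h : Fin k → V} → (∀ i → g i ≡ h i) → ∀ es → edgeProduct g es ≡ edgeProduct h es
  edgeProduct-ext g≗h []             = refl
  edgeProduct-ext g≗h ((u , v) ∷ es) =
    cong₂ _*_ (cong₂ adjacency (g≗h u) (g≗h v)) (edgeProduct-ext g≗h es)

  edgeProduct-yes : ∀ {k} {g : Fin k → V} {es} → All (λ (u , v) → g u ~ g v) es → edgeProduct g es ≡ 1ℚ
  edgeProduct-yes []        = refl
  edgeProduct-yes (e ∷ all) = cong₂ _*_ (indicator-yes (_ ~? _) e) (edgeProduct-yes all)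

  edgeProduct-no : ∀ {k} {g : Fin k → V} es → ¬ All (λ (u , v) → g u ~ g v) es → edgeProduct g es ≡ 0ℚ
  edgeProduct-no         []             ¬all = ⊥-elim (¬all [])
  edgeProduct-no {g = g} ((u , v) ∷ es) ¬all with g u ~? g v
  ... | yes e = trans (*-identityˡ _) (edgeProduct-no es λ all → ¬all (e ∷ all))
  ... | no _  = *-zeroˡ (edgeProduct g es)

  module _ (F : Graph) where
    private module F = Graph F

    ∈edges : ∀ {u v} → u Fin.< v → u F.~ v → (u , v) ∈ˡ F.edges
    ∈edges u<v u~v = ∈-filter⁺ (λ (u , v) → (u Fin.<? v) ×-dec (u F.~? v))
      (∈-cartesianProduct⁺ (∈-allFin _) (∈-allFin _)) (u<v , u~v)

    hom⇒all : ∀ {g} → IsHom F G g → All (λ (u , v) → g u ~ g v) F.edges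
    hom⇒all h = All.tabulate λ {(u , v)} e → h u v (proj₂ (proj₂ (∈-filter⁻
      (λ (u , v) → (u Fin.<? v) ×-dec (u F.~? v))
      {xs = cartesianProduct (allFin F.order) (allFin F.order)} e)))

    all⇒hom : ∀ {g} → All (λ (u , v) → g u ~ g v) F.edges → IsHom F G g
    all⇒hom all u v u~v with Fin.<-cmp u v
    ... | tri< u<v _ _ = All.lookup all (∈edges u<v u~v)
    ... | tri≈ _ u≡v _ = ⊥-elim (F.~-irrefl u≡v u~v)
    ... | tri> _ _ v<u = ~-sym (All.lookup all (∈edges v<u (F.~-sym u~v)))

    indicator-hom : ∀ g → indicator (isHom? F G g) ≡ edgeProduct g F.edges
    indicator-hom g = indicator-unique (isHom? F G g)
      (λ h → edgeProduct-yes (hom⇒all h)) (λ ¬h → edgeProduct-no F.edges λ all → ¬h (all⇒hom all))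

    t≡Ê : t F G ≡ Ê F.order (λ g → edgeProduct g F.edges)
    t≡Ê = ≤-antisym (cancel (≤-reflexive eq)) (cancel (≤-reflexive (sym eq)))
      where
      N = order ℕ.^ F.order
      instance
        N≢0 : ℕ.NonZero N
        N≢0 = ℕ.m^n≢0 order F.order
      cancel : ∀ {x y} → fromNat N * x ≤ fromNat N * y → x ≤ y
      cancel = *-cancelˡ (fromNat N) (0<fromNat N)
      open ≡-Reasoning
      eq : fromNat N * t F G ≡ fromNat N * Ê F.order (λ g → edgeProduct g F.edges)
      eq = begin
        fromNat N * t F G
          ≡⟨ *-comm (fromNat N) (t F G) ⟩
        t F G * fromNat N
          ≡⟨ /-*-cancel (hom F G) N ⟩
        fromNat (hom F G)
          ≡⟨ count-tabulate (isHom? F G ∘ finToFun) id ⟩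
        sum (λ i → indicator (isHom? F G (finToFun i)))
          ≡⟨ sum-cong-≗ (λ i → indicator-hom (finToFun i)) ⟩
        sum (λ i → edgeProduct (finToFun i) F.edges)
          ≡⟨ Ê≡sum F.order (λ g → edgeProduct g F.edges) (λ g≗h → edgeProduct-ext g≗h F.edges) ⟨
        fromNat N * Ê F.order (λ g → edgeProduct g F.edges) ∎

  triangleKernel : Kernel
  triangleKernel x y = adjacency x y * codegree adjacency x y

  t-K₃ : t K₃ G ≡ E₂ triangleKernel
  t-K₃ = trans (t≡Ê K₃) (E₂-cong λ x y →
    trans (E-cong λ z → lem (adjacency x y) (adjacency x z) (adjacency y z))
          (E-* (adjacency x y) (λ z → adjacency x z * adjacency y z)))
    where
    lem : ∀ a b c → a * (b * (c * 1ℚ)) ≡ a * (b * c)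
    lem = solve-∀ ring

  -- The cycle runs through `x`, `y`, `z`, `w`, and `a`, `b`, `c`, `d` are the apexes over `xy`,
  -- `xw`, `yz`, `zw`. Averaging out an apex produces a value of `B`, which turns its edge into a
  -- value of `W`; for fixed `x` and `z` the opposite vertices `y` and `w` are then independent.
  t-C₄△ : t (C₄ △) G ≡ E₂ (λ x z → codegree triangleKernel x z * codegree triangleKernel x z)
  t-C₄△ = begin
    t (C₄ △) G
      ≡⟨ t≡Ê (C₄ △) ⟩
    E₂ (λ x y → E₂ λ z w → E₂ λ a b → E₂ λ c d →
      A x y * (A x w * (A x a * (A x b * (A y z * (A y a * (A y c * (A z w * (A z c * (A z d * (A w b * (A w d * 1ℚ))))))))))))
      ≡⟨ E₂-cong (λ x y → E₂-cong λ z w → apexes x y z w) ⟩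
    E₂ (λ x y → E₂ λ z w → W x y * W z y * (W x w * W z w))
      ≡⟨ E-cong (λ x → E-swap (λ y z → E λ w → W x y * W z y * (W x w * W z w))) ⟩
    E₂ (λ x z → E₂ λ y w → W x y * W z y * (W x w * W z w))
      ≡⟨ E₂-cong (λ x z → E-product (λ y → W x y * W z y) (λ w → W x w * W z w)) ⟩
    E₂ (λ x z → codegree W x z * codegree W x z) ∎
    where
    open ≡-Reasoning
    A = adjacency
    W = triangleKernel
    B = codegree A
    W-sym : ∀ x y → W x y ≡ W y x
    W-sym x y = cong₂ _*_ (adjacency-sym x y) (E-cong λ z → *-comm (A x z) (A y z))
    lem₁ : ∀ xy xw xa xb yz ya yc zw zc zd wb wd →
      xy * (xw * (xa * (xb * (yz * (ya * (yc * (zw * (zc * (zd * (wb * (wd * 1ℚ))))))))))) ≡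
      xy * xw * (yz * zw) * (xa * ya * (xb * wb)) * (yc * zc * (zd * wd))
    lem₁ = solve-∀ ring
    lem₂ : ∀ xy xw yz zw a b c d → xy * xw * (yz * zw) * (a * b) * (c * d) ≡
      xy * a * (yz * c) * (xw * b * (zw * d))
    lem₂ = solve-∀ ring
    apexes : ∀ x y z w → E₂ (λ a b → E₂ λ c d →
      A x y * (A x w * (A x a * (A x b * (A y z * (A y a * (A y c * (A z w * (A z c * (A z d * (A w b * (A w d * 1ℚ))))))))))))
      ≡ W x y * W z y * (W x w * W z w)
    apexes x y z w = begin
      E₂ (λ a b → E₂ λ c d →
        A x y * (A x w * (A x a * (A x b * (A y z * (A y a * (A y c * (A z w * (A z c * (A z d * (A w b * (A w d * 1ℚ))))))))))))
        ≡⟨ E₂-cong (λ a b → E₂-cong λ c d → lem₁ (A x y) (A x w) (A x a) (A x b) (A y z) (A y a) (A y c) (A z w) (A z c) (A z d) (A w b) (A w d)) ⟩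
      E₂ (λ a b → E₂ λ c d → k * (A x a * A y a * (A x b * A w b)) * (A y c * A z c * (A z d * A w d)))
        ≡⟨ E₂-cong (λ a b → trans (E₂-* (k * (A x a * A y a * (A x b * A w b))) (λ c d → A y c * A z c * (A z d * A w d)))
             (cong (k * (A x a * A y a * (A x b * A w b)) *_) (E-product (λ c → A y c * A z c) (λ d → A z d * A w d)))) ⟩
      E₂ (λ a b → k * (A x a * A y a * (A x b * A w b)) * (B y z * B z w))
        ≡⟨ trans (E-cong λ a → E-*ʳ (λ b → k * (A x a * A y a * (A x b * A w b))) (B y z * B z w))
                 (E-*ʳ (λ a → E λ b → k * (A x a * A y a * (A x b * A w b))) (B y z * B z w)) ⟩
      E₂ (λ a b → k * (A x a * A y a * (A x b * A w b))) * (B y z * B z w)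
        ≡⟨ cong (_* (B y z * B z w)) (trans (E₂-* k (λ a b → A x a * A y a * (A x b * A w b)))
             (cong (k *_) (E-product (λ a → A x a * A y a) (λ b → A x b * A w b)))) ⟩
      k * (B x y * B x w) * (B y z * B z w)
        ≡⟨ lem₂ (A x y) (A x w) (A y z) (A z w) (B x y) (B x w) (B y z) (B z w) ⟩
      W x y * W y z * (W x w * W z w)
        ≡⟨ cong (λ v → W x y * v * (W x w * W z w)) (W-sym y z) ⟩
      W x y * W z y * (W x w * W z w) ∎
      where
      k = A x y * A x w * (A y z * A z w)

-- Edge counts between vertex subsets

size≡sum : ∀ {n} (X : Subset n) → fromNat (size X) ≡ sum (λ x → indicator (x ∈? X))
size≡sum []          = refl
size≡sum (true  ∷ X) = trans (fromNat-+ 1 (size X)) (cong (1ℚ +_) (size≡sum X))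
size≡sum (false ∷ X) = trans (size≡sum X) (sym (+-identityˡ _))

module _ (G : Graph) where
  open Graph G using (order; _~?_; nonEmpty)
  open Average order

  private
    N : ℚ
    N = fromNat order

    0≤N : 0ℚ ≤ N
    0≤N = 0≤fromNat order

    χ : Subset order → Fun
    χ X x = indicator (x ∈? X)

    χ-bdd : ∀ X → Bounded (χ X)
    χ-bdd X x = 0≤x≤1⇒∣x∣≤1 (0≤indicator (x ∈? X)) (indicator≤1 (x ∈? X))

  size≡ : ∀ X → fromNat (size X) ≡ N * E (χ X)
  size≡ X = trans (size≡sum X) (sym (n*E≡sum (χ X)))

  size≤ : ∀ X → fromNat (size X) ≤ N
  size≤ X = begin
    fromNat (size X)  ≡⟨ size≡ X ⟩
    N * E (χ X)    ≤⟨ *-monoˡ N 0≤N (E-≤ λ x → indicator≤1 (x ∈? X)) ⟩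
    N * 1ℚ         ≡⟨ *-identityʳ N ⟩
    N              ∎
    where open ≤-Reasoning

  pairCount≡ : ∀ X Y → fromNat (pairCount G X Y) ≡ N * (N * E₂ (λ x y → χ X x * χ Y y * adjacency G x y))
  pairCount≡ X Y = begin
    fromNat (pairCount G X Y)
      ≡⟨ count-product (λ (x , y) → (x ∈? X) ×-dec (y ∈? Y) ×-dec (x ~? y)) id id ⟩
    sum (λ x → sum (λ y → indicator ((x ∈? X) ×-dec (y ∈? Y) ×-dec (x ~? y))))
      ≡⟨ sum-cong-≗ (λ x → sum-cong-≗ λ y → trans (indicator-× (x ∈? X) ((y ∈? Y) ×-dec (x ~? y)))
           (trans (cong (χ X x *_) (indicator-× (y ∈? Y) (x ~? y))) (sym (*-assoc (χ X x) (χ Y y) _)))) ⟩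
    sum (λ x → sum (K x))
      ≡⟨ sum-cong-≗ (λ x → n*E≡sum (K x)) ⟨
    sum (λ x → N * E (K x))
      ≡⟨ n*E≡sum (λ x → N * E (K x)) ⟨
    N * E (λ x → N * E (K x))
      ≡⟨ cong (N *_) (E-* N (λ x → E (K x))) ⟩
    N * (N * E₂ K) ∎
    where
    open ≡-Reasoning
    K : Kernel
    K x y = χ X x * χ Y y * adjacency G x y

  discrepancy : ∀ {p ε} → CutSmall ε (λ x y → adjacency G x y - p) → ∀ X Y →
    ∣ fromNat (pairCount G X Y) - p * fromNat (size X) * fromNat (size Y) ∣ ≤ ε * (N * N)
  discrepancy {p} {ε} small X Y = begin
    ∣ fromNat (pairCount G X Y) - p * fromNat (size X) * fromNat (size Y) ∣
      ≡⟨ cong ∣_∣ (trans (cong₂ _-_ (pairCount≡ X Y)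
           (cong₂ (λ a b → p * a * b) (size≡ X) (size≡ Y))) (trans
           (lem N (E₂ (λ x y → χ X x * χ Y y * adjacency G x y)) p (E (χ X)) (E (χ Y)))
           (cong (N * N *_) (sym average)))) ⟩
    ∣ N * N * S ∣
      ≡⟨ trans (∣p*q∣≡∣p∣*∣q∣ (N * N) S) (cong (_* ∣ S ∣) (0≤p⇒∣p∣≡p 0≤NN)) ⟩
    N * N * ∣ S ∣
      ≤⟨ *-monoˡ (N * N) 0≤NN (∣x∣-lub S (small (χ X) (χ Y) (χ-bdd X) (χ-bdd Y)) -S≤ε) ⟩
    N * N * ε
      ≡⟨ *-comm (N * N) ε ⟩
    ε * (N * N) ∎
    where
    open ≤-Reasoning
    0≤NN = 0≤-* 0≤N 0≤N
    S : ℚ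
    S = E₂ (λ x y → χ X x * χ Y y * (adjacency G x y - p))
    lem : ∀ N a p x y → N * (N * a) - p * (N * x) * (N * y) ≡ N * N * (a - p * (x * y))
    lem = solve-∀ ring
    lem₂ : ∀ a b k p → a * b * (k - p) ≡ a * b * k - p * (a * b)
    lem₂ = solve-∀ ring
    lem₃ : ∀ s k → s * - k ≡ - (s * k)
    lem₃ = solve-∀ ring
    average : S ≡ E₂ (λ x y → χ X x * χ Y y * adjacency G x y) - p * (E (χ X) * E (χ Y))
    average = trans (E₂-cong λ x y → lem₂ (χ X x) (χ Y y) (adjacency G x y) p)
      (trans (E₂-- (λ x y → χ X x * χ Y y * adjacency G x y) (λ x y → p * (χ X x * χ Y y)))
        (cong (λ z → E₂ (λ x y → χ X x * χ Y y * adjacency G x y) - z)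
          (trans (E₂-* p (λ x y → χ X x * χ Y y)) (cong (p *_) (E-product (χ X) (χ Y))))))
    -S≤ε : - S ≤ ε
    -S≤ε = subst (_≤ ε)
      (trans (E₂-cong λ x y → lem₃ (χ X x * χ Y y) (adjacency G x y - p))
             (E₂-neg (λ x y → χ X x * χ Y y * (adjacency G x y - p))))
      (cutSmall-neg small (χ X) (χ Y) (χ-bdd X) (χ-bdd Y))

opaque
  -- This is `2 ^ k - 1`, a one-sided Lipschitz constant for the `k`-th power when the larger
  -- argument is at most 2.
  lipschitz : ℕ → ℚ
  lipschitz zero    = 0ℚ
  lipschitz (suc k) = 1ℚ + 2ℚ * lipschitz k

  0≤lipschitz : ∀ k → 0ℚ ≤ lipschitz k
  0≤lipschitz zero    = ≤-refl
  0≤lipschitz (suc k) = 0≤-+ 0≤1 (0≤-* 0≤2 (0≤lipschitz k))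

  ^-lipschitz : ∀ k {x y η} → 0ℚ ≤ x → x ≤ 2ℚ → 0ℚ ≤ y → y ≤ 1ℚ → 0ℚ ≤ η → x ≤ y + η →
    x ^ k ≤ y ^ k + lipschitz k * η
  ^-lipschitz zero {η = η} 0≤x x≤2 0≤y y≤1 0≤η x≤y+η = ≤-reflexive (lem η)
    where
    lem : ∀ η → 1ℚ ≡ 1ℚ + 0ℚ * η
    lem = solve-∀ ring
  ^-lipschitz (suc k) {x} {y} {η} 0≤x x≤2 0≤y y≤1 0≤η x≤y+η = begin
    x * x ^ k
      ≤⟨ *-monoˡ x 0≤x (^-lipschitz k 0≤x x≤2 0≤y y≤1 0≤η x≤y+η) ⟩
    x * (y ^ k + lipschitz k * η)
      ≤⟨ ≤-by (y ^ k * (y + η - x) + ((1ℚ - y ^ k) * η + (2ℚ - x) * (lipschitz k * η)))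
           (0≤-+ (0≤-* (0≤-^ k 0≤y) (≤⇒0≤- x≤y+η)) (0≤-+ (0≤-* (≤⇒0≤- (^≤1 k 0≤y y≤1)) 0≤η)
             (0≤-* (≤⇒0≤- x≤2) (0≤-* (0≤lipschitz k) 0≤η))))
           (lem x y (y ^ k) (lipschitz k) η) ⟩
    y * y ^ k + (1ℚ + 2ℚ * lipschitz k) * η ∎
    where
    open ≤-Reasoning
    lem : ∀ x y p l η → y * p + (1ℚ + (1ℚ + 1ℚ) * l) * η ≡
      x * (p + l * η) + (p * (y + η - x) + ((1ℚ - p) * η + ((1ℚ + 1ℚ) - x) * (l * η)))
    lem = solve-∀ ring

-- Here `δ` is an additive error, not the relative one of `Forcing`, and it is uniform over `q` in
-- `[p₀, 1]`: the terms of the sequence representing `p` all have to share it.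
rational-forcing : ∀ {p₀ ε} → 0ℚ < p₀ → p₀ ≤ 1ℚ → 0ℚ < ε →
  ∃ λ δ → 0ℚ < δ × (∀ G {q} → p₀ ≤ q → q ≤ 1ℚ →
    q * q * q - δ ≤ t K₃ G →
    t (C₄ △) G ≤ q * q * q * (q * q * q) * (q * q * q * (q * q * q)) + δ →
    ∀ X Y → ∣ fromNat (pairCount G X Y) - q * fromNat (size X) * fromNat (size Y) ∣ ≤
      ε * (fromNat (Graph.order G) * fromNat (Graph.order G)))
rational-forcing 0<p₀ p₀≤1 0<ε = C.δ , C.0<δ , λ G p₀≤q q≤1 density copies →
  discrepancy G (C.quasirandom {{Graph.nonEmpty G}} (adjacency G) (adjacency-sym G)
    (λ u v → 0≤indicator (Graph._~?_ G u v)) (λ u v → indicator≤1 (Graph._~?_ G u v)) p₀≤q q≤1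
    (≤-trans density (≤-reflexive (t-K₃ G))) (≤-trans (≤-reflexive (sym (t-C₄△ G))) copies))
  where module C = Constants 0<p₀ p₀≤1 0<ε

-- From reals to rationals

-- The hypothesis `p ≤ 1` only yields `q ≤ 1 + η` for late terms `q` of the sequence. The rational
-- statement is therefore applied to the clipped value `q′`, and the difference of at most `η` is
-- absorbed by the tolerances.
module Tolerance {δ ε : ℚ} (0<δ : 0ℚ < δ) (0<ε : 0ℚ < ε) where
  private
    0<½δ : 0ℚ < ½ * δ
    0<½δ = 0<-* 0<½ 0<δ

    L : ℚ
    L = lipschitz 12

    0≤L : 0ℚ ≤ L
    0≤L = 0≤lipschitz 12

    shrink-η = shrink (0≤-* 0≤2 0≤L) 0<½δ

  δ′ η : ℚ
  -- `δ′` enters twice, as the relative error in `Forcing` and as the slack in the order of the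
  -- reals, so `2 * δ′` has to fit into half of `δ`.
  δ′ = ½ * (½ * δ) ⊓ 1ℚ
  -- The three caps provide `2Lη≤½δ`, `q-q′≤ε` and the bound `q ≤ 2` needed by `^-lipschitz`.
  η = proj₁ shrink-η ⊓ (ε ⊓ 1ℚ)

  0<δ′ : 0ℚ < δ′
  0<δ′ = 0<⊓ (0<-* 0<½ 0<½δ) 0<1

  0<η : 0ℚ < η
  0<η = 0<⊓ (proj₁ (proj₂ shrink-η)) (0<⊓ 0<ε 0<1)

  private
    δ′≤1 : δ′ ≤ 1ℚ
    δ′≤1 = p⊓q≤q (½ * (½ * δ)) 1ℚ

    2δ′≤½δ : δ′ + δ′ ≤ ½ * δ
    2δ′≤½δ = ≤-trans (+-mono-≤ δ′≤ δ′≤) (≤-reflexive (halves (½ * δ)))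
      where
      δ′≤ = p⊓q≤p (½ * (½ * δ)) 1ℚ

    η≤ε : η ≤ ε
    η≤ε = ≤-trans (p⊓q≤q (proj₁ shrink-η) (ε ⊓ 1ℚ)) (p⊓q≤p ε 1ℚ)

    η≤1 : η ≤ 1ℚ
    η≤1 = ≤-trans (p⊓q≤q (proj₁ shrink-η) (ε ⊓ 1ℚ)) (p⊓q≤q ε 1ℚ)

    2Lη≤½δ : 2ℚ * L * η ≤ ½ * δ
    2Lη≤½δ = ≤-trans (*-monoˡ (2ℚ * L) (0≤-* 0≤2 0≤L) (p⊓q≤p (proj₁ shrink-η) (ε ⊓ 1ℚ)))
      (proj₂ (proj₂ shrink-η))

  module _ {q : ℚ} (0≤q : 0ℚ ≤ q) (q≤1+η : q ≤ 1ℚ + η) where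
    q′ : ℚ
    q′ = q ⊓ 1ℚ

    q′≤1 : q′ ≤ 1ℚ
    q′≤1 = p⊓q≤q q 1ℚ

    private
      open ≤-Reasoning

      q′≤q : q′ ≤ q
      q′≤q = p⊓q≤p q 1ℚ

      0≤q′ : 0ℚ ≤ q′
      0≤q′ = ⊓-glb 0≤q 0≤1

      q≤q′+η : q ≤ q′ + η
      q≤q′+η with ≤-total q 1ℚ
      ... | inj₁ q≤1 = ≤-by η (<⇒≤ 0<η) (cong (_+ η) (p≤q⇒p⊓q≡p q≤1))
      ... | inj₂ 1≤q = ≤-trans q≤1+η (≤-reflexive (cong (_+ η) (sym (p≥q⇒p⊓q≡q 1≤q))))

    0≤q-q′ : 0ℚ ≤ q - q′
    0≤q-q′ = ≤⇒0≤- q′≤q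

    q-q′≤ε : q - q′ ≤ ε
    q-q′≤ε = ≤-trans (≤-trans (+-monoˡ-≤ (- q′) q≤q′+η) (≤-reflexive (lem q′ η))) η≤ε
      where
      lem : ∀ a b → a + b - a ≡ b
      lem = solve-∀ ring

    lower : ∀ {τ} → (1ℚ - δ′) * q ^ 3 ≤ τ + δ′ → q′ * q′ * q′ - δ ≤ τ
    lower {τ} h = begin
      q′ * q′ * q′ - δ
        ≤⟨ +-monoʳ-≤ (q′ * q′ * q′) (neg-antimono-≤ (≤-trans 2δ′≤½δ ½δ≤δ)) ⟩
      q′ * q′ * q′ - (δ′ + δ′)
        ≡⟨ lem₁ q′ δ′ ⟩
      q′ ^ 3 - δ′ - δ′
        ≤⟨ +-monoˡ-≤ (- δ′) q³-δ′≤ ⟩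
      (1ℚ - δ′) * q′ ^ 3 - δ′
        ≤⟨ +-monoˡ-≤ (- δ′) (≤-trans (*-monoˡ (1ℚ - δ′) (≤⇒0≤- δ′≤1) (^-monoˡ-≤ 3 0≤q′ q′≤q)) h) ⟩
      τ + δ′ - δ′
        ≡⟨ lem₃ τ δ′ ⟩
      τ ∎
      where
      ½δ≤δ : ½ * δ ≤ δ
      ½δ≤δ = ≤-by (½ * δ) (<⇒≤ 0<½δ) (sym (halves δ))
      lem₁ : ∀ q d → q * q * q - (d + d) ≡ q * (q * (q * 1ℚ)) - d - d
      lem₁ = solve-∀ ring
      lem₂ : ∀ a d → (1ℚ - d) * a ≡ a - d + d * (1ℚ - a)
      lem₂ = solve-∀ ring
      lem₃ : ∀ a d → a + d - d ≡ a
      lem₃ = solve-∀ ring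
      q³-δ′≤ : q′ ^ 3 - δ′ ≤ (1ℚ - δ′) * q′ ^ 3
      q³-δ′≤ = ≤-by (δ′ * (1ℚ - q′ ^ 3)) (0≤-* (<⇒≤ 0<δ′) (≤⇒0≤- (^≤1 3 0≤q′ q′≤1)))
        (lem₂ (q′ ^ 3) δ′)

    -- Unlike in `lower`, clipping goes the wrong way here, because the given bound involves
    -- `q ^ 12 ≥ q′ ^ 12`. The Lipschitz estimate pays for the difference.
    upper : ∀ {τ} → τ ≤ (1ℚ + δ′) * q ^ 12 + δ′ →
      τ ≤ q′ * q′ * q′ * (q′ * q′ * q′) * (q′ * q′ * q′ * (q′ * q′ * q′)) + δ
    upper {τ} h = begin
      τ
        ≤⟨ h ⟩
      (1ℚ + δ′) * q ^ 12 + δ′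
        ≤⟨ +-monoˡ-≤ δ′ (*-monoˡ (1ℚ + δ′) (0≤-+ 0≤1 (<⇒≤ 0<δ′))
             (^-lipschitz 12 0≤q q≤2 0≤q′ q′≤1 (<⇒≤ 0<η) q≤q′+η)) ⟩
      (1ℚ + δ′) * (q′ ^ 12 + L * η) + δ′
        ≤⟨ ≤-by (δ′ * (1ℚ - q′ ^ 12) + (1ℚ - δ′) * (L * η))
             (0≤-+ (0≤-* (<⇒≤ 0<δ′) (≤⇒0≤- (^≤1 12 0≤q′ q′≤1)))
                   (0≤-* (≤⇒0≤- δ′≤1) (0≤-* 0≤L (<⇒≤ 0<η))))
             (lem₁ (q′ ^ 12) δ′ L η) ⟩
      q′ ^ 12 + ((δ′ + δ′) + 2ℚ * L * η)
        ≤⟨ +-monoʳ-≤ (q′ ^ 12) (≤-trans (+-mono-≤ 2δ′≤½δ 2Lη≤½δ) (≤-reflexive (halves δ))) ⟩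
      q′ ^ 12 + δ
        ≡⟨ cong (_+ δ) (lem₂ q′) ⟩
      q′ * q′ * q′ * (q′ * q′ * q′) * (q′ * q′ * q′ * (q′ * q′ * q′)) + δ ∎
      where
      q≤2 : q ≤ 2ℚ
      q≤2 = ≤-trans q≤1+η (+-monoʳ-≤ 1ℚ η≤1)
      lem₁ : ∀ a d l η → a + ((d + d) + (1ℚ + 1ℚ) * l * η) ≡
        (1ℚ + d) * (a + l * η) + d + (d * (1ℚ - a) + (1ℚ - d) * (l * η))
      lem₁ = solve-∀ ring
      lem₂ : ∀ q → q * (q * (q * (q * (q * (q * (q * (q * (q * (q * (q * (q * 1ℚ))))))))))) ≡
        q * q * q * (q * q * q) * (q * q * q * (q * q * q))
      lem₂ = solve-∀ ring

corollary1p3 : Forcing K₃ (C₄ △)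
corollary1p3 p ε (p₁ , 0<p₁ , n₁ , p₁≤p) p≤1 (ε₁ , 0<ε₁ , n₂ , ε₁≤ε) =
  -- Capping the witness `p₁` yields a lower bound that is at most 1 and remains a lower bound for
  -- the clipped terms `q ⊓ 1ℚ`.
  transfer (rational-forcing (0<⊓ 0<p₁ 0<1) (p⊓q≤q p₁ 1ℚ) 0<ε₀)
  where
  -- One half of `ε₁` is for the discrepancy at the clipped density, the other for the error of
  -- clipping.
  ε₀ : ℚ
  ε₀ = ½ * ε₁

  0<ε₀ : 0ℚ < ε₀
  0<ε₀ = 0<-* 0<½ 0<ε₁

  transfer : (∃ λ δ → 0ℚ < δ × (∀ G {q} → p₁ ⊓ 1ℚ ≤ q → q ≤ 1ℚ →
      q * q * q - δ ≤ t K₃ G →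
      t (C₄ △) G ≤ q * q * q * (q * q * q) * (q * q * q * (q * q * q)) + δ →
      ∀ X Y → ∣ fromNat (pairCount G X Y) - q * fromNat (size X) * fromNat (size Y) ∣ ≤
        ε₀ * (fromNat (Graph.order G) * fromNat (Graph.order G)))) →
    ∃ λ δ → Defs._<_ Defs.0ℝ δ × (∀ (G : Graph) →
      Defs._≥_ (fromℚ (t K₃ G)) (Defs._*_ (Defs._-_ Defs.1ℝ δ) (Defs._^_ p (Graph.edgeCount K₃))) →
      Defs._≤_ (fromℚ (t (C₄ △) G)) (Defs._*_ (Defs._+_ Defs.1ℝ δ) (Defs._^_ p (Graph.edgeCount (C₄ △)))) →
      Quasirandom ε p G)
  transfer (δ , 0<δ , forcing) = fromℚ δ′ , (δ′ , 0<δ′ , 0 , λ _ _ → ≤-reflexive (+-identityˡ δ′)) , quasirandom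
    where
    open Tolerance 0<δ 0<ε₀

    quasirandom : ∀ G →
      Defs._≥_ (fromℚ (t K₃ G)) (Defs._*_ (Defs._-_ Defs.1ℝ (fromℚ δ′)) (Defs._^_ p (Graph.edgeCount K₃))) →
      Defs._≤_ (fromℚ (t (C₄ △) G)) (Defs._*_ (Defs._+_ Defs.1ℝ (fromℚ δ′)) (Defs._^_ p (Graph.edgeCount (C₄ △)))) →
      Quasirandom ε p G
    -- The five thresholds belong to the lower bounds of `p` and of `ε`, to `p ≤ 1` with tolerance
    -- `η`, and to the two density hypotheses with tolerance `δ′`. Beyond all of them the inequality
    -- holds term by term.
    quasirandom G many-triangles few-copies X Y e 0<e = n₁ ℕ.⊔ n₂ ℕ.⊔ n₃ ℕ.⊔ n₄ ℕ.⊔ n₅ , λ m n≤m →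
      let n₁₂₃₄≤m = ℕ.m⊔n≤o⇒m≤o (n₁ ℕ.⊔ n₂ ℕ.⊔ n₃ ℕ.⊔ n₄) n₅ n≤m
          n₁₂₃≤m  = ℕ.m⊔n≤o⇒m≤o (n₁ ℕ.⊔ n₂ ℕ.⊔ n₃) n₄ n₁₂₃₄≤m
          n₁₂≤m   = ℕ.m⊔n≤o⇒m≤o (n₁ ℕ.⊔ n₂) n₃ n₁₂₃≤m
      in at m
        (≤-trans (≤-reflexive (sym (+-identityˡ p₁))) (p₁≤p m (ℕ.m⊔n≤o⇒m≤o n₁ n₂ n₁₂≤m)))
        (≤-trans (≤-reflexive (sym (+-identityˡ ε₁))) (ε₁≤ε m (ℕ.m⊔n≤o⇒n≤o n₁ n₂ n₁₂≤m)))
        (proj₂ (p≤1 η 0<η) m (ℕ.m⊔n≤o⇒n≤o (n₁ ℕ.⊔ n₂) n₃ n₁₂₃≤m))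
        (proj₂ (many-triangles δ′ 0<δ′) m (ℕ.m⊔n≤o⇒n≤o (n₁ ℕ.⊔ n₂ ℕ.⊔ n₃) n₄ n₁₂₃₄≤m))
        (proj₂ (few-copies δ′ 0<δ′) m (ℕ.m⊔n≤o⇒n≤o (n₁ ℕ.⊔ n₂ ℕ.⊔ n₃ ℕ.⊔ n₄) n₅ n≤m))
      where
      n₃ = proj₁ (p≤1 η 0<η)
      n₄ = proj₁ (many-triangles δ′ 0<δ′)
      n₅ = proj₁ (few-copies δ′ 0<δ′)

      N x y z : ℚ
      N = fromNat (Graph.order G)
      x = fromNat (size X)
      y = fromNat (size Y)
      z = fromNat (pairCount G X Y)

      at : ∀ m → p₁ ≤ seq p m → ε₁ ≤ seq ε m → seq p m ≤ 1ℚ + η →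
        (1ℚ - δ′) * seq p m ^ 3 ≤ t K₃ G + δ′ → t (C₄ △) G ≤ (1ℚ + δ′) * seq p m ^ 12 + δ′ →
        ∣ z + - (seq p m * x * y) ∣ ≤ seq ε m * (N * (N * 1ℚ)) + e
      at m p₁≤q ε₁≤εₘ q≤1+η triangles copies = begin
        ∣ z + - (q * x * y) ∣
          ≡⟨ cong ∣_∣ (split z q r x y) ⟩
        ∣ (z - r * x * y) + - ((q - r) * (x * y)) ∣
          ≤⟨ ∣p+q∣≤∣p∣+∣q∣ (z - r * x * y) (- ((q - r) * (x * y))) ⟩
        ∣ z - r * x * y ∣ + ∣ - ((q - r) * (x * y)) ∣
          ≤⟨ +-mono-≤
               (forcing G (⊓-mono-≤ p₁≤q (≤-refl {1ℚ})) (q′≤1 0≤q q≤1+η) (lower 0≤q q≤1+η triangles) (upper 0≤q q≤1+η copies) X Y)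
               (≤-trans (≤-reflexive (trans (∣-p∣≡∣p∣ ((q - r) * (x * y))) (0≤p⇒∣p∣≡p (0≤-* 0≤q-r (0≤-* 0≤x 0≤y)))))
                 (*-mono-≤ 0≤q-r 0≤NN (q-q′≤ε 0≤q q≤1+η) (*-mono-≤ 0≤x 0≤N (size≤ G X) (size≤ G Y)))) ⟩
        ε₀ * (N * N) + ε₀ * (N * N)
          ≡⟨ lem ε₁ (N * N) ⟩
        ε₁ * (N * N)
          ≤⟨ *-monoʳ-≤-nonNeg (N * N) {{nonNegative 0≤NN}} ε₁≤εₘ ⟩
        seq ε m * (N * N)
          ≡⟨ cong (λ w → seq ε m * (N * w)) (*-identityʳ N) ⟨
        seq ε m * (N * (N * 1ℚ))
          ≤⟨ ≤-by e (<⇒≤ 0<e) refl ⟩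
        seq ε m * (N * (N * 1ℚ)) + e ∎
        where
        open ≤-Reasoning
        q r : ℚ
        q = seq p m
        0≤q : 0ℚ ≤ q
        0≤q = ≤-trans (<⇒≤ 0<p₁) p₁≤q
        r = q′ 0≤q q≤1+η
        0≤q-r : 0ℚ ≤ q - r
        0≤q-r = 0≤q-q′ 0≤q q≤1+η
        0≤N : 0ℚ ≤ N
        0≤N = 0≤fromNat (Graph.order G)
        0≤NN : 0ℚ ≤ N * N
        0≤NN = 0≤-* 0≤N 0≤N
        0≤x : 0ℚ ≤ x
        0≤x = 0≤fromNat (size X)
        0≤y : 0ℚ ≤ y
        0≤y = 0≤fromNat (size Y)
        split : ∀ z q r x y → z + - (q * x * y) ≡ (z - r * x * y) + - ((q - r) * (x * y))
        split = solve-∀ ring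
        lem : ∀ e n → ½ * e * n + ½ * e * n ≡ e * n
        lem = solve-∀ ring
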